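{- Let $k\ge3$, $m\ge1$ and $0<\alpha<1$. Among all $k$-uniform hypertrees with $m$ hyperedges, the first hypertree in $S_\alpha$-order is the hyperpath $P_m^{(k)}$.
   Context: Hypergraphs are finite; $k$-uniform means every hyperedge has exactly $k$ vertices; a hypertree is a connected hypergraph without cycles. The hyperpath $P_m^{(k)}$ is obtained from the path graph with $m$ edges by inserting $k-2$ new vertices (of degree one) into each edge. For a $k$-uniform hypergraph $\mathcal{H}$ on $[n]$, $\mathcal{A}(\mathcal{H})$ is the $k$-order $n$-dimensional tensor with entry $\frac1{(k-1)!}$ at $(i_1,\dots,i_k)$ if $\{i_1,\dots,i_k\}\in E(\mathcal{H})$ and $0$ otherwise; $\mathcal{D}(\mathcal{H})$ is the diagonal tensor of vertex degrees; $\mathcal{A}_\alpha(\mathcal{H})=\alpha\mathcal{D}(\mathcal{H})+(1-\alpha)\mathcal{A}(\mathcal{H})$. For a tensor $\mathcal{T}$, $\mathrm{Tr}_d(\mathcal{T})$ is the sum of the $d$-th powers of all $n(k-1)^{n-1}$ eigenvalues of $\mathcal{T}$ (roots of its characteristic polynomial, with multiplicity); in particular $\mathrm{Tr}_0(\mathcal{T})=n(k-1)^{n-1}$, and for $d\ge1$ $$\mathrm{Tr}_{d}(\mathcal{T})=(k-1)^{n-1}\sum_{d_1+\cdots+d_n=d}\ \prod_{i=1}^{n}\frac{1}{(d_i(k-1))!}\Big(\sum_{\gamma\in[n]^{k-1}}(\mathcal{T})_{i\gamma}\frac{\partial}{\partial a_{i\gamma}}\Big)^{d_i}\mathrm{tr}\big(A^{d(k-1)}\big),$$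 with $A=(a_{ij})$ an $n\times n$ matrix of indeterminates, $d_i\ge0$ integers, $\frac{\partial}{\partial a_{i\gamma}}=\frac{\partial}{\partial a_{i i_2}}\cdots\frac{\partial}{\partial a_{i i_k}}$ for $\gamma=i_2\cdots i_k$. $S_\alpha$-order: for $k$-uniform hypergraphs $\mathcal{H}_1,\mathcal{H}_2$ with $n$ vertices, $\mathcal{H}_1\prec_\alpha\mathcal{H}_2$ if there is $d\in\{1,\dots,n(k-1)^{n-1}-1\}$ with $\mathrm{Tr}_t(\mathcal{A}_\alpha(\mathcal{H}_1))=\mathrm{Tr}_t(\mathcal{A}_\alpha(\mathcal{H}_2))$ for $t=0,\dots,d-1$ and $\mathrm{Tr}_d(\mathcal{A}_\alpha(\mathcal{H}_1))<\mathrm{Tr}_d(\mathcal{A}_\alpha(\mathcal{H}_2))$. "$X$ is the first hypertree in a class" means $X$ is in the class and $X\prec_\alpha\mathcal{H}$ for every $\mathcal{H}$ in the class not isomorphic to $X$. -}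

module Defs where

open import Level using (_⊔_) renaming (suc to lsuc)
open import Algebra.Apartness.Bundles using (HeytingField; HeytingCommutativeRing)
open import Algebra.Bundles using (CommutativeRing)
import Algebra.Definitions.RawMonoid as RawMonoidDefinitions
open import Data.Bool.Base using (Bool; true; if_then_else_)
import Data.Bool.Properties as Bool
open import Data.Fin.Base using (Fin; toℕ; fromℕ<)
import Data.Fin.Properties as Fin
open import Data.Fin.Subset using (Subset; ⁅_⁆; ⋃; ∣_∣) renaming (_∈_ to _∈ₛ_)
open import Data.Fin.Subset.Properties using (_∈?_)
open import Data.List.Base as List
  using (List; []; _∷_; [_]; map; concatMap; cartesianProductWith; allFin; upTo; filter; length)
open import Data.Nat.Base as ℕ using (ℕ; zero; suc; pred; _∸_; _!; NonZero; s≤s)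
open import Data.Nat.DivMod using (_mod_)
open import Data.Nat.GeneralisedArithmetic using (fold)
import Data.Nat.Properties as ℕ
open import Data.Product using (∃-syntax; _×_; _,_; proj₁; map₁)
open import Data.Sum.Base using (_⊎_)
open import Data.Vec.Base as Vec using (Vec; []; _∷_; lookup; tabulate)
import Data.Vec.Properties as Vec
import Data.Vec.Relation.Unary.All as VecAll
open import Data.Vec.Functional using (updateAt)
open import Function.Bundles using (_↔_; _⇔_; Inverse)
open import Function.Definitions using (Injective)
open import Relation.Binary.Construct.Closure.ReflexiveTransitive using (Star)
open import Relation.Binary.Core using (Rel)
open import Relation.Binary.PropositionalEquality
  using (_≡_; sym; trans; cong; subst)
open import Relation.Binary.Structures using (IsStrictPartialOrder)
open import Relation.Nullary using (¬_; Dec; does; yes)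
open import Relation.Nullary.Decidable using (_×-dec_; dec-true)

record OrderedField c ℓ₁ ℓ₂ : Set (lsuc (c ⊔ ℓ₁ ⊔ ℓ₂)) where
  field
    heytingField : HeytingField c ℓ₁ ℓ₂

  open HeytingField heytingField public
    renaming (refl to ≈-refl; sym to ≈-sym; trans to ≈-trans)

  infix 4 _<_
  field
    _<_                  : Rel Carrier ℓ₂
    isStrictPartialOrder : IsStrictPartialOrder _≈_ _<_
    #⇒<⊎>                : ∀ {x y} → x # y → x < y ⊎ y < x
    <⇒#                  : ∀ {x y} → x < y → x # y
    0<1                  : 0# < 1#
    +-monoˡ-<            : ∀ {x y} z → x < y → x + z < y + z
    *-pos                : ∀ {x y} → 0# < x → 0# < y → 0# < x * y

  commutativeRing : CommutativeRing c ℓ₁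
  commutativeRing = HeytingCommutativeRing.commutativeRing heytingCommutativeRing

  open RawMonoidDefinitions (CommutativeRing.+-rawMonoid commutativeRing)
    public using () renaming (_×_ to _·ℕ_)

  fromℕ : ℕ → Carrier
  fromℕ n = n ·ℕ 1#

  fromℕ-pos : ∀ n → .{{NonZero n}} → 0# < fromℕ n
  fromℕ-pos (suc zero)    = <-respʳ-≈ (≈-sym (+-identityʳ 1#)) 0<1
    where open IsStrictPartialOrder isStrictPartialOrder using (<-respʳ-≈)
  fromℕ-pos (suc (suc n)) = <-trans (fromℕ-pos (suc n))
    (<-respˡ-≈ (+-identityˡ _) (+-monoˡ-< (fromℕ (suc n)) 0<1))
    where
    open IsStrictPartialOrder isStrictPartialOrder
      using (<-respˡ-≈) renaming (trans to <-trans)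

  -- The library supplies an inverse of (fromℕ n - 0#), which is ≈ fromℕ n.
  recip : ∀ n → .{{NonZero n}} → Carrier
  recip n = proj₁ (#⇒invertible (#-sym (<⇒# (fromℕ-pos n))))

  1/_! : ℕ → Carrier
  1/ n ! = recip (n !) {{n ℕ.!≢0}}

-- Archimedean, Cauchy complete ordered fields; classically ℝ is the only
-- one up to isomorphism. |x - y| < ε is written x < y + ε and y < x + ε.
record RealNumbers c ℓ₁ ℓ₂ : Set (lsuc (c ⊔ ℓ₁ ⊔ ℓ₂)) where
  field
    orderedField : OrderedField c ℓ₁ ℓ₂

  open OrderedField orderedField public

  IsCauchy : (ℕ → Carrier) → Set (c ⊔ ℓ₂)
  IsCauchy f = ∀ ε → 0# < ε →
    ∃[ N ] ∀ i j → N ℕ.≤ i → N ℕ.≤ j → f i < f j + ε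

  _ConvergesTo_ : (ℕ → Carrier) → Carrier → Set (c ⊔ ℓ₂)
  f ConvergesTo x = ∀ ε → 0# < ε →
    ∃[ N ] ∀ i → N ℕ.≤ i → (f i < x + ε) × (x < f i + ε)

  field
    archimedean    : ∀ x → ∃[ n ] x < fromℕ n
    cauchyComplete : ∀ f → IsCauchy f → ∃[ x ] f ConvergesTo x

-- Vertex set Fin order; injectivity of edge makes {edge j} a set of exactly
-- size hyperedges.
record Hypergraph : Set where
  field
    order         : ℕ
    size          : ℕ
    edge          : Fin size → Subset order
    edge-distinct : Injective _≡_ _≡_ edge

  Vertex : Set
  Vertex = Fin order

  IsEdge : Subset order → Set
  IsEdge S = ∃[ j ] edge j ≡ S

  isEdge? : ∀ S → Dec (IsEdge S)
  isEdge? S = Fin.any? (λ j → Vec.≡-dec Bool._≟_ (edge j) S)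

  degree : Vertex → ℕ
  degree v = length (filter (λ j → v ∈? edge j) (allFin size))

  Adjacent : Vertex → Vertex → Set
  Adjacent u v = ∃[ j ] (u ∈ₛ edge j) × (v ∈ₛ edge j)

  Connected : Set
  Connected = ∀ u v → Star Adjacent u v

  -- v₀ e₀ v₁ e₁ … v_{l-1} e_{l-1} v₀ with l = 2 + p ≥ 2, distinct vertices
  -- and distinct hyperedges; in particular two hyperedges sharing two
  -- vertices form a cycle.
  record Cycle : Set where
    field
      p          : ℕ
      v          : Fin (2 ℕ.+ p) → Vertex
      e          : Fin (2 ℕ.+ p) → Fin size
      v-distinct : Injective _≡_ _≡_ v
      e-distinct : Injective _≡_ _≡_ e
      v∈e        : ∀ i → v i ∈ₛ edge (e i)
      next∈e     : ∀ i → v (suc (toℕ i) mod (2 ℕ.+ p)) ∈ₛ edge (e i)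

open Hypergraph public

Uniform : ℕ → Hypergraph → Set
Uniform k H = ∀ j → ∣ edge H j ∣ ≡ k

IsHypertree : Hypergraph → Set
IsHypertree H = Connected H × ¬ Cycle H

record UniformHypertree (k m : ℕ) (H : Hypergraph) : Set where
  field
    uniform   : Uniform k H
    hypertree : IsHypertree H
    size≡m    : size H ≡ m

record _≅_ (G H : Hypergraph) : Set where
  field
    vertices : Vertex G ↔ Vertex H
    edges    : Fin (size G) ↔ Fin (size H)
    incident : ∀ v j →
      v ∈ₛ edge G j ⇔ Inverse.to vertices v ∈ₛ edge H (Inverse.to edges j)

-- Vertices are numbered along the path. With k - 2 vertices inserted into
-- each edge of the path graph, its original vertices are the multiples of
-- spacing k, which is k - 1 for k ≥ 2, and the j-th hyperedge is the interval
-- from j * spacing k to (j + 1) * spacing k.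
spacing : ℕ → ℕ
spacing k = suc (k ∸ 2)

Between : ℕ → ℕ → ℕ → Set
Between k j i = (j ℕ.* spacing k ℕ.≤ i) × (i ℕ.≤ suc j ℕ.* spacing k)

between? : ∀ k j i → Dec (Between k j i)
between? k j i = (j ℕ.* spacing k ℕ.≤? i) ×-dec (i ℕ.≤? suc j ℕ.* spacing k)

interval : ∀ k m → Fin m → Subset (suc (m ℕ.* spacing k))
interval k m j = tabulate (λ i → does (between? k (toℕ j) (toℕ i)))

interval-≤ : ∀ k m {i j} → interval k m i ≡ interval k m j → toℕ j ℕ.≤ toℕ i
interval-≤ k m {i} {j} eq = ℕ.*-cancelʳ-≤ (toℕ j) (toℕ i) (spacing k) (proj₁ j∋start)
  where
  start : Fin (suc (m ℕ.* spacing k))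
  start = fromℕ< (s≤s (ℕ.*-monoˡ-≤ (spacing k) (ℕ.<⇒≤ (Fin.toℕ<n i))))

  start≡ : toℕ start ≡ toℕ i ℕ.* spacing k
  start≡ = Fin.toℕ-fromℕ< _

  i∋start : Between k (toℕ i) (toℕ start)
  i∋start = ℕ.≤-reflexive (sym start≡)
          , ℕ.≤-trans (ℕ.≤-reflexive start≡) (ℕ.m≤n+m _ (spacing k))

  in? : Fin m → Fin (suc (m ℕ.* spacing k)) → Bool
  in? l v = does (between? k (toℕ l) (toℕ v))

  at-start : in? j start ≡ true
  at-start = trans (sym (Vec.lookup∘tabulate (in? j) start))
    (trans (cong (λ S → lookup S start) (sym eq))
      (trans (Vec.lookup∘tabulate (in? i) start)
        (dec-true (between? k (toℕ i) (toℕ start)) i∋start)))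

  witness : ∀ {A : Set} (a? : Dec A) → does a? ≡ true → A
  witness (yes a) _ = a

  j∋start : Between k (toℕ j) (toℕ i ℕ.* spacing k)
  j∋start = subst (Between k (toℕ j)) start≡ (witness (between? k (toℕ j) (toℕ start)) at-start)

hyperpath : ℕ → ℕ → Hypergraph
hyperpath k m = record
  { order         = suc (m ℕ.* spacing k)
  ; size          = m
  ; edge          = interval k m
  ; edge-distinct = λ eq → Fin.toℕ-injective
      (ℕ.≤-antisym (interval-≤ k m (sym eq)) (interval-≤ k m eq))
  }

words : ∀ n l → List (Vec (Fin n) l)
words n zero    = [ [] ]
words n (suc l) = cartesianProductWith _∷_ (allFin n) (words n l)

-- All (d₁ , … , dₙ) with d₁ + ⋯ + dₙ = d.
compositions : ∀ n (d : ℕ) → List (Vec ℕ n)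
compositions zero    zero    = [ [] ]
compositions zero    (suc d) = []
compositions (suc n) d       =
  concatMap (λ i → map (i ∷_) (compositions n (d ∸ i))) (upTo (suc d))

module Spectral {c ℓ₁ ℓ₂} (F : OrderedField c ℓ₁ ℓ₂) where
  open OrderedField F

  -- T i γ is the entry of T at (i , γ), where γ has k - 1 components.
  Tensor : ℕ → ℕ → Set c
  Tensor k n = Fin n → Vec (Fin n) (k ∸ 1) → Carrier

  -- Polynomials in the n² indeterminates a_ij, as formal sums of terms
  -- coefficient × monomial; a monomial is its matrix of exponents.
  Monomial : ℕ → Set
  Monomial n = Fin n → Fin n → ℕ

  Poly : ℕ → Set c
  Poly n = List (Carrier × Monomial n)

  module _ {n : ℕ} where

    updateExponent : Fin n → Fin n → (ℕ → ℕ) → Monomial n → Monomial n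
    updateExponent i j f e = updateAt e i (λ row → updateAt row j f)

    constant : Carrier → Poly n
    constant x = [ x , (λ _ _ → 0) ]

    indeterminate : Fin n → Fin n → Poly n
    indeterminate i j = [ 1# , updateExponent i j suc (λ _ _ → 0) ]

    scale : Carrier → Poly n → Poly n
    scale x = map (map₁ (x *_))

    infixl 7 _*ₚ_
    _*ₚ_ : Poly n → Poly n → Poly n
    _*ₚ_ = cartesianProductWith
      (λ (x , e) (y , f) → x * y , (λ i j → e i j ℕ.+ f i j))

    ∑ₚ : ∀ {a} {A : Set a} → List A → (A → Poly n) → Poly n
    ∑ₚ xs f = concatMap f xs

    ∂ : Fin n → Fin n → Poly n → Poly n
    ∂ i j = map (λ (x , e) → e i j ·ℕ x , updateExponent i j pred e)

    constantTerm : Poly n → Carrier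
    constantTerm []            = 0#
    constantTerm ((x , e) ∷ p) = (if does isOne? then x else 0#) + constantTerm p
      where
      isOne? : Dec (∀ i j → e i j ≡ 0)
      isOne? = Fin.all? (λ i → Fin.all? (λ j → e i j ℕ.≟ 0))

    -- Aᴺ and its trace, for A the matrix of the indeterminates.
    power : ℕ → Fin n → Fin n → Poly n
    power zero    i j = if does (i Fin.≟ j) then constant 1# else []
    power (suc N) i j = ∑ₚ (allFin n) (λ l → indeterminate i l *ₚ power N l j)

    tracePower : ℕ → Poly n
    tracePower N = ∑ₚ (allFin n) (λ i → power N i i)

    ∂* : ∀ {l} → Fin n → Vec (Fin n) l → Poly n → Poly n
    ∂* i γ p = Vec.foldr (λ _ → Poly n) (∂ i) p γ

  module _ (k : ℕ) {n : ℕ} (T : Tensor k n) where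

    slice : Fin n → Poly n → Poly n
    slice i p = ∑ₚ (words n (k ∸ 1)) (λ γ → scale (T i γ) (∂* i γ p))

    -- ∏ᵢ 1/(dᵢ(k-1))! (slice i)^dᵢ, a composition of (commuting) operators.
    operator : Vec ℕ n → Poly n → Poly n
    operator d p = List.foldr
      (λ i q → scale (1/ (lookup d i ℕ.* (k ∸ 1)) !) (fold q (slice i) (lookup d i)))
      p (allFin n)

    -- The sum of the D-th powers of the n(k-1)^(n-1) eigenvalues of T, written
    -- with the Morozov–Shakirov trace formula.
    -- operator d lowers the degree by exactly that of tr A^(D(k-1)) when the
    -- dᵢ add up to D, so the result is a constant polynomial.
    Tr : ℕ → Carrier
    Tr zero      = fromℕ (n ℕ.* (k ∸ 1) ℕ.^ (n ∸ 1))
    Tr D@(suc _) = fromℕ ((k ∸ 1) ℕ.^ (n ∸ 1)) *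
      constantTerm (∑ₚ (compositions n D)
        (λ d → operator d (tracePower (D ℕ.* (k ∸ 1)))))

  -- The set {i₁ , … , i_k} has fewer than k elements when two indices
  -- coincide, so it is then not a hyperedge of a k-uniform hypergraph.
  adjacencyTensor : ∀ k H → Tensor k (order H)
  adjacencyTensor k H i γ =
    if does (isEdge? H (⋃ (map ⁅_⁆ (i ∷ Vec.toList γ)))) then 1/ (k ∸ 1) ! else 0#

  degreeTensor : ∀ k H → Tensor k (order H)
  degreeTensor k H i γ =
    if does (VecAll.all? (Fin._≟ i) γ) then fromℕ (degree H i) else 0#

  alphaTensor : ∀ k → Carrier → ∀ H → Tensor k (order H)
  alphaTensor k α H i γ =
    α * degreeTensor k H i γ + (1# - α) * adjacencyTensor k H i γ

  -- Only hypergraphs with equally many vertices are comparable.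
  _≺[_,_]_ : Hypergraph → ℕ → Carrier → Hypergraph → Set (ℓ₁ ⊔ ℓ₂)
  G ≺[ k , α ] H = order G ≡ order H ×
    (∃[ d ] 1 ℕ.≤ d × d ℕ.≤ order G ℕ.* (k ∸ 1) ℕ.^ (order G ∸ 1) ∸ 1 ×
      (∀ t → t ℕ.< d → trace G t ≈ trace H t) × trace G d < trace H d)
    where
    trace : Hypergraph → ℕ → Carrier
    trace X = Tr k (alphaTensor k α X)

  IsFirst : ℕ → Carrier → (Hypergraph → Set) → Hypergraph → Set (ℓ₁ ⊔ ℓ₂)
  IsFirst k α Class X = Class X × (∀ H → Class H → ¬ (X ≅ H) → X ≺[ k , α ] H)

{-# OPTIONS --safe #-}

-- By the trace formula, Tr_D is a sum over compositions of D and over choices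
-- of D tensor entries, weighted by the number of closed walks using the arcs of
-- the chosen entries. Closed walks are balanced, and a hypertree carries no
-- nonzero circulation, so each hyperedge is used equally often at all its k
-- vertices. For D < 2k the chosen entries are therefore either D times one
-- diagonal entry, or one hyperedge once at each of its vertices together with
-- D - k diagonal entries at vertices of that hyperedge. Hence, up to positive
-- constants depending on k, D and α only, Tr_D is ∑ᵥ dᵥ^D for D < k, is determined
-- by the degrees for D ≤ k + 1, and Tr_{k+2} adds ∑ₑ ∑_{u<v∈e} d_u d_v.
--
-- A hypertree has n = m(k - 1) + 1 vertices and degree sum mk. If some degree
-- exceeds 2, then ∑ d² exceeds its value for the hyperpath, so Tr_2 decides. If all
-- degrees are at most 2, they agree with those of the hyperpath up to order, and
-- Tr_{k+2} compares ∑ₑ sₑ², where sₑ counts the hyperedges meeting e and ∑ₑ sₑ is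
-- fixed: it exceeds its value for the hyperpath unless all sₑ ≤ 2, in which case
-- the hypertree is a hyperpath.
module Submission where

open import Defs
open import Algebra.Bundles using (CommutativeSemiring; CommutativeRing)
open import Data.Bool.Base using (if_then_else_; true; false; Bool)
import Data.Bool.Properties as Bool
open import Data.Empty using (⊥-elim; ⊥)
open import Data.Fin.Base using (Fin; zero; suc; toℕ; fromℕ<; inject₁)
import Data.Fin.Properties as Fin
open import Data.Fin.Subset using (Subset; ∣_∣; ⁅_⁆; ⋃) renaming (_∈_ to _∈ₛ_)
open import Data.Fin.Subset.Properties using (_∈?_; x∈p∪q⁻; x∈p∪q⁺; x∈⁅x⁆; x∈⁅y⁆⇒x≡y; ∉⊥; ⊆-antisym)
open import Data.List.Base as List
  using (List; []; _∷_; [_]; _++_; map; concatMap; cartesianProductWith; filter; length; allFin; replicate; foldr; lookup; cartesianProduct; upTo)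
import Data.List.Membership.DecPropositional as DecMembership
open import Data.List.Membership.Propositional using (_∈_; _∉_; find; lose)
open import Data.List.Membership.Propositional.Properties
  using (∈-∃++; ∈-++⁺ʳ; ∈-map⁻; ∈-allFin; ∈-map⁺; ∈-filter⁺; ∈-filter⁻; ∈-lookup; ∈-++⁻; ∈-++⁺ˡ; ∈-concatMap⁺; ∈-concatMap⁻; ∈-cartesianProduct⁺; ∈-cartesianProduct⁻; ∈-upTo⁺; ∈-upTo⁻)
import Data.List.Properties as List
open import Data.List.Relation.Binary.Permutation.Propositional
  using (_↭_; refl; prep; swap; trans; ↭-sym; ↭-trans; ↭-reflexive; ↭-refl)
open import Data.List.Relation.Binary.Permutation.Propositional.Properties
  using (∈-resp-↭; shift; ↭-length; ∷↭∷ʳ; ++⁺ˡ; All-resp-↭; drop-∷; ++⁺ʳ; shifts; ++-assoc; map⁺; ++⁺; ++-comm; ↭-singleton-inv)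
open import Data.List.Relation.Unary.All as All using (All; []; _∷_)
import Data.List.Relation.Unary.All.Properties as All
open import Data.List.Relation.Unary.AllPairs as AllPairs using ([]; _∷_; AllPairs)
import Data.List.Relation.Unary.AllPairs.Properties as AllPairs
open import Data.List.Relation.Unary.Any as Any using (here; there; Any; index)
open import Data.List.Relation.Unary.Any.Properties using (lookup-index)
open import Data.List.Relation.Unary.Unique.Propositional using (Unique)
import Data.List.Relation.Unary.Unique.Propositional.Properties as Unique
open import Data.Maybe.Base using (Maybe; just; nothing)
open import Data.Nat.Base as ℕ using (ℕ; zero; suc; s≤s; z≤n; pred; _∸_; _!; NonZero)
open import Data.Nat.DivMod
  using (_mod_; m%n<n; m<n⇒m%n≡m; n%n≡0; m/n*n≤m; m≡m%n+[m/n]*n; m<n*o⇒m/o<n)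
open import Data.Nat.GeneralisedArithmetic using (fold)
import Data.Nat.Properties as ℕ
open import Data.Nat.Tactic.RingSolver using (solve-∀)
open import Data.Product using (_×_; _,_; proj₁; proj₂; map₁; ∃-syntax)
open import Data.Sum.Base using (inj₁; inj₂; _⊎_; [_,_]′)
open import Data.Unit.Base using (⊤; tt)
open import Data.Vec.Base as Vec using (Vec; []; _∷_; here; there)
open import Data.Vec.Functional using (updateAt)
open import Data.Vec.Functional.Properties using (updateAt-updates; updateAt-minimal)
import Data.Vec.Properties as Vec
open import Data.Vec.Relation.Unary.All as VecAll using ([]; _∷_)
open import Function.Base using (_∘_; id)
open import Function.Bundles using (_↔_; mk↔ₛ′; mk⇔; Inverse)
open import Function.Definitions using (Injective)
open import Level using (Level)
open import Relation.Binary.Construct.Closure.ReflexiveTransitive using (Star; ε; _◅_; _◅◅_)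
open import Relation.Binary.Definitions using (tri<; tri≈; tri>)
open import Relation.Binary.PropositionalEquality as ≡ using (_≡_; _≢_; module ≡-Reasoning; refl)
open import Relation.Binary.Structures using (IsStrictPartialOrder)
open import Relation.Nullary using (¬_; Dec; does; yes; no)
open import Relation.Nullary.Decidable using (¬?; decidable-stable; dec-true; _×-dec_)
open import Relation.Unary using (Pred; Decidable)

-- Polynomials enter only through the number `⟨ L , p ⟩`, the constant term of p differentiated
-- along a list L of arcs: matrix powers become counts of closed walks, and tensor entries become
-- arcs added to L. The (k-1)! orderings of a hyperedge have the same arcs up to order and cancel
-- the factor 1/(k-1)!, so a row offers its diagonal entry or one incident hyperedge. The counts are
-- never evaluated. That they do not depend on the hypertree comes from transporting them to k
-- standard vertices along an injection. A sign matters twice: for the diagonal constant at index 2,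
-- and at index k + 2 for the constant of two distinct extra diagonal entries. There one closed walk
-- suffices, an Euler tour of the complete digraph with loops spliced in. The remaining constants
-- only have to agree. The bound k ≥ 3 brings both deciding indices into the tractable range: 2 < k
-- and k + 2 < 2k. The passage from pairs to squares at index k + 2 comes from squaring ∑_{v∈e} d_v
-- = k + sₑ and summing over e: the diagonal terms of the squares add up to ∑ᵥ dᵥ³, which the
-- degrees determine.

module ListCombinatorics where

  -- Lists up to permutation, and finite sums over them

  module UniqueLists {a} {A : Set a} where

    unique-resp-↭ : ∀ {xs ys : List A} → xs ↭ ys → Unique xs → Unique ys
    unique-resp-↭ refl u = u
    unique-resp-↭ (prep x p) (x∉ ∷ u) =
      All.tabulate (λ y∈ → All.lookup x∉ (∈-resp-↭ (↭-sym p) y∈)) ∷ unique-resp-↭ p u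
    unique-resp-↭ (swap x y p) ((x≢y ∷ x∉) ∷ y∉ ∷ u) =
      ((λ y≡x → x≢y (≡.sym y≡x)) ∷ All.tabulate (λ z∈ → All.lookup y∉ (∈-resp-↭ (↭-sym p) z∈)))
      ∷ All.tabulate (λ z∈ → All.lookup x∉ (∈-resp-↭ (↭-sym p) z∈))
      ∷ unique-resp-↭ p u
    unique-resp-↭ (trans p q) u = unique-resp-↭ q (unique-resp-↭ p u)

    ∈⇒↭∷ : ∀ {x : A} {xs} → x ∈ xs → ∃[ ys ] xs ↭ x ∷ ys
    ∈⇒↭∷ {x} x∈ with ys , zs , refl ← ∈-∃++ x∈ = ys ++ zs , shift x ys zs

    private
      drop-head : ∀ {x y : A} {ys zs} → All (y ≢_) ys → x ∈ ys → x ∈ y ∷ zs → x ∈ zs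
      drop-head y∉ x∈ (here refl) = ⊥-elim (All.lookup y∉ x∈ refl)
      drop-head y∉ x∈ (there x∈′)   = x∈′

    -- Splitting off a duplicate-free sublist up to order is the common source of the length
    -- comparisons and of the restriction of sums and products to their support.
    unique-⊆⇒↭++ : ∀ {ys xs : List A} → Unique ys → (∀ {x} → x ∈ ys → x ∈ xs) →
      ∃[ rest ] xs ↭ ys ++ rest
    unique-⊆⇒↭++ {[]} {xs} u sub = xs , refl
    unique-⊆⇒↭++ {y ∷ ys} {xs} (y∉ ∷ u) sub
      with xs′ , p ← ∈⇒↭∷ (sub (here refl))
      with rest , q ← unique-⊆⇒↭++ {ys} {xs′} u
             (λ {x} x∈ → drop-head y∉ x∈ (∈-resp-↭ p (sub (there x∈))))
      = rest , trans p (prep y q)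

    unique-⊆⇒length≤ : ∀ {ys xs : List A} → Unique ys → (∀ {x} → x ∈ ys → x ∈ xs) →
      length ys ℕ.≤ length xs
    unique-⊆⇒length≤ {ys} u sub with rest , p ← unique-⊆⇒↭++ u sub =
      ℕ.≤-trans (ℕ.m≤m+n (length ys) (length rest))
        (ℕ.≤-reflexive (≡.trans (≡.sym (List.length-++ ys)) (≡.sym (↭-length p))))

    -- Pigeonhole: once `ys` is split off, anything left over would make `xs` longer than `ys`.
    unique-⊆-length⇒↭ : ∀ {ys xs : List A} → Unique ys → (∀ {x} → x ∈ ys → x ∈ xs) →
      length xs ℕ.≤ length ys → xs ↭ ys
    unique-⊆-length⇒↭ {ys} u sub xs≤ys with unique-⊆⇒↭++ u sub
    ... | [] , p rewrite List.++-identityʳ ys = p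
    ... | r ∷ rest , p = ⊥-elim (ℕ.<⇒≱ lt xs≤ys)
      where
      lt : length ys ℕ.< _
      lt = ℕ.≤-trans (ℕ.m<m+n (length ys) {suc (length rest)} (s≤s z≤n))
        (ℕ.≤-reflexive (≡.trans (≡.sym (List.length-++ ys)) (≡.sym (↭-length p))))

    unique-⇔⇒↭ : ∀ {xs ys : List A} → Unique xs → Unique ys →
      (∀ {x} → x ∈ xs → x ∈ ys) → (∀ {x} → x ∈ ys → x ∈ xs) → xs ↭ ys
    unique-⇔⇒↭ uxs uys to from = unique-⊆-length⇒↭ uys from (unique-⊆⇒length≤ uxs to)

    unique-++-disjoint : ∀ {x} (xs : List A) {ys} → Unique (xs ++ ys) → x ∈ xs → x ∉ ys
    unique-++-disjoint (_ ∷ xs) (x∉ ∷ u) (here refl) x∈ys =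
      All.lookup x∉ (∈-++⁺ʳ xs x∈ys) refl
    unique-++-disjoint (_ ∷ xs) (_ ∷ u) (there x∈) x∈ys = unique-++-disjoint xs u x∈ x∈ys

    unique-map-on : ∀ {b} {B : Set b} (f : A → B) {xs : List A} →
      (∀ {x y} → x ∈ xs → y ∈ xs → f x ≡ f y → x ≡ y) → Unique xs → Unique (map f xs)
    unique-map-on f inj [] = []
    unique-map-on f inj (x∉ ∷ u) =
      All.map⁺ (All.tabulate (λ y∈ fx≡fy → All.lookup x∉ y∈ (inj (here refl) (there y∈) fx≡fy)))
      ∷ unique-map-on f (λ x∈ y∈ → inj (there x∈) (there y∈)) u

  open UniqueLists public

  concatMap-↭ : ∀ {a b} {A : Set a} {B : Set b} (f : A → List B) {xs ys} → xs ↭ ys → concatMap f xs ↭ concatMap f ys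
  concatMap-↭ f refl         = refl
  concatMap-↭ f (prep x p)   = ++⁺ˡ (f x) (concatMap-↭ f p)
  concatMap-↭ f (swap x y p) = trans (shifts (f x) (f y)) (++⁺ˡ (f y) (++⁺ˡ (f x) (concatMap-↭ f p)))
  concatMap-↭ f (trans p q)  = trans (concatMap-↭ f p) (concatMap-↭ f q)

  module ListSum {c ℓ} (S : CommutativeSemiring c ℓ) where
    open CommutativeSemiring S
      renaming (refl to ≈-refl; sym to ≈-sym; trans to ≈-trans; zero to *-zero)
    open import Relation.Binary.Reasoning.Setoid setoid
    open import Algebra.Properties.CommutativeSemigroup +-commutativeSemigroup using (interchange; x∙yz≈y∙xz)

    ∑ : ∀ {a} {A : Set a} → List A → (A → Carrier) → Carrier
    ∑ []       f = 0#
    ∑ (x ∷ xs) f = f x + ∑ xs f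

    -- The Iverson bracket. Branching on `does` gives it the same form as the conditionals in the
    -- tensors and in `constantTerm`.
    [_]· : ∀ {p} {P : Set p} → Dec P → Carrier → Carrier
    [ p? ]· x = if does p? then x else 0#

    module _ {a} {A : Set a} where

      ∑-cong∈ : ∀ (xs : List A) {f g : A → Carrier} → (∀ {x} → x ∈ xs → f x ≈ g x) → ∑ xs f ≈ ∑ xs g
      ∑-cong∈ []       eq = ≈-refl
      ∑-cong∈ (x ∷ xs) eq = +-cong (eq (here refl)) (∑-cong∈ xs (eq ∘ there))

      ∑-cong : ∀ (xs : List A) {f g : A → Carrier} → (∀ x → f x ≈ g x) → ∑ xs f ≈ ∑ xs g
      ∑-cong xs eq = ∑-cong∈ xs (λ {x} _ → eq x)

      ∑-0 : ∀ (xs : List A) {f : A → Carrier} → (∀ {x} → x ∈ xs → f x ≈ 0#) → ∑ xs f ≈ 0#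
      ∑-0 []       eq = ≈-refl
      ∑-0 (x ∷ xs) eq = ≈-trans (+-cong (eq (here refl)) (∑-0 xs (eq ∘ there))) (+-identityˡ 0#)

      ∑-++ : ∀ (xs ys : List A) {f : A → Carrier} → ∑ (xs ++ ys) f ≈ ∑ xs f + ∑ ys f
      ∑-++ []       ys = ≈-sym (+-identityˡ _)
      ∑-++ (x ∷ xs) ys = ≈-trans (+-congˡ (∑-++ xs ys)) (≈-sym (+-assoc _ _ _))

      ∑-+ : ∀ (xs : List A) {f g : A → Carrier} → ∑ xs (λ x → f x + g x) ≈ ∑ xs f + ∑ xs g
      ∑-+ []       = ≈-sym (+-identityˡ 0#)
      ∑-+ (x ∷ xs) = ≈-trans (+-congˡ (∑-+ xs)) (interchange _ _ _ _)

      ∑-*ˡ : ∀ (xs : List A) {f : A → Carrier} y → y * ∑ xs f ≈ ∑ xs (λ x → y * f x)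
      ∑-*ˡ []       y = zeroʳ y
      ∑-*ˡ (x ∷ xs) y = ≈-trans (distribˡ y _ _) (+-congˡ (∑-*ˡ xs y))

      ∑-↭ : ∀ {xs ys : List A} {f : A → Carrier} → xs ↭ ys → ∑ xs f ≈ ∑ ys f
      ∑-↭ refl         = ≈-refl
      ∑-↭ (prep x p)   = +-congˡ (∑-↭ p)
      ∑-↭ (swap x y p) = ≈-trans (x∙yz≈y∙xz _ _ _) (+-congˡ (+-congˡ (∑-↭ p)))
      ∑-↭ (trans p q)  = ≈-trans (∑-↭ p) (∑-↭ q)

      ∑-filter : ∀ {p} {P : Pred A p} (P? : Decidable P) (xs : List A) {f : A → Carrier} →
        ∑ (filter P? xs) f ≈ ∑ xs (λ x → [ P? x ]· (f x))
      ∑-filter P? [] = ≈-refl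
      ∑-filter P? (x ∷ xs) with does (P? x)
      ... | true  = +-congˡ (∑-filter P? xs)
      ... | false = ≈-trans (∑-filter P? xs) (≈-sym (+-identityˡ _))

      ∑-support : ∀ {ys xs : List A} {f : A → Carrier} → Unique ys → Unique xs →
        (∀ {x} → x ∈ ys → x ∈ xs) → (∀ {x} → x ∈ xs → x ∉ ys → f x ≈ 0#) → ∑ xs f ≈ ∑ ys f
      ∑-support {ys} {xs} {f} uys uxs sub vanish with rest , p ← unique-⊆⇒↭++ uys sub = begin
        ∑ xs f             ≈⟨ ∑-↭ p ⟩
        ∑ (ys ++ rest) f   ≈⟨ ∑-++ ys rest ⟩
        ∑ ys f + ∑ rest f  ≈⟨ +-congˡ (∑-0 rest (λ x∈ → vanish (∈-resp-↭ (↭-sym p) (∈-++⁺ʳ ys x∈))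
                               (λ x∈ys → unique-++-disjoint ys (unique-resp-↭ p uxs) x∈ys x∈))) ⟩
        ∑ ys f + 0#        ≈⟨ +-identityʳ _ ⟩
        ∑ ys f             ∎

      ∑-single : ∀ {xs : List A} {f : A → Carrier} {x} → Unique xs → x ∈ xs →
        (∀ {y} → y ∈ xs → y ≢ x → f y ≈ 0#) → ∑ xs f ≈ f x
      ∑-single {x = x} u x∈ vanish = ≈-trans
        (∑-support ([] ∷ []) u (λ { (here refl) → x∈ })
          (λ y∈ y∉ → vanish y∈ (λ y≡x → y∉ (here y≡x))))
        (+-identityʳ _)

    module _ {a b} {A : Set a} {B : Set b} where

      ∑-map : ∀ (g : A → B) (xs : List A) {f : B → Carrier} → ∑ (map g xs) f ≈ ∑ xs (f ∘ g)
      ∑-map g []       = ≈-refl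
      ∑-map g (x ∷ xs) = +-congˡ (∑-map g xs)

      ∑-concatMap : ∀ (g : A → List B) (xs : List A) {f : B → Carrier} →
        ∑ (concatMap g xs) f ≈ ∑ xs (λ x → ∑ (g x) f)
      ∑-concatMap g []       = ≈-refl
      ∑-concatMap g (x ∷ xs) = ≈-trans (∑-++ (g x) _) (+-congˡ (∑-concatMap g xs))

      ∑-swap : ∀ (xs : List A) (ys : List B) {f : A → B → Carrier} →
        ∑ xs (λ x → ∑ ys (f x)) ≈ ∑ ys (λ y → ∑ xs (λ x → f x y))
      ∑-swap []       ys = ≈-sym (∑-0 ys (λ _ → ≈-refl))
      ∑-swap (x ∷ xs) ys = ≈-trans (+-congˡ (∑-swap xs ys)) (≈-sym (∑-+ ys))

    ∑-cartesianProductWith : ∀ {a b d} {A : Set a} {B : Set b} {D : Set d}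
      (g : A → B → D) (xs : List A) (ys : List B) {f : D → Carrier} →
      ∑ (cartesianProductWith g xs ys) f ≈ ∑ xs (λ x → ∑ ys (λ y → f (g x y)))
    ∑-cartesianProductWith g []       ys = ≈-refl
    ∑-cartesianProductWith g (x ∷ xs) ys =
      ≈-trans (∑-++ (map (g x) ys) _) (+-cong (∑-map (g x) ys) (∑-cartesianProductWith g xs ys))

    []·-yes : ∀ {p} {P : Set p} (p? : Dec P) {x} → P → [ p? ]· x ≈ x
    []·-yes (yes _) pr = ≈-refl
    []·-yes (no ¬p) pr = ⊥-elim (¬p pr)

    []·-no : ∀ {p} {P : Set p} (p? : Dec P) {x} → ¬ P → [ p? ]· x ≈ 0#
    []·-no (yes p) ¬pr = ⊥-elim (¬pr p)
    []·-no (no _)  ¬pr = ≈-refl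

    []·-cong : ∀ {p} {P : Set p} (p? : Dec P) {x y} → (P → x ≈ y) → [ p? ]· x ≈ [ p? ]· y
    []·-cong (yes p) eq = eq p
    []·-cong (no _)  eq = ≈-refl

    []·-⇔ : ∀ {p q} {P : Set p} {Q : Set q} (p? : Dec P) (q? : Dec Q) {x y} →
      (P → Q) → (Q → P) → x ≈ y → [ p? ]· x ≈ [ q? ]· y
    []·-⇔ (yes p) (yes q) to from x≈y = x≈y
    []·-⇔ (yes p) (no ¬q) to from x≈y = ⊥-elim (¬q (to p))
    []·-⇔ (no ¬p) (yes q) to from x≈y = ⊥-elim (¬p (from q))
    []·-⇔ (no ¬p) (no ¬q) to from x≈y = ≈-refl

    []·-*ˡ : ∀ {p} {P : Set p} (p? : Dec P) y x → y * [ p? ]· x ≈ [ p? ]· (y * x)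
    []·-*ˡ p? y x with does p?
    ... | true  = ≈-refl
    ... | false = zeroʳ y

    []·-∑ : ∀ {p} {P : Set p} (p? : Dec P) {a} {A : Set a} (xs : List A) {f : A → Carrier} →
      [ p? ]· (∑ xs f) ≈ ∑ xs (λ x → [ p? ]· (f x))
    []·-∑ p? xs with does p?
    ... | true  = ≈-refl
    ... | false = ≈-sym (∑-0 xs (λ _ → ≈-refl))

  -- Draws every position once, so equal elements are drawn with multiplicity. This is the
  -- bookkeeping of the product rule for derivatives.
  select : ∀ {a} {A : Set a} → List A → List (A × List A)
  select []       = []
  select (x ∷ xs) = (x , xs) ∷ map (λ (y , ys) → y , x ∷ ys) (select xs)

  ∈-select⇒↭ : ∀ {a} {A : Set a} (xs : List A) {y ys} → (y , ys) ∈ select xs → xs ↭ y ∷ ys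
  ∈-select⇒↭ (x ∷ xs) (here refl) = refl
  ∈-select⇒↭ (x ∷ xs) (there p) with (z , zs) , q , refl ← ∈-map⁻ _ p
    = trans (prep x (∈-select⇒↭ xs q)) (swap x _ refl)

  module SelectSum {c ℓ} (S : CommutativeSemiring c ℓ) where
    open CommutativeSemiring S
      renaming (refl to ≈-refl; sym to ≈-sym; trans to ≈-trans; zero to *-zero)
    open import Algebra.Properties.CommutativeSemigroup +-commutativeSemigroup using (x∙yz≈y∙xz)
    open ListSum S

    ∑-select-↭ : ∀ {a} {A : Set a} {xs ys : List A} {f : A × List A → Carrier} →
      (∀ {x zs zs′} → zs ↭ zs′ → f (x , zs) ≈ f (x , zs′)) → xs ↭ ys →
      ∑ (select xs) f ≈ ∑ (select ys) f
    ∑-select-↭ resp refl = ≈-refl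
    ∑-select-↭ {xs = x ∷ xs} {x ∷ ys} resp (prep x p) = +-cong (resp p)
      (≈-trans (∑-map _ (select xs)) (≈-trans (∑-select-↭ (λ q → resp (prep x q)) p) (≈-sym (∑-map _ (select ys)))))
    ∑-select-↭ {xs = x ∷ y ∷ xs} {y ∷ x ∷ ys} {f} resp (swap x y p) =
      ≈-trans (x∙yz≈y∙xz _ _ _) (+-cong (resp (prep x p)) (+-cong (resp (prep y p))
        (≈-trans (twice x y xs)
          (≈-trans (∑-cong (select xs) (λ _ → resp (swap x y refl)))
            (≈-trans (∑-select-↭ (λ q → resp (prep y (prep x q))) p) (≈-sym (twice y x ys)))))))
      where
      twice : ∀ x y zs → ∑ (map (λ (z , zs) → z , x ∷ zs) (map (λ (z , zs) → z , y ∷ zs) (select zs))) f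
        ≈ ∑ (select zs) (λ (z , zs) → f (z , x ∷ y ∷ zs))
      twice x y zs = ≈-trans (∑-map _ (map _ (select zs))) (∑-map _ (select zs))
    ∑-select-↭ resp (trans p q) = ≈-trans (∑-select-↭ resp p) (∑-select-↭ resp q)

-- Counting closed walks that use a given list of arcs

module WalkCounting where

  open import Data.Nat.Base using (_+_; _<_)
  open ListCombinatorics

  module ∑ℕ where
    open ListSum ℕ.+-*-commutativeSemiring public
    open SelectSum ℕ.+-*-commutativeSemiring public

    ∑-≢0 : ∀ {a} {A : Set a} (xs : List A) {f : A → ℕ} → ∑ xs f ≢ 0 → ∃[ x ] x ∈ xs × f x ≢ 0
    ∑-≢0 []       ∑≢0 = ⊥-elim (∑≢0 refl)
    ∑-≢0 (x ∷ xs) {f} ∑≢0 with f x ℕ.≟ 0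
    ... | no fx≢0 = x , here refl , fx≢0
    ... | yes fx≡0 with y , y∈ , fy≢0 ← ∑-≢0 xs (λ ∑≡0 → ∑≢0 (≡.cong₂ _+_ fx≡0 ∑≡0)) =
      y , there y∈ , fy≢0

    ∑-≥ : ∀ {a} {A : Set a} {xs : List A} {f : A → ℕ} {x} → x ∈ xs → f x ℕ.≤ ∑ xs f
    ∑-≥ {f = f} (here refl) = ℕ.m≤m+n _ _
    ∑-≥ {xs = y ∷ _} {f} (there x∈) = ℕ.≤-trans (∑-≥ x∈) (ℕ.m≤n+m _ (f y))

    []·-≢0 : ∀ {p} {P : Set p} (p? : Dec P) {x} → [ p? ]· x ≢ 0 → P × x ≢ 0
    []·-≢0 (yes p) x≢0 = p , x≢0
    []·-≢0 (no ¬p) 0≢0 = ⊥-elim (0≢0 refl)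

  open ∑ℕ using (∑; [_]·)

  Arc : ℕ → Set
  Arc n = Fin n × Fin n

  -- The number of bijections from N steps to the arcs of L that make up a walk
  -- from i to j; arcs at different positions of L are distinguishable.
  walks : ∀ {n} → ℕ → List (Arc n) → Fin n → Fin n → ℕ
  walks zero    []      i j = [ i Fin.≟ j ]· 1
  walks zero    (_ ∷ _) i j = 0
  walks (suc N) L       i j = ∑ (select L) (λ ((s , t) , L′) → [ s Fin.≟ i ]· (walks N L′ t j))

  closedWalks : ∀ {n} → ℕ → List (Arc n) → ℕ
  closedWalks {n} N L = ∑ (allFin n) (λ i → walks N L i i)

  data IsWalk {n} : List (Arc n) → Fin n → Fin n → Set where
    []   : ∀ {i} → IsWalk [] i i
    step : ∀ {i l j L} → IsWalk L l j → IsWalk ((i , l) ∷ L) i j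

  module _ {n : ℕ} where

    walks-↭ : ∀ N {L L′ : List (Arc n)} {i j} → L ↭ L′ → walks N L i j ≡ walks N L′ i j
    walks-↭ zero {[]}    {[]}     p = refl
    walks-↭ zero {[]}    {_ ∷ _}  p with () ← ↭-length p
    walks-↭ zero {_ ∷ _} {[]}     p with () ← ↭-length p
    walks-↭ zero {_ ∷ _} {_ ∷ _}  p = refl
    walks-↭ (suc N) p = ∑ℕ.∑-select-↭
      (λ {((s , t))} q → ∑ℕ.[]·-cong (s Fin.≟ _) (λ _ → walks-↭ N q)) p

    closedWalks-↭ : ∀ N {L L′ : List (Arc n)} → L ↭ L′ → closedWalks N L ≡ closedWalks N L′
    closedWalks-↭ N p = ∑ℕ.∑-cong (allFin n) (λ _ → walks-↭ N p)

    -- Counts are used later only through being zero or positive and through their invariance under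
    -- permutation and relabelling; this extracts an actual walk from a nonzero one.
    walks≢0⇒IsWalk : ∀ N (L : List (Arc n)) {i j} → walks N L i j ≢ 0 → ∃[ L′ ] L ↭ L′ × IsWalk L′ i j
    walks≢0⇒IsWalk zero [] {i} {j} w≢0 with refl , _ ← ∑ℕ.[]·-≢0 (i Fin.≟ j) w≢0 = [] , refl , []
    walks≢0⇒IsWalk zero (_ ∷ _) w≢0 = ⊥-elim (w≢0 refl)
    walks≢0⇒IsWalk (suc N) L {i} w≢0
      with ((s , t) , L₁) , ∈sel , f≢0 ← ∑ℕ.∑-≢0 (select L) w≢0
      with refl , w′≢0 ← ∑ℕ.[]·-≢0 (s Fin.≟ i) f≢0
      with L₂ , p , wk ← walks≢0⇒IsWalk N L₁ w′≢0
      = (s , t) ∷ L₂ , trans (∈-select⇒↭ L ∈sel) (prep _ p) , step wk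

    IsWalk⇒walks>0 : ∀ {L : List (Arc n)} {i j} → IsWalk L i j → 0 < walks (length L) L i j
    IsWalk⇒walks>0 {i = i} [] = ℕ.≤-reflexive (≡.sym (∑ℕ.[]·-yes (i Fin.≟ i) refl))
    IsWalk⇒walks>0 {L = (i , l) ∷ L} (step wk) = ℕ.<-≤-trans
      (ℕ.<-≤-trans (IsWalk⇒walks>0 wk) (ℕ.≤-reflexive (≡.sym (∑ℕ.[]·-yes (i Fin.≟ i) refl))))
      (∑ℕ.∑-≥ {xs = select ((i , l) ∷ L)} (here refl))

    closedWalks≢0⇒IsWalk : ∀ N (L : List (Arc n)) → closedWalks N L ≢ 0 → ∃[ L′ ] ∃[ i ] L ↭ L′ × IsWalk L′ i i
    closedWalks≢0⇒IsWalk N L c≢0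
      with i , _ , w≢0 ← ∑ℕ.∑-≢0 (allFin n) c≢0
      with L′ , p , wk ← walks≢0⇒IsWalk N L w≢0
      = L′ , i , p , wk

    IsWalk⇒closedWalks>0 : ∀ {L L′ : List (Arc n)} {i} → L ↭ L′ → IsWalk L′ i i → 0 < closedWalks (length L) L
    IsWalk⇒closedWalks>0 {L} {L′} p wk rewrite ↭-length p | closedWalks-↭ (length L′) p =
      ℕ.<-≤-trans (IsWalk⇒walks>0 wk) (∑ℕ.∑-≥ {xs = allFin n} {f = λ i → walks (length L′) L′ i i} (∈-allFin _))

    outdegree indegree : Fin n → List (Arc n) → ℕ
    outdegree v L = ∑ L (λ (s , t) → [ s Fin.≟ v ]· 1)
    indegree  v L = ∑ L (λ (s , t) → [ t Fin.≟ v ]· 1)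

    -- Every step leaves one vertex and enters the next, so only the two ends of the walk are left
    -- over; for a closed walk they cancel.
    IsWalk⇒balanced : ∀ {L i j} v → IsWalk L i j →
      outdegree v L + [ j Fin.≟ v ]· 1 ≡ indegree v L + [ i Fin.≟ v ]· 1
    IsWalk⇒balanced v [] = refl
    IsWalk⇒balanced {j = j} v (step {i} {l} {L = L} wk) = begin
      i# + outdegree v L + [ j Fin.≟ v ]· 1    ≡⟨ ℕ.+-assoc i# _ _ ⟩
      i# + (outdegree v L + [ j Fin.≟ v ]· 1)  ≡⟨ ≡.cong (i# +_) (IsWalk⇒balanced v wk) ⟩
      i# + (indegree v L + l#)                 ≡⟨ ℕ.+-comm i# _ ⟩
      indegree v L + l# + i#                   ≡⟨ ≡.cong (_+ i#) (ℕ.+-comm (indegree v L) l#) ⟩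
      l# + indegree v L + i#                   ∎
      where
      open ≡-Reasoning
      i# = [ i Fin.≟ v ]· 1
      l# = [ l Fin.≟ v ]· 1

    closedWalks≢0⇒balanced : ∀ N L → closedWalks N L ≢ 0 → ∀ v → outdegree v L ≡ indegree v L
    closedWalks≢0⇒balanced N L c≢0 v with L′ , i , p , wk ← closedWalks≢0⇒IsWalk N L c≢0 = begin
      outdegree v L   ≡⟨ ∑ℕ.∑-↭ p ⟩
      outdegree v L′  ≡⟨ ℕ.+-cancelʳ-≡ _ _ _ (IsWalk⇒balanced v wk) ⟩
      indegree v L′   ≡⟨ ∑ℕ.∑-↭ p ⟨
      indegree v L    ∎
      where open ≡-Reasoning

    -- Applied to a property and to its negation, this yields the dichotomy `one-sided` for the rows
    -- visited by a closed walk.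
    IsWalk-stays : ∀ {p} {P : Pred (Fin n) p} {L i j} → IsWalk L i j →
      All (λ (s , t) → P s → P t) L → P i → All (λ (s , t) → P s) L
    IsWalk-stays []        []           Pi = []
    IsWalk-stays (step wk) (closed ∷ c) Pi = Pi ∷ IsWalk-stays wk c (closed Pi)

    IsWalk-++ : ∀ {L L′ : List (Arc n)} {i j l} → IsWalk L i j → IsWalk L′ j l → IsWalk (L ++ L′) i l
    IsWalk-++ []        wk′ = wk′
    IsWalk-++ (step wk) wk′ = step (IsWalk-++ wk wk′)

    loops : ℕ → Fin n → List (Arc n)
    loops q i = replicate q (i , i)

    IsWalk-loops : ∀ q {i} → IsWalk (loops q i) i i
    IsWalk-loops zero    = []
    IsWalk-loops (suc q) = step (IsWalk-loops q)

    -- The loops are spliced in just before an arc that leaves s. This keeps an Euler tour closed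
    -- when diagonal entries are added.
    insert-loops : ∀ {L : List (Arc n)} {i j s t} q → IsWalk L i j → (s , t) ∈ L → ∃[ L′ ] loops q s ++ L ↭ L′ × IsWalk L′ i j
    insert-loops q (step wk) (here refl) = _ , refl , IsWalk-++ (IsWalk-loops q) (step wk)
    insert-loops {s = s} q (step {i} {l} {L = L} wk) (there a∈) with L′ , p , wk′ ← insert-loops q wk a∈ =
      (i , l) ∷ L′ , trans (shift (i , l) (loops q s) L) (prep _ p) , step wk′

  module _ {k n : ℕ} (φ : Fin k → Fin n) where

    relabel : List (Arc k) → List (Arc n)
    relabel = map (λ (s , t) → φ s , φ t)

    select-map : ∀ {a b} {A : Set a} {B : Set b} (f : A → B) (xs : List A) →
      select (map f xs) ≡ map (λ (x , ys) → f x , map f ys) (select xs)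
    select-map f []       = refl
    select-map f (x ∷ xs) = ≡.cong ((f x , map f xs) ∷_)
      (≡.trans (≡.cong (map (λ z → proj₁ z , f x ∷ proj₂ z)) (select-map f xs))
      (≡.trans (≡.sym (List.map-∘ {g = λ z → proj₁ z , f x ∷ proj₂ z} (select xs)))
        (List.map-∘ {g = λ z → f (proj₁ z) , map f (proj₂ z)} (select xs))))

    module _ (φ-inj : Injective _≡_ _≡_ φ) where

      walks-relabel : ∀ N L i j → walks N (relabel L) (φ i) (φ j) ≡ walks N L i j
      walks-relabel zero []      i j = ∑ℕ.[]·-⇔ (φ i Fin.≟ φ j) (i Fin.≟ j) φ-inj (≡.cong φ) refl
      walks-relabel zero (_ ∷ _) i j = refl
      walks-relabel (suc N) L i j rewrite select-map (λ (s , t) → φ s , φ t) L = ≡.trans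
        (∑ℕ.∑-map _ (select L))
        (∑ℕ.∑-cong (select L) (λ ((s , t) , L′) →
          ∑ℕ.[]·-⇔ (φ s Fin.≟ φ i) (s Fin.≟ i) φ-inj (≡.cong φ) (walks-relabel N L′ t j)))

      -- A nonempty walk starts at the source of one of its arcs, so vertices outside the image of φ
      -- contribute nothing. The empty walk, in contrast, is counted once at every vertex, which
      -- excludes N = 0.
      closedWalks-relabel : ∀ {N} → 0 < N → ∀ L → closedWalks N (relabel L) ≡ closedWalks N L
      closedWalks-relabel {suc N} _ L = begin
        ∑ (allFin n) f                 ≡⟨ ∑ℕ.∑-support (Unique.map⁺ φ-inj (Unique.allFin⁺ k)) (Unique.allFin⁺ n)
                                            (λ _ → ∈-allFin _) (λ {v} _ → vanish v) ⟩
        ∑ (map φ (allFin k)) f         ≡⟨ ∑ℕ.∑-map φ (allFin k) ⟩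
        ∑ (allFin k) (λ i → f (φ i))   ≡⟨ ∑ℕ.∑-cong (allFin k) (λ i → walks-relabel (suc N) L i i) ⟩
        closedWalks (suc N) L          ∎
        where
        open ≡-Reasoning
        f : Fin n → ℕ
        f v = walks (suc N) (relabel L) v v
        vanish : ∀ v → v ∉ map φ (allFin k) → f v ≡ 0
        vanish v v∉ rewrite select-map (λ (s , t) → φ s , φ t) L = ∑ℕ.∑-0 (map _ (select L)) {f = λ ((s , t) , L′) → [ s Fin.≟ v ]· (walks N L′ t v)}
          (λ {x} x∈ → ∑ℕ.[]·-no (proj₁ (proj₁ x) Fin.≟ v) (λ s≡v → outside x∈ s≡v))
          where
          outside : ∀ {x} → x ∈ map (λ ((s , t) , ys) → (φ s , φ t) , relabel ys) (select L) → proj₁ (proj₁ x) ≢ v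
          outside x∈ s≡v with ((s , t) , _) , _ , refl ← ∈-map⁻ _ x∈ =
            v∉ (≡.subst (_∈ map φ (allFin k)) s≡v (∈-map⁺ φ (∈-allFin s)))

-- Traces as weighted counts of closed walks

module TracePairing where

  open ListCombinatorics
  open WalkCounting

  module OrderedFieldProperties {c ℓ₁ ℓ₂ : Level} (F : OrderedField c ℓ₁ ℓ₂) where
    open OrderedField F public hiding (zero)
    open IsStrictPartialOrder isStrictPartialOrder public
      using (<-respʳ-≈; <-respˡ-≈) renaming (trans to <-trans; irrefl to <-irrefl)

    semiring : CommutativeSemiring c ℓ₁
    semiring = CommutativeRing.commutativeSemiring commutativeRing

    open import Algebra.Properties.Semiring.Mult (CommutativeSemiring.semiring semiring) public
      using (×-comm-*; ×1-homo-*; ×-homo-+; ×-congʳ)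
    open import Algebra.Properties.Ring (CommutativeRing.ring commutativeRing) public
      using (-‿distribˡ-*; -0#≈0#)
    open import Relation.Binary.Reasoning.Setoid (CommutativeRing.setoid commutativeRing)
    open ListSum semiring

    fromℕ-+ : ∀ a b → fromℕ (a ℕ.+ b) ≈ fromℕ a + fromℕ b
    fromℕ-+ = ×-homo-+ 1#

    fromℕ-* : ∀ a b → fromℕ (a ℕ.* b) ≈ fromℕ a * fromℕ b
    fromℕ-* = ×1-homo-*

    fromℕ-1 : fromℕ 1 ≈ 1#
    fromℕ-1 = +-identityʳ 1#

    fromℕ-≡ : ∀ {a b} → a ≡ b → fromℕ a ≈ fromℕ b
    fromℕ-≡ refl = ≈-refl

    ·ℕ≈*fromℕ : ∀ a x → a ·ℕ x ≈ x * fromℕ a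
    ·ℕ≈*fromℕ a x = ≈-trans (×-congʳ a (≈-sym (*-identityʳ x))) (≈-sym (×-comm-* a x 1#))

    fromℕ-∑ : ∀ {a} {A : Set a} (xs : List A) {f : A → ℕ} → fromℕ (∑ℕ.∑ xs f) ≈ ∑ xs (λ x → fromℕ (f x))
    fromℕ-∑ []       = ≈-refl
    fromℕ-∑ (x ∷ xs) {f} = ≈-trans (fromℕ-+ (f x) _) (+-congˡ (fromℕ-∑ xs))

    fromℕ-[] : ∀ {p} {P : Set p} (p? : Dec P) a → fromℕ (∑ℕ.[ p? ]· a) ≈ [ p? ]· (fromℕ a)
    fromℕ-[] p? a with does p?
    ... | true  = ≈-refl
    ... | false = ≈-refl

    neg-pos : ∀ {x} → x < 0# → 0# < - x
    neg-pos {x} x<0 = <-respʳ-≈ (+-identityˡ _) (<-respˡ-≈ (-‿inverseʳ x) (+-monoˡ-< (- x) x<0))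

    sub-pos : ∀ {x y} → x < y → 0# < y - x
    sub-pos {x} x<y = <-respˡ-≈ (-‿inverseʳ x) (+-monoˡ-< (- x) x<y)

    +-monoʳ-< : ∀ {x y} z → x < y → z + x < z + y
    +-monoʳ-< z x<y = <-respˡ-≈ (+-comm _ z) (<-respʳ-≈ (+-comm _ z) (+-monoˡ-< z x<y))

    *-monoˡ-< : ∀ {x y z} → 0# < z → x < y → z * x < z * y
    *-monoˡ-< {x} {y} {z} 0<z x<y = <-respˡ-≈ (+-identityˡ _) (<-respʳ-≈ eq
      (+-monoˡ-< (z * x) (*-pos 0<z (sub-pos x<y))))
      where
      eq : z * (y - x) + z * x ≈ z * y
      eq = begin
        z * (y - x) + z * x  ≈⟨ distribˡ z _ _ ⟨
        z * (y - x + x)      ≈⟨ *-congˡ (+-assoc y _ x) ⟩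
        z * (y + (- x + x))  ≈⟨ *-congˡ (+-congˡ (-‿inverseˡ x)) ⟩
        z * (y + 0#)         ≈⟨ *-congˡ (+-identityʳ y) ⟩
        z * y                ∎

    fromℕ-mono-< : ∀ {a b} → a ℕ.< b → fromℕ a < fromℕ b
    fromℕ-mono-< {a} {b} a<b = <-respˡ-≈ (+-identityˡ _) (<-respʳ-≈ eq
      (+-monoˡ-< (fromℕ a) (fromℕ-pos (b ∸ a) {{ℕ.>-nonZero (ℕ.m<n⇒0<n∸m a<b)}})))
      where
      eq : fromℕ (b ∸ a) + fromℕ a ≈ fromℕ b
      eq = ≈-trans (≈-sym (fromℕ-+ (b ∸ a) a)) (fromℕ-≡ (ℕ.m∸n+n≡m (ℕ.<⇒≤ a<b)))

    recip-inverse : ∀ n .{{_ : NonZero n}} → recip n * fromℕ n ≈ 1#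
    recip-inverse n = ≈-trans (*-congˡ (≈-sym (≈-trans (+-congˡ -0#≈0#) (+-identityʳ _))))
      (proj₁ (proj₂ (#⇒invertible (#-sym (<⇒# (fromℕ-pos n))))))

    -- `recip n` comes only as some inverse, so its sign has to be derived: being invertible it is
    -- apart from 0, and if it were negative, its negative times n, which is -1, would be positive.
    recip-pos : ∀ n .{{_ : NonZero n}} → 0# < recip n
    recip-pos n with #⇒<⊎> (invertible⇒# {recip n} {0#} (fromℕ n , left , ≈-trans (*-comm _ _) left))
      where
      left : fromℕ n * (recip n - 0#) ≈ 1#
      left = ≈-trans (*-congˡ (≈-trans (+-congˡ -0#≈0#) (+-identityʳ _))) (≈-trans (*-comm _ _) (recip-inverse n))
    ... | inj₂ 0<r = 0<r
    ... | inj₁ r<0 = ⊥-elim (<-irrefl ≈-refl (<-trans 0<1 1<0))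
      where
      0<-1 : 0# < - 1#
      0<-1 = <-respʳ-≈ (≈-trans (≈-sym (-‿distribˡ-* (recip n) (fromℕ n))) (-‿cong (recip-inverse n)))
        (*-pos (neg-pos r<0) (fromℕ-pos n))
      1<0 : 1# < 0#
      1<0 = <-respˡ-≈ (+-identityˡ _) (<-respʳ-≈ (-‿inverseˡ 1#) (+-monoˡ-< 1# 0<-1))

  module PolynomialPairing {c ℓ₁ ℓ₂ : Level} (F : OrderedField c ℓ₁ ℓ₂) where
    open OrderedFieldProperties F
    open Spectral F
    open ListSum semiring
    open import Algebra.Properties.CommutativeSemigroup (CommutativeSemiring.*-commutativeSemigroup semiring)
      using (x∙yz≈y∙xz)

    module _ {n : ℕ} where

      single : Fin n → Fin n → Monomial n
      single s t = updateExponent s t suc (λ _ _ → 0)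

      infixl 6 _⊕_
      _⊕_ : Monomial n → Monomial n → Monomial n
      (e ⊕ f) i j = e i j ℕ.+ f i j

      infix 4 _≗₂_
      _≗₂_ : Monomial n → Monomial n → Set
      e ≗₂ f = ∀ i j → e i j ≡ f i j

      updateExponent-same : ∀ s t f (e : Monomial n) → updateExponent s t f e s t ≡ f (e s t)
      updateExponent-same s t f e rewrite updateAt-updates s {λ row → updateAt row t f} e =
        updateAt-updates t (e s)

      updateExponent-other : ∀ s t f (e : Monomial n) i j → ¬ (i ≡ s × j ≡ t) → updateExponent s t f e i j ≡ e i j
      updateExponent-other s t f e i j ≢ with i Fin.≟ s
      ... | no i≢s = ≡.cong (λ row → row j) (updateAt-minimal i s {λ row → updateAt row t f} e i≢s)
      ... | yes refl rewrite updateAt-updates s {λ row → updateAt row t f} e =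
        updateAt-minimal j t (e s) (λ j≡t → ≢ (refl , j≡t))

      pair-≟ : ∀ (i j s t : Fin n) → Dec (i ≡ s × j ≡ t)
      pair-≟ i j s t = (i Fin.≟ s) ×-dec (j Fin.≟ t)
        where open import Relation.Nullary.Decidable using (_×-dec_)

      updateExponent-cong : ∀ s t f {e e′ : Monomial n} → e ≗₂ e′ → updateExponent s t f e ≗₂ updateExponent s t f e′
      updateExponent-cong s t f {e} {e′} eq i j with pair-≟ i j s t
      ... | yes (refl , refl) = begin
        updateExponent i j f e i j   ≡⟨ updateExponent-same i j f e ⟩
        f (e i j)                    ≡⟨ ≡.cong f (eq i j) ⟩
        f (e′ i j)                   ≡⟨ updateExponent-same i j f e′ ⟨
        updateExponent i j f e′ i j  ∎
        where open ≡-Reasoning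
      ... | no ≢ = ≡.trans (updateExponent-other s t f e i j ≢)
        (≡.trans (eq i j) (≡.sym (updateExponent-other s t f e′ i j ≢)))

      pred-single⊕ : ∀ s t (e : Monomial n) → updateExponent s t pred (single s t ⊕ e) ≗₂ e
      pred-single⊕ s t e i j with pair-≟ i j s t
      ... | yes (refl , refl) = ≡.trans (updateExponent-same i j pred (single i j ⊕ e))
        (≡.cong (λ z → pred (z ℕ.+ e i j)) (updateExponent-same i j suc (λ _ _ → 0)))
      ... | no ≢ = ≡.trans (updateExponent-other s t pred (single s t ⊕ e) i j ≢)
        (≡.cong (ℕ._+ e i j) (updateExponent-other s t suc (λ _ _ → 0) i j ≢))

      single⊕pred : ∀ s t (e : Monomial n) → e s t ≢ 0 → single s t ⊕ updateExponent s t pred e ≗₂ e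
      single⊕pred s t e est≢0 i j with pair-≟ i j s t
      ... | yes (refl , refl) = ≡.trans
        (≡.cong₂ ℕ._+_ (updateExponent-same i j suc (λ _ _ → 0)) (updateExponent-same i j pred e))
        (ℕ.suc-pred (e i j) {{ℕ.≢-nonZero est≢0}})
      ... | no ≢ = ≡.cong₂ ℕ._+_ (updateExponent-other s t suc (λ _ _ → 0) i j ≢)
        (updateExponent-other s t pred e i j ≢)

      pred-single-comm : ∀ a b s t (e : Monomial n) → ¬ (a ≡ s × b ≡ t) →
        updateExponent a b pred (single s t ⊕ e) ≗₂ single s t ⊕ updateExponent a b pred e
      pred-single-comm a b s t e ab≢st i j with pair-≟ i j a b
      ... | no ≢ = ≡.trans (updateExponent-other a b pred (single s t ⊕ e) i j ≢)
        (≡.cong (single s t i j ℕ.+_) (≡.sym (updateExponent-other a b pred e i j ≢)))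
      ... | yes (refl , refl) = begin
        updateExponent i j pred (single s t ⊕ e) i j         ≡⟨ updateExponent-same i j pred (single s t ⊕ e) ⟩
        pred (single s t i j ℕ.+ e i j)                      ≡⟨ ≡.cong (λ z → pred (z ℕ.+ e i j)) 0≡ ⟩
        pred (e i j)                                         ≡⟨ updateExponent-same i j pred e ⟨
        updateExponent i j pred e i j                        ≡⟨ ≡.cong (ℕ._+ updateExponent i j pred e i j) 0≡ ⟨
        single s t i j ℕ.+ updateExponent i j pred e i j     ∎
        where
        open ≡-Reasoning
        0≡ : single s t i j ≡ 0
        0≡ = updateExponent-other s t suc (λ _ _ → 0) i j ab≢st

      -- The constant term of the monomial e after differentiating along L.
      coeff : List (Arc n) → Monomial n → ℕ
      coeff []            e = ∑ℕ.[ Fin.all? (λ i → Fin.all? (λ j → e i j ℕ.≟ 0)) ]· 1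
      coeff ((s , t) ∷ L) e = e s t ℕ.* coeff L (updateExponent s t pred e)

      coeff-cong : ∀ L {e e′} → e ≗₂ e′ → coeff L e ≡ coeff L e′
      coeff-cong [] {e} {e′} eq = ∑ℕ.[]·-⇔ (Fin.all? _) (Fin.all? _)
        (λ z i j → ≡.trans (≡.sym (eq i j)) (z i j)) (λ z i j → ≡.trans (eq i j) (z i j)) refl
      coeff-cong ((s , t) ∷ L) eq = ≡.cong₂ ℕ._*_ (eq s t) (coeff-cong L (updateExponent-cong s t pred eq))

      -- Product rule: the new factor a_st has to be removed by one of the derivatives along L, and
      -- the sum runs over the position of that derivative.
      coeff-single⊕ : ∀ L s t e → coeff L (single s t ⊕ e) ≡
        ∑ℕ.∑ (select L) (λ ((a , b) , L′) → ∑ℕ.[ pair-≟ a b s t ]· (coeff L′ e))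
      coeff-single⊕ [] s t e = ∑ℕ.[]·-no (Fin.all? (λ i → Fin.all? (λ j → (single s t ⊕ e) i j ℕ.≟ 0)))
        (λ z → ℕ.1+n≢0 (≡.trans (≡.cong (ℕ._+ e s t) (≡.sym (updateExponent-same s t suc (λ _ _ → 0)))) (z s t)))
      coeff-single⊕ ((a , b) ∷ L) s t e = ≡.trans (main (pair-≟ a b s t)) (≡.cong (∑ℕ.[ pair-≟ a b s t ]· (coeff L e) ℕ.+_) (≡.sym tail))
        where
        open ≡-Reasoning
        pred-e = updateExponent a b pred e
        tail : ∑ℕ.∑ (map (λ (y , ys) → y , (a , b) ∷ ys) (select L)) (λ ((a , b) , L′) → ∑ℕ.[ pair-≟ a b s t ]· (coeff L′ e))
          ≡ e a b ℕ.* coeff L (single s t ⊕ pred-e)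
        tail = begin
          _ ≡⟨ ∑ℕ.∑-map _ (select L) ⟩
          ∑ℕ.∑ (select L) (λ ((a′ , b′) , L′) → ∑ℕ.[ pair-≟ a′ b′ s t ]· (e a b ℕ.* coeff L′ pred-e))
            ≡⟨ ∑ℕ.∑-cong (select L) (λ ((a′ , b′) , L′) → ∑ℕ.[]·-*ˡ (pair-≟ a′ b′ s t) (e a b) _) ⟨
          ∑ℕ.∑ (select L) (λ ((a′ , b′) , L′) → e a b ℕ.* ∑ℕ.[ pair-≟ a′ b′ s t ]· (coeff L′ pred-e))
            ≡⟨ ∑ℕ.∑-*ˡ (select L) (e a b) ⟨
          e a b ℕ.* ∑ℕ.∑ (select L) (λ ((a′ , b′) , L′) → ∑ℕ.[ pair-≟ a′ b′ s t ]· (coeff L′ pred-e))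
            ≡⟨ ≡.cong (e a b ℕ.*_) (coeff-single⊕ L s t pred-e) ⟨
          e a b ℕ.* coeff L (single s t ⊕ pred-e) ∎
        main : (ab≟st : Dec (a ≡ s × b ≡ t)) → coeff ((a , b) ∷ L) (single s t ⊕ e) ≡
          ∑ℕ.[ ab≟st ]· (coeff L e) ℕ.+ e a b ℕ.* coeff L (single s t ⊕ pred-e)
        main (no ≢) = ≡.cong₂ (λ x y → (x ℕ.+ e a b) ℕ.* y) {y = 0} (updateExponent-other s t suc (λ _ _ → 0) a b ≢)
          (coeff-cong L (pred-single-comm a b s t e ≢))
        -- The derivative multiplies by the exponent 1 + e a b. The 1 is the case in which it
        -- removes the new factor, e a b the case in which it removes an old one.
        main (yes (refl , refl)) = ≡.trans
          (≡.cong₂ (λ x y → (x ℕ.+ e a b) ℕ.* y) {y = 1} (updateExponent-same a b suc (λ _ _ → 0))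
            (coeff-cong L (pred-single⊕ a b e)))
          (≡.cong (coeff L e ℕ.+_) step′)
          where
          step′ : e a b ℕ.* coeff L e ≡ e a b ℕ.* coeff L (single a b ⊕ pred-e)
          -- For exponent 0 the truncated `pred` is not undone by `single`, but then the prefactor
          -- is 0.
          step′ with e a b ℕ.≟ 0
          ... | yes z rewrite z = refl
          ... | no nz = ≡.cong (e a b ℕ.*_) (≡.sym (coeff-cong L (single⊕pred a b e nz)))

      -- The constant term of p differentiated along L. It is linear in p, and each operator on
      -- formal polynomials turns into an operation on L, so formal sums never have to be compared
      -- as polynomials.
      ⟨_,_⟩ : List (Arc n) → Poly n → Carrier
      ⟨ L , p ⟩ = ∑ p (λ (x , e) → x * fromℕ (coeff L e))

      constantTerm≈⟨[],⟩ : ∀ p → constantTerm p ≈ ⟨ [] , p ⟩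
      constantTerm≈⟨[],⟩ [] = ≈-refl
      constantTerm≈⟨[],⟩ ((x , e) ∷ p) = +-cong eq (constantTerm≈⟨[],⟩ p)
        where
        d = Fin.all? (λ i → Fin.all? (λ j → e i j ℕ.≟ 0))
        eq : (if does d then x else 0#) ≈ x * fromℕ (∑ℕ.[ d ]· 1)
        eq with does d
        ... | true  = ≈-sym (≈-trans (*-congˡ fromℕ-1) (*-identityʳ x))
        ... | false = ≈-sym (zeroʳ x)

      ⟨,scale⟩ : ∀ L x p → ⟨ L , scale x p ⟩ ≈ x * ⟨ L , p ⟩
      ⟨,scale⟩ L x p = ≈-trans (∑-map (map₁ (x *_)) p)
        (≈-trans (∑-cong p (λ (y , e) → *-assoc x y _)) (≈-sym (∑-*ˡ p x)))

      ⟨,∑ₚ⟩ : ∀ {a} {A : Set a} L (xs : List A) (f : A → Poly n) → ⟨ L , ∑ₚ xs f ⟩ ≈ ∑ xs (λ x → ⟨ L , f x ⟩)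
      ⟨,∑ₚ⟩ L xs f = ∑-concatMap f xs

      ⟨,∂⟩ : ∀ L s t p → ⟨ L , ∂ s t p ⟩ ≈ ⟨ (s , t) ∷ L , p ⟩
      ⟨,∂⟩ L s t p = ≈-trans (∑-map _ p) (∑-cong p (λ (x , e) → ≈-trans
        (*-congʳ (·ℕ≈*fromℕ (e s t) x))
        (≈-trans (*-assoc x _ _) (*-congˡ (≈-sym (fromℕ-* (e s t) _))))))

      ⟨,indeterminate*⟩ : ∀ L s t p → ⟨ L , indeterminate s t *ₚ p ⟩ ≈
        ∑ (select L) (λ ((a , b) , L′) → [ pair-≟ a b s t ]· ⟨ L′ , p ⟩)
      ⟨,indeterminate*⟩ L s t p = begin
        ⟨ L , indeterminate s t *ₚ p ⟩
          ≈⟨ ∑-cartesianProductWith (λ (x , e) (y , f) → x * y , (λ i j → e i j ℕ.+ f i j)) (indeterminate s t) p ⟩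
        ∑ p (λ (x , e) → 1# * x * fromℕ (coeff L (single s t ⊕ e))) + 0#
          ≈⟨ +-identityʳ _ ⟩
        ∑ p (λ (x , e) → 1# * x * fromℕ (coeff L (single s t ⊕ e)))
          ≈⟨ ∑-cong p (λ (x , e) → term x e) ⟩
        ∑ p (λ (x , e) → ∑ (select L) (λ ((a , b) , L′) → [ pair-≟ a b s t ]· (x * fromℕ (coeff L′ e))))
          ≈⟨ ∑-swap p (select L) ⟩
        ∑ (select L) (λ ((a , b) , L′) → ∑ p (λ (x , e) → [ pair-≟ a b s t ]· (x * fromℕ (coeff L′ e))))
          ≈⟨ ∑-cong (select L) (λ ((a , b) , L′) → []·-∑ (pair-≟ a b s t) p) ⟨
        ∑ (select L) (λ ((a , b) , L′) → [ pair-≟ a b s t ]· ⟨ L′ , p ⟩) ∎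
        where
        open import Relation.Binary.Reasoning.Setoid (CommutativeRing.setoid commutativeRing)
        term : ∀ x e → 1# * x * fromℕ (coeff L (single s t ⊕ e)) ≈
          ∑ (select L) (λ ((a , b) , L′) → [ pair-≟ a b s t ]· (x * fromℕ (coeff L′ e)))
        term x e = begin
          1# * x * fromℕ (coeff L (single s t ⊕ e))
            ≈⟨ *-cong (*-identityˡ x) (≈-trans (fromℕ-≡ (coeff-single⊕ L s t e)) (fromℕ-∑ (select L))) ⟩
          x * ∑ (select L) (λ ((a , b) , L′) → fromℕ (∑ℕ.[ pair-≟ a b s t ]· (coeff L′ e)))
            ≈⟨ ∑-*ˡ (select L) x ⟩
          ∑ (select L) (λ ((a , b) , L′) → x * fromℕ (∑ℕ.[ pair-≟ a b s t ]· (coeff L′ e)))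
            ≈⟨ ∑-cong (select L) (λ ((a , b) , L′) →
                 ≈-trans (*-congˡ (fromℕ-[] (pair-≟ a b s t) _)) ([]·-*ˡ (pair-≟ a b s t) x _)) ⟩
          ∑ (select L) (λ ((a , b) , L′) → [ pair-≟ a b s t ]· (x * fromℕ (coeff L′ e))) ∎

      -- Each matrix factor a_il consumes one derivative of L, namely an arc from i to l; this is
      -- the recursion that defines `walks`.
      ⟨,power⟩ : ∀ N L i j → ⟨ L , power N i j ⟩ ≈ fromℕ (walks N L i j)
      ⟨,power⟩ zero [] i j with does (i Fin.≟ j)
      ... | false = ≈-refl
      ... | true  = ≈-trans (+-identityʳ _) (≈-trans (*-identityˡ _)
        (fromℕ-≡ {b = 1} (∑ℕ.[]·-yes (Fin.all? {n} (λ _ → Fin.all? {n} (λ _ → 0 ℕ.≟ 0))) {x = 1} (λ _ _ → refl))))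
      ⟨,power⟩ zero ((s , t) ∷ L) i j with does (i Fin.≟ j)
      ... | false = ≈-refl
      ... | true  = ≈-trans (+-identityʳ _) (zeroʳ 1#)
      ⟨,power⟩ (suc N) L i j = begin
        ⟨ L , power (suc N) i j ⟩
          ≈⟨ ⟨,∑ₚ⟩ L (allFin n) _ ⟩
        ∑ (allFin n) (λ l → ⟨ L , indeterminate i l *ₚ power N l j ⟩)
          ≈⟨ ∑-cong (allFin n) (λ l → ⟨,indeterminate*⟩ L i l (power N l j)) ⟩
        ∑ (allFin n) (λ l → ∑ (select L) (λ ((a , b) , L′) → [ pair-≟ a b i l ]· ⟨ L′ , power N l j ⟩))
          ≈⟨ ∑-swap (allFin n) (select L) ⟩
        ∑ (select L) (λ ((a , b) , L′) → ∑ (allFin n) (λ l → [ pair-≟ a b i l ]· ⟨ L′ , power N l j ⟩))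
          ≈⟨ ∑-cong (select L) (λ ((a , b) , L′) → pick a b L′) ⟩
        ∑ (select L) (λ ((a , b) , L′) → fromℕ (∑ℕ.[ a Fin.≟ i ]· (walks N L′ b j)))
          ≈⟨ fromℕ-∑ (select L) ⟨
        fromℕ (walks (suc N) L i j) ∎
        where
        open import Relation.Binary.Reasoning.Setoid (CommutativeRing.setoid commutativeRing)
        pick : ∀ a b L′ → ∑ (allFin n) (λ l → [ pair-≟ a b i l ]· ⟨ L′ , power N l j ⟩) ≈
          fromℕ (∑ℕ.[ a Fin.≟ i ]· (walks N L′ b j))
        pick a b L′ = begin
          ∑ (allFin n) (λ l → [ pair-≟ a b i l ]· ⟨ L′ , power N l j ⟩)
            ≈⟨ ∑-single (Unique.allFin⁺ n) (∈-allFin b)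
                 (λ {l} _ l≢b → []·-no (pair-≟ a b i l) (λ (_ , b≡l) → l≢b (≡.sym b≡l))) ⟩
          [ pair-≟ a b i b ]· ⟨ L′ , power N b j ⟩
            ≈⟨ []·-⇔ (pair-≟ a b i b) (a Fin.≟ i) proj₁ (λ a≡i → a≡i , refl) (⟨,power⟩ N L′ b j) ⟩
          [ a Fin.≟ i ]· (fromℕ (walks N L′ b j))
            ≈⟨ fromℕ-[] (a Fin.≟ i) _ ⟨
          fromℕ (∑ℕ.[ a Fin.≟ i ]· (walks N L′ b j)) ∎

      ⟨,tracePower⟩ : ∀ N L → ⟨ L , tracePower N ⟩ ≈ fromℕ (closedWalks N L)
      ⟨,tracePower⟩ N L = ≈-trans (⟨,∑ₚ⟩ L (allFin n) _)
        (≈-trans (∑-cong (allFin n) (λ i → ⟨,power⟩ N L i i)) (≈-sym (fromℕ-∑ (allFin n))))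

      push : ∀ {l} → Fin n → Vec (Fin n) l → List (Arc n) → List (Arc n)
      push i []      L = L
      push i (g ∷ γ) L = push i γ ((i , g) ∷ L)

      push-↭ : ∀ {l} i (γ : Vec (Fin n) l) L → push i γ L ↭ map (i ,_) (Vec.toList γ) ++ L
      push-↭ i []      L = refl
      push-↭ i (g ∷ γ) L = trans (push-↭ i γ ((i , g) ∷ L)) (shift (i , g) (map (i ,_) (Vec.toList γ)) L)

      ⟨,∂*⟩ : ∀ {l} L i (γ : Vec (Fin n) l) p → ⟨ L , ∂* i γ p ⟩ ≈ ⟨ push i γ L , p ⟩
      ⟨,∂*⟩ L i []      p = ≈-refl
      ⟨,∂*⟩ L i (g ∷ γ) p = ≈-trans (⟨,∂⟩ L i g (∂* i γ p)) (⟨,∂*⟩ ((i , g) ∷ L) i γ p)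

    module _ (k : ℕ) {n : ℕ} (T : Tensor k n) where

      -- What a product of slices becomes under the pairing: every row in `is` sums over its tensor
      -- entries and adds the arcs of the chosen word, and φ evaluates the arcs collected in the
      -- end.
      contract : List (Fin n) → (List (Arc n) → Carrier) → List (Arc n) → Carrier
      contract []       φ L = φ L
      contract (i ∷ is) φ L = ∑ (words n (k ∸ 1)) (λ γ → T i γ * contract is φ (push i γ L))

      contract-++ : ∀ is js φ L → contract (is ++ js) φ L ≡ contract is (contract js φ) L
      contract-++ []       js φ L = refl
      contract-++ (i ∷ is) js φ L = ∑-≡ (words n (k ∸ 1)) (λ γ → ≡.cong (T i γ *_) (contract-++ is js φ (push i γ L)))
        where
        ∑-≡ : ∀ {A : Set} (xs : List A) {f g : A → Carrier} → (∀ x → f x ≡ g x) → ∑ xs f ≡ ∑ xs g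
        ∑-≡ []       eq = refl
        ∑-≡ (x ∷ xs) eq = ≡.cong₂ _+_ (eq x) (∑-≡ xs eq)

      contract-cong : ∀ is {φ ψ : List (Arc n) → Carrier} → (∀ L → φ L ≈ ψ L) → ∀ L → contract is φ L ≈ contract is ψ L
      contract-cong []       eq L = eq L
      contract-cong (i ∷ is) eq L = ∑-cong (words n (k ∸ 1)) (λ γ → *-congˡ (contract-cong is eq (push i γ L)))

      contract-* : ∀ is x {φ : List (Arc n) → Carrier} L → contract is (λ L → x * φ L) L ≈ x * contract is φ L
      contract-* []       x L = ≈-refl
      contract-* (i ∷ is) x {φ} L = ≈-trans
        (∑-cong (words n (k ∸ 1)) (λ γ → ≈-trans (*-congˡ (contract-* is x (push i γ L))) (x∙yz≈y∙xz _ x _)))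
        (≈-sym (∑-*ˡ (words n (k ∸ 1)) x))

      ⟨,slices⟩ : ∀ L i t p → ⟨ L , fold p (slice k T i) t ⟩ ≈ contract (replicate t i) (λ L → ⟨ L , p ⟩) L
      ⟨,slices⟩ L i zero    p = ≈-refl
      ⟨,slices⟩ L i (suc t) p = ≈-trans (⟨,∑ₚ⟩ L (words n (k ∸ 1)) _) (∑-cong (words n (k ∸ 1)) (λ γ →
        ≈-trans (⟨,scale⟩ L (T i γ) (∂* i γ (fold p (slice k T i) t)))
          (*-congˡ (≈-trans (⟨,∂*⟩ L i γ (fold p (slice k T i) t)) (⟨,slices⟩ (push i γ L) i t p)))))

      weight : List (Fin n) → (Fin n → ℕ) → Carrier
      weight vs d = foldr (λ i x → 1/ (d i ℕ.* (k ∸ 1)) ! * x) 1# vs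

      expand : ∀ {m} → List (Fin m) → (Fin m → ℕ) → List (Fin m)
      expand vs d = concatMap (λ i → replicate (d i) i) vs

      ⟨,operator⟩ : ∀ L d p vs → 
        ⟨ L , foldr (λ i q → scale (1/ (Vec.lookup d i ℕ.* (k ∸ 1)) !) (fold q (slice k T i) (Vec.lookup d i))) p vs ⟩ ≈ weight vs (Vec.lookup d) * contract (expand vs (Vec.lookup d)) (λ L → ⟨ L , p ⟩) L
      ⟨,operator⟩ L d p []       = ≈-sym (*-identityˡ _)
      ⟨,operator⟩ L d p (i ∷ vs) = begin
        ⟨ L , scale x (fold q (slice k T i) (Vec.lookup d i)) ⟩           ≈⟨ ⟨,scale⟩ L x (fold q (slice k T i) (Vec.lookup d i)) ⟩
        x * ⟨ L , fold q (slice k T i) (Vec.lookup d i) ⟩                 ≈⟨ *-congˡ (⟨,slices⟩ L i (Vec.lookup d i) q) ⟩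
        x * contract is (λ L → ⟨ L , q ⟩) L                           ≈⟨ *-congˡ (contract-cong is (λ L → ⟨,operator⟩ L d p vs) L) ⟩
        x * contract is (λ L → weight vs (Vec.lookup d) * contract js φ L) L  ≈⟨ *-congˡ (contract-* is _ L) ⟩
        x * (weight vs (Vec.lookup d) * contract is (contract js φ) L)    ≈⟨ *-assoc x _ _ ⟨
        x * weight vs (Vec.lookup d) * contract is (contract js φ) L      ≡⟨ ≡.cong (x * weight vs (Vec.lookup d) *_) (contract-++ is js φ L) ⟨
        x * weight vs (Vec.lookup d) * contract (is ++ js) φ L            ∎
        where
        open import Relation.Binary.Reasoning.Setoid (CommutativeRing.setoid commutativeRing)
        x = 1/ (Vec.lookup d i ℕ.* (k ∸ 1)) !
        q = foldr (λ i q → scale (1/ (Vec.lookup d i ℕ.* (k ∸ 1)) !) (fold q (slice k T i) (Vec.lookup d i))) p vs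
        is = replicate (Vec.lookup d i) i
        js = expand vs (Vec.lookup d)
        φ = λ L → ⟨ L , p ⟩

      -- The trace formula freed of polynomials: the rows repeated according to the composition
      -- choose tensor entries, and the chosen arcs are evaluated by counting closed walks.
      Tr≈ : ∀ D → Tr k T (suc D) ≈ fromℕ ((k ∸ 1) ℕ.^ (n ∸ 1)) *
        ∑ (compositions n (suc D)) (λ d → weight (allFin n) (Vec.lookup d) *
          contract (expand (allFin n) (Vec.lookup d)) (λ L → fromℕ (closedWalks (suc D ℕ.* (k ∸ 1)) L)) [])
      Tr≈ D = *-congˡ (begin
        constantTerm (∑ₚ (compositions n (suc D)) (λ d → operator k T d p))
          ≈⟨ constantTerm≈⟨[],⟩ (∑ₚ (compositions n (suc D)) (λ d → operator k T d p)) ⟩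
        ⟨ [] , ∑ₚ (compositions n (suc D)) (λ d → operator k T d p) ⟩
          ≈⟨ ⟨,∑ₚ⟩ [] (compositions n (suc D)) _ ⟩
        ∑ (compositions n (suc D)) (λ d → ⟨ [] , operator k T d p ⟩)
          ≈⟨ ∑-cong (compositions n (suc D)) (λ d → ≈-trans (⟨,operator⟩ [] d p (allFin n))
               (*-congˡ (contract-cong (expand (allFin n) (Vec.lookup d)) (⟨,tracePower⟩ (suc D ℕ.* (k ∸ 1))) []))) ⟩
        _ ∎)
        where
        open import Relation.Binary.Reasoning.Setoid (CommutativeRing.setoid commutativeRing)
        p = tracePower (suc D ℕ.* (k ∸ 1))

-- Hypertrees grown one hyperedge at a time

module HypertreeGrowth where

  open import Data.Nat.Base using (_+_; _*_; _≤_; _<_)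
  open ListCombinatorics
  open WalkCounting

  open ∑ℕ using (∑; [_]·)

  unique-lookup-injective : ∀ {a b} {A : Set a} {B : Set b} (f : A → B) {xs : List A} → Unique (map f xs) →
    ∀ {i j} → f (lookup xs i) ≡ f (lookup xs j) → i ≡ j
  unique-lookup-injective f {x ∷ xs} (x∉ ∷ u) {zero}  {zero}  eq = refl
  unique-lookup-injective f {x ∷ xs} (x∉ ∷ u) {zero}  {suc j} eq =
    ⊥-elim (All.lookup x∉ (∈-map⁺ f (∈-lookup j)) eq)
  unique-lookup-injective f {x ∷ xs} (x∉ ∷ u) {suc i} {zero}  eq =
    ⊥-elim (All.lookup x∉ (∈-map⁺ f (∈-lookup i)) (≡.sym eq))
  unique-lookup-injective f {x ∷ xs} (x∉ ∷ u) {suc i} {suc j} eq = ≡.cong suc (unique-lookup-injective f u eq)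

  ∑-const-1 : ∀ {a} {A : Set a} (xs : List A) → ∑ xs (λ _ → 1) ≡ length xs
  ∑-const-1 []       = refl
  ∑-const-1 (_ ∷ xs) = ≡.cong suc (∑-const-1 xs)

  members : ∀ {n} → Subset n → List (Fin n)
  members S = filter (_∈? S) (allFin _)

  module _ {n : ℕ} (S : Subset n) where

    members-unique : Unique (members S)
    members-unique = Unique.filter⁺ (_∈? S) (Unique.allFin⁺ n)

    ∈-members⁺ : ∀ {v} → v ∈ₛ S → v ∈ members S
    ∈-members⁺ {v} v∈ = ∈-filter⁺ (_∈? S) (∈-allFin v) v∈

    ∈-members⁻ : ∀ {v} → v ∈ members S → v ∈ₛ S
    ∈-members⁻ v∈ = proj₂ (∈-filter⁻ (_∈? S) {xs = allFin n} v∈)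

  ∑-allFin-suc : ∀ {n} (f : Fin (suc n) → ℕ) → ∑ (allFin (suc n)) f ≡ f zero + ∑ (allFin n) (f ∘ suc)
  ∑-allFin-suc {n} f = ≡.cong (f zero +_) (≡.trans
    (≡.cong (λ xs → ∑ xs f) (≡.sym (List.map-tabulate {n = n} (λ i → i) suc))) (∑ℕ.∑-map suc (allFin n)))

  ∑-∈? : ∀ {n} (S : Subset n) → ∑ (allFin n) (λ v → [ v ∈? S ]· 1) ≡ ∣ S ∣
  ∑-∈? []          = refl
  ∑-∈? (b ∷ S) = ≡.trans (∑-allFin-suc (λ v → [ v ∈? (b ∷ S) ]· 1)) (≡.trans (≡.cong (head +_) tail) (last b))
    where
    head : ℕ
    head = [ zero ∈? (b ∷ S) ]· 1
    tail : ∑ (allFin _) (λ v → [ suc v ∈? (b ∷ S) ]· 1) ≡ ∣ S ∣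
    tail = ≡.trans (∑ℕ.∑-cong (allFin _) (λ v → ∑ℕ.[]·-⇔ (suc v ∈? (b ∷ S)) (v ∈? S)
      (λ { (there v∈) → v∈ }) there refl)) (∑-∈? S)
    last : ∀ b → [ zero ∈? (b ∷ S) ]· 1 + ∣ S ∣ ≡ ∣ b ∷ S ∣
    last true  = refl
    last false = refl

  ∑-members : ∀ {n} (S : Subset n) (f : Fin n → ℕ) → ∑ (members S) f ≡ ∑ (allFin n) (λ v → [ v ∈? S ]· (f v))
  ∑-members S f = ∑ℕ.∑-filter (_∈? S) (allFin _)

  length-members : ∀ {n} (S : Subset n) → length (members S) ≡ ∣ S ∣
  length-members S = ≡.trans (≡.sym (∑-const-1 (members S))) (≡.trans (∑-members S (λ _ → 1)) (∑-∈? S))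

  module Incidence (H : Hypergraph) where

    V E : Set
    V = Fin (order H)
    E = Fin (size H)

    infix 4 _∈ᵉ_ _∈ᵉ?_
    _∈ᵉ_ : V → E → Set
    v ∈ᵉ j = v ∈ₛ edge H j

    _∈ᵉ?_ : ∀ v j → Dec (v ∈ᵉ j)
    v ∈ᵉ? j = v ∈? edge H j

    vertices : E → List V
    vertices j = members (edge H j)

    degree≡∑ : ∀ v → degree H v ≡ ∑ (allFin (size H)) (λ j → [ v ∈ᵉ? j ]· 1)
    degree≡∑ v = ≡.trans (≡.sym (∑-const-1 (filter (v ∈ᵉ?_) (allFin (size H)))))
      (∑ℕ.∑-filter (v ∈ᵉ?_) (allFin (size H)))

    -- Double counting of incidences. With f equal to 1, the degree, its square or the degree minus
    -- one, it gives the degree identities needed below.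
    ∑∑-edges : ∀ (f : V → ℕ) →
      ∑ (allFin (size H)) (λ j → ∑ (vertices j) f) ≡ ∑ (allFin (order H)) (λ v → degree H v * f v)
    ∑∑-edges f = begin
      ∑ Es (λ j → ∑ (vertices j) f)                ≡⟨ ∑ℕ.∑-cong Es (λ j → ∑-members (edge H j) f) ⟩
      ∑ Es (λ j → ∑ Vs (λ v → [ v ∈ᵉ? j ]· (f v)))  ≡⟨ ∑ℕ.∑-swap Es Vs ⟩
      ∑ Vs (λ v → ∑ Es (λ j → [ v ∈ᵉ? j ]· (f v)))  ≡⟨ ∑ℕ.∑-cong Vs (λ v → count v) ⟩
      ∑ Vs (λ v → degree H v * f v)                ∎
      where
      open ≡-Reasoning
      Es = allFin (size H)
      Vs = allFin (order H)
      count : ∀ v → ∑ Es (λ j → [ v ∈ᵉ? j ]· (f v)) ≡ degree H v * f v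
      count v = begin
        ∑ Es (λ j → [ v ∈ᵉ? j ]· (f v))      ≡⟨ ∑ℕ.∑-cong Es (λ j → ≡.cong [ v ∈ᵉ? j ]· (ℕ.*-identityʳ (f v))) ⟨
        ∑ Es (λ j → [ v ∈ᵉ? j ]· (f v * 1))  ≡⟨ ∑ℕ.∑-cong Es (λ j → ∑ℕ.[]·-*ˡ (v ∈ᵉ? j) (f v) 1) ⟨
        ∑ Es (λ j → f v * [ v ∈ᵉ? j ]· 1)    ≡⟨ ∑ℕ.∑-*ˡ Es (f v) ⟨
        f v * ∑ Es (λ j → [ v ∈ᵉ? j ]· 1)    ≡⟨ ≡.cong (f v *_) (degree≡∑ v) ⟨
        f v * degree H v                     ≡⟨ ℕ.*-comm (f v) _ ⟩
        degree H v * f v                     ∎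

    Covered : List E → V → Set
    Covered es v = Any (v ∈ᵉ_) es

    covered? : ∀ es v → Dec (Covered es v)
    covered? es v = Any.any? (v ∈ᵉ?_) es

    ∈⇒Covered : ∀ {es j v} → j ∈ es → v ∈ᵉ j → Covered es v
    ∈⇒Covered (here refl) v∈ = here v∈
    ∈⇒Covered (there j∈)    v∈ = there (∈⇒Covered j∈ v∈)

    -- Orders, last hyperedge first, in which each new hyperedge meets the union
    -- of the earlier ones in exactly one vertex.
    data Grown (s : E) : List E → Set where
      seed : Grown s [ s ]
      grow : ∀ {es j w} → Grown s es → j ∉ es → w ∈ᵉ j → Covered es w →
        (∀ {u} → u ∈ᵉ j → Covered es u → u ≡ w) → Grown s (j ∷ es)

    Grown-unique : ∀ {s es} → Grown s es → Unique es
    Grown-unique seed = [] ∷ []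
    Grown-unique (grow g j∉ _ _ _) = All.¬Any⇒All¬ _ j∉ ∷ Grown-unique g

    seed∈ : ∀ {s es} → Grown s es → s ∈ es
    seed∈ seed = here refl
    seed∈ (grow g _ _ _ _) = there (seed∈ g)

    start : List (V × E) → V → V
    start []            y = y
    start ((x , _) ∷ _) y = x

    -- Paths x₁ e₁ x₂ e₂ … x_l e_l y, given by the list of the (x_i , e_i).
    data Chain : List (V × E) → V → Set where
      []  : ∀ {y} → Chain [] y
      _∷_ : ∀ {x e ps y} → x ∈ᵉ e × start ps y ∈ᵉ e → Chain ps y → Chain ((x , e) ∷ ps) y

    Chain-∷ʳ : ∀ {ps y e z} → Chain ps y → y ∈ᵉ e → z ∈ᵉ e → Chain (ps ++ [ y , e ]) z
    Chain-∷ʳ []                             y∈ z∈ = (y∈ , z∈) ∷ []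
    Chain-∷ʳ (_∷_ {ps = []}    (x∈ , y∈′) c) y∈ z∈ = (x∈ , y∈′) ∷ Chain-∷ʳ c y∈ z∈
    Chain-∷ʳ (_∷_ {ps = _ ∷ _} (x∈ , y∈′) c) y∈ z∈ = (x∈ , y∈′) ∷ Chain-∷ʳ c y∈ z∈

    Chain-next : ∀ {ps y} → Chain ps y → ∀ i j → toℕ j ≡ suc (toℕ i) →
      proj₁ (lookup ps j) ∈ᵉ proj₂ (lookup ps i)
    Chain-next (_∷_ {ps = _ ∷ _} (_ , x∈) c) zero    (suc zero) eq = x∈
    Chain-next (_ ∷ c)                       (suc i) (suc j)    eq = Chain-next c i j (ℕ.suc-injective eq)

    Chain-last : ∀ {ps y} → Chain ps y → ∀ i → suc (toℕ i) ≡ length ps → y ∈ᵉ proj₂ (lookup ps i)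
    Chain-last (_∷_ {ps = []}    (_ , y∈) c) zero    eq = y∈
    Chain-last (_∷_ {ps = _ ∷ _} _ c)        (suc i) eq = Chain-last c i (ℕ.suc-injective eq)

    closedChain⇒Cycle : ∀ {x₀ e₀ x₁ e₁ rest} → let ps = (x₀ , e₀) ∷ (x₁ , e₁) ∷ rest in
      Chain ps x₀ → Unique (map proj₁ ps) → Unique (map proj₂ ps) → Cycle H
    closedChain⇒Cycle {x₀} {e₀} {x₁} {e₁} {rest} c uv ue = record
      { p          = length rest
      ; v          = proj₁ ∘ lookup ps
      ; e          = proj₂ ∘ lookup ps
      ; v-distinct = unique-lookup-injective proj₁ uv
      ; e-distinct = unique-lookup-injective proj₂ ue
      ; v∈e        = own c
      ; next∈e     = next
      }
      where
      ps = (x₀ , e₀) ∷ (x₁ , e₁) ∷ rest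
      N = length ps
      own : ∀ {ps y} → Chain ps y → ∀ i → proj₁ (lookup ps i) ∈ᵉ proj₂ (lookup ps i)
      own ((x∈ , _) ∷ c) zero    = x∈
      own (_ ∷ c)        (suc i) = own c i
      toℕ-mod : ∀ a → toℕ (a mod N) ≡ a ℕ.% N
      toℕ-mod a = Fin.toℕ-fromℕ< (m%n<n a N)
      next : ∀ i → proj₁ (lookup ps (suc (toℕ i) mod N)) ∈ᵉ proj₂ (lookup ps i)
      next i with suc (toℕ i) ℕ.<? N
      ... | yes lt = Chain-next c i (suc (toℕ i) mod N) (≡.trans (toℕ-mod (suc (toℕ i))) (m<n⇒m%n≡m lt))
      -- At the last index `mod` wraps around to zero, and the chain ends at its first vertex.
      ... | no ≮ = ≡.subst (λ z → proj₁ (lookup ps z) ∈ᵉ proj₂ (lookup ps i)) (≡.sym wrap) (Chain-last c i eq)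
        where
        eq : suc (toℕ i) ≡ N
        eq = ℕ.≤-antisym (Fin.toℕ<n i) (ℕ.≮⇒≥ ≮)
        wrap : suc (toℕ i) mod N ≡ zero
        wrap = Fin.toℕ-injective (≡.trans (toℕ-mod (suc (toℕ i))) (≡.trans (≡.cong (ℕ._% N) eq) (n%n≡0 N)))

    -- The end vertex v does not occur among the starting vertices recorded in `steps`, hence it is
    -- added in `uniqueᵛ`. The field `within` confines the path to `es`, so that a hyperedge outside
    -- `es` can be attached without repetition.
    record SimplePath (es : List E) (u v : V) : Set where
      field
        steps     : List (V × E)
        chain     : Chain steps v
        starts    : start steps v ≡ u
        nonempty  : 0 < length steps
        uniqueᵛ   : Unique (v ∷ map proj₁ steps)
        uniqueᵉ   : Unique (map proj₂ steps)
        within    : All (_∈ es) (map proj₂ steps)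

    open SimplePath

    Linked : List E → Set
    Linked es = ∀ u v → u ≢ v → Covered es u → Covered es v → SimplePath es u v

    singleStep : ∀ {es u v e} → e ∈ es → u ∈ᵉ e → v ∈ᵉ e → u ≢ v → SimplePath es u v
    singleStep {u = u} {v} {e} e∈ u∈ v∈ u≢v = record
      { steps = [ u , e ] ; chain = (u∈ , v∈) ∷ [] ; starts = refl ; nonempty = s≤s z≤n
      ; uniqueᵛ = ((λ v≡u → u≢v (≡.sym v≡u)) ∷ []) ∷ [] ∷ [] ; uniqueᵉ = [] ∷ [] ; within = e∈ ∷ [] }

    chain-covered : ∀ {es ps y x} → Chain ps y → All (_∈ es) (map proj₂ ps) → x ∈ map proj₁ ps → Covered es x
    chain-covered ((x∈ , _) ∷ c) (e∈ ∷ _) (here refl) = ∈⇒Covered e∈ x∈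
    chain-covered (_ ∷ c)        (_ ∷ es) (there x∈)    = chain-covered c es x∈

    ∉-within : ∀ {es : List E} {e js} → e ∉ es → All (_∈ es) js → e ∉ js
    ∉-within e∉ js e∈ = e∉ (All.lookup js e∈)

    extendˡ : ∀ {es e x w v} → e ∉ es → ¬ Covered es x → x ∈ᵉ e → w ∈ᵉ e → Covered es v →
      SimplePath es w v → SimplePath (e ∷ es) x v
    extendˡ {es} {e} {x} {w} {v} e∉ x∉ x∈ w∈ cv p = record
      { steps = (x , e) ∷ steps p
      ; chain = (x∈ , ≡.subst (_∈ᵉ e) (≡.sym (starts p)) w∈) ∷ chain p
      ; starts = refl
      ; nonempty = s≤s z≤n
      ; uniqueᵛ = reorder (uniqueᵛ p)
      ; uniqueᵉ = All.¬Any⇒All¬ _ (∉-within e∉ (within p)) ∷ uniqueᵉ p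
      ; within = here refl ∷ All.map there (within p) }
      where
      reorder : Unique (v ∷ map proj₁ (steps p)) → Unique (v ∷ x ∷ map proj₁ (steps p))
      reorder (v∉ ∷ u) = ((λ { refl → x∉ cv }) ∷ v∉)
        ∷ All.¬Any⇒All¬ _ (λ x∈ps → x∉ (chain-covered (chain p) (within p) x∈ps)) ∷ u

    extendʳ : ∀ {es e x w u} → e ∉ es → ¬ Covered es x → x ∈ᵉ e → w ∈ᵉ e → Covered es w →
      SimplePath es u w → SimplePath (e ∷ es) u x
    extendʳ {es} {e} {x} {w} {u} e∉ x∉ x∈ w∈ cw p = record
      { steps = steps p ++ [ w , e ]
      ; chain = Chain-∷ʳ (chain p) w∈ x∈
      ; starts = ≡.trans (start-∷ʳ (steps p)) (starts p)
      ; nonempty = ℕ.<-≤-trans (nonempty p) (ℕ.≤-trans (ℕ.m≤m+n _ _) (ℕ.≤-reflexive (≡.sym (List.length-++ (steps p)))))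
      ; uniqueᵛ = ≡.subst (λ xs → Unique (x ∷ xs)) (≡.sym (List.map-++ proj₁ (steps p) [ w , e ]))
          (All.¬Any⇒All¬ _ fresh ∷ unique-∷ʳ (uniqueᵛ p))
      ; uniqueᵉ = ≡.subst Unique (≡.sym (List.map-++ proj₂ (steps p) [ w , e ]))
          (Unique.++⁺ (uniqueᵉ p) ([] ∷ []) (λ { (e∈ , here refl) → ∉-within e∉ (within p) e∈ }))
      ; within = ≡.subst (All (_∈ (e ∷ es))) (≡.sym (List.map-++ proj₂ (steps p) [ w , e ]))
          (All.++⁺ (All.map there (within p)) (here refl ∷ []))
      }
      where
      start-∷ʳ : ∀ ps {z} → start (ps ++ [ w , e ]) z ≡ start ps w
      start-∷ʳ []      = refl
      start-∷ʳ (_ ∷ _) = refl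
      fresh : x ∉ map proj₁ (steps p) ++ [ w ]
      fresh x∈′ with ∈-++⁻ (map proj₁ (steps p)) x∈′
      ... | inj₁ x∈ps          = x∉ (chain-covered (chain p) (within p) x∈ps)
      ... | inj₂ (here refl) = x∉ cw
      unique-∷ʳ : ∀ {xs : List V} {y} → Unique (y ∷ xs) → Unique (xs ++ [ y ])
      unique-∷ʳ (y∉ ∷ u) = Unique.++⁺ u ([] ∷ []) (λ { (y∈ , here refl) → All.lookup y∉ y∈ refl })

    weaken : ∀ {es e u v} → SimplePath es u v → SimplePath (e ∷ es) u v
    weaken p = record { SimplePath p ; within = All.map there (within p) }

    -- Induction on the growth: a vertex not covered before lies in the newest hyperedge and reaches
    -- the earlier ones through the joint w.
    Grown⇒Linked : ∀ {s es} → Grown s es → Linked es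
    Grown⇒Linked seed u v u≢v (here u∈) (here v∈) = singleStep (here refl) u∈ v∈ u≢v
    Grown⇒Linked (grow {es} {e} {w} g e∉ w∈ cw _) u v u≢v cu cv with covered? es u | covered? es v
    ... | yes cu′ | yes cv′ = weaken (Grown⇒Linked g u v u≢v cu′ cv′)
    ... | no u∉   | no v∉   = singleStep (here refl) (Any.head u∉ cu) (Any.head v∉ cv) u≢v
    ... | no u∉   | yes cv′ with w Fin.≟ v
    ...   | yes refl = singleStep (here refl) (Any.head u∉ cu) w∈ u≢v
    ...   | no w≢v     = extendˡ e∉ u∉ (Any.head u∉ cu) w∈ cv′ (Grown⇒Linked g w v w≢v cw cv′)
    Grown⇒Linked (grow {es} {e} {w} g e∉ w∈ cw _) u v u≢v cu cv | yes cu′ | no v∉ with u Fin.≟ w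
    ...   | yes refl = singleStep (here refl) w∈ (Any.head v∉ cv) u≢v
    ...   | no u≢w     = extendʳ e∉ v∉ (Any.head v∉ cv) w∈ cw (Grown⇒Linked g u w u≢w cu′ cw)

    -- The path from u to w inside `es`, followed by e from w back to u, is a cycle; e does not
    -- repeat because it lies outside `es`.
    Linked⇒Cycle : ∀ {es e u w} → Linked es → e ∉ es → u ∈ᵉ e → w ∈ᵉ e → u ≢ w → Covered es u → Covered es w → Cycle H
    Linked⇒Cycle {es} {e} {u} {w} linked e∉ u∈ w∈ u≢w cu cw = close (steps p) (chain p) (starts p) (nonempty p)
      (uniqueᵛ p) (uniqueᵉ p) (∉-within e∉ (within p))
      where
      p = linked u w u≢w cu cw
      unique-∷ʳ : ∀ {a} {A : Set a} {xs : List A} {y} → y ∉ xs → Unique xs → Unique (xs ++ [ y ])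
      unique-∷ʳ y∉ u = Unique.++⁺ u ([] ∷ []) (λ { (y∈ , here refl) → y∉ y∈ })
      close : ∀ ps → Chain ps w → start ps w ≡ u → 0 < length ps → Unique (w ∷ map proj₁ ps) →
        Unique (map proj₂ ps) → e ∉ map proj₂ ps → Cycle H
      close (x ∷ []) c refl _ (w∉ ∷ uv) ue e∉ps = closedChain⇒Cycle (Chain-∷ʳ c w∈ u∈)
        (unique-∷ʳ (All.All¬⇒¬Any w∉) uv) (unique-∷ʳ e∉ps ue)
      close (x ∷ y ∷ ps) c refl _ (w∉ ∷ uv) ue e∉ps = closedChain⇒Cycle (Chain-∷ʳ c w∈ u∈)
        (≡.subst Unique (≡.sym (List.map-++ proj₁ (x ∷ y ∷ ps) [ w , e ])) (unique-∷ʳ (All.All¬⇒¬Any w∉) uv))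
        (≡.subst Unique (≡.sym (List.map-++ proj₂ (x ∷ y ∷ ps) [ w , e ])) (unique-∷ʳ e∉ps ue))

  module UniformHypertrees (H : Hypergraph) {k : ℕ} (1≤k : 1 ≤ k) (uniform : Uniform k H)
    (connected : Connected H) (acyclic : ¬ Cycle H) where
    open Incidence H
    open DecMembership (Fin._≟_ {n = size H}) using () renaming (_∈?_ to _∈ˡ?_)

    length-vertices : ∀ j → length (vertices j) ≡ k
    length-vertices j = ≡.trans (length-members (edge H j)) (uniform j)

    someVertex : ∀ j → ∃[ v ] v ∈ᵉ j
    someVertex j = nonempty (vertices j) (ℕ.≤-trans 1≤k (ℕ.≤-reflexive (≡.sym (length-vertices j)))) (∈-members⁻ _)
      where
      nonempty : ∀ (xs : List V) → 1 ≤ length xs → (∀ {v} → v ∈ xs → v ∈ᵉ j) → ∃[ v ] v ∈ᵉ j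
      nonempty (x ∷ _) _ sub = x , sub (here refl)

    Grown⇒all∈ : ∀ {s es} → Grown s es → length es ≡ size H → ∀ j → j ∈ es
    Grown⇒all∈ {es = es} g len j = ∈-resp-↭ (unique-⊆-length⇒↭ (Grown-unique g) (λ _ → ∈-allFin _)
      (ℕ.≤-reflexive (≡.trans (List.length-tabulate {n = size H} (λ i → i)) (≡.sym len)))) (∈-allFin j)
      where open import Data.List.Relation.Binary.Permutation.Propositional.Properties using (∈-resp-↭)

    -- Follow the walk from the covered vertex. The step that leaves the covered set uses a new
    -- hyperedge; if no step leaves it, the target hyperedge itself is met at a covered vertex.
    crossing : ∀ {es u v} → Star (Adjacent H) v u → Covered es v → (∃[ j ] j ∉ es × u ∈ᵉ j) →
      ∃[ j ] ∃[ w ] j ∉ es × w ∈ᵉ j × Covered es w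
    crossing {u = u} ε cv (j , j∉ , u∈) = j , u , j∉ , u∈ , cv
    crossing {es} {v = v} (_◅_ {j = v′} (e , v∈ , v′∈) path) cv target with covered? es v′
    ... | yes cv′ = crossing path cv′ target
    ... | no v′∉  = e , v , (λ e∈ → v′∉ (∈⇒Covered e∈ v′∈)) , v∈ , cv

    growOnce : ∀ {s es} → Grown s es → length es < size H → ∃[ j ] Grown s (j ∷ es)
    growOnce {s} {es} g lt with Fin.any? {n = size H} (λ j → ¬? (j ∈ˡ? es))
    ... | no all∈ = ⊥-elim (ℕ.<⇒≱ lt (ℕ.≤-trans
      (ℕ.≤-reflexive (≡.sym (List.length-tabulate {n = size H} (λ i → i))))
      (unique-⊆⇒length≤ (Unique.allFin⁺ (size H)) (λ {j} _ → decidable-stable (j ∈ˡ? es) (λ j∉ → all∈ (j , j∉))))))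
    ... | yes (j , j∉)
      with u , u∈ ← someVertex j
      with v , v∈ ← someVertex s
      with j′ , w , j′∉ , w∈ , cw ← crossing (connected v u) (∈⇒Covered (seed∈ g) v∈) (j , j∉ , u∈)
      -- A second common vertex would be linked to w inside `es` and so close a cycle.
      = j′ , grow g j′∉ w∈ cw (λ {u} u∈ cu → decidable-stable (u Fin.≟ w)
          (λ u≢w → acyclic (Linked⇒Cycle (Grown⇒Linked g) j′∉ u∈ w∈ u≢w cu cw)))

    growTo : ∀ s l → suc l ≤ size H → ∃[ es ] Grown s es × length es ≡ suc l
    growTo s zero    _  = [ s ] , seed , refl
    growTo s (suc l) le with es , g , len ← growTo s l (ℕ.<⇒≤ le)
      with j , g′ ← growOnce g (ℕ.<-≤-trans (s≤s (ℕ.≤-reflexive len)) le) = j ∷ es , g′ , ≡.cong suc len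

    growAll : ∀ s → ∃[ es ] Grown s es × length es ≡ size H
    growAll s = bySize (size H) refl
      where
      bySize : ∀ m → m ≡ size H → ∃[ es ] Grown s es × length es ≡ size H
      bySize zero    eq with () ← ≡.subst Fin (≡.sym eq) s
      bySize (suc m) eq with es , g , len ← growTo s m (ℕ.≤-reflexive eq) = es , g , ≡.trans len eq

    ∑-≟ : ∀ (w : V) → ∑ (allFin (order H)) (λ v → [ v Fin.≟ w ]· 1) ≡ 1
    ∑-≟ w = ≡.trans (∑ℕ.∑-single (Unique.allFin⁺ (order H)) (∈-allFin w) (λ {v} _ v≢w → ∑ℕ.[]·-no (v Fin.≟ w) v≢w))
      (∑ℕ.[]·-yes (w Fin.≟ w) refl)

    coveredCount : List E → ℕ
    coveredCount es = ∑ (allFin (order H)) (λ v → [ covered? es v ]· 1)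

    -- Of the k vertices of a new hyperedge exactly one, the joint, is covered already. Adding
    -- `length es` on the left avoids truncated subtraction.
    Grown⇒coveredCount : ∀ {s es} → Grown s es → coveredCount es + length es ≡ 1 + length es * k
    Grown⇒coveredCount {s} seed = begin
      coveredCount [ s ] + 1  ≡⟨ ≡.cong (_+ 1) (∑ℕ.∑-cong (allFin (order H)) (λ v →
                                   ∑ℕ.[]·-⇔ (covered? [ s ] v) (v ∈ᵉ? s) (λ { (here v∈) → v∈ }) here refl)) ⟩
      ∑ (allFin (order H)) (λ v → [ v ∈ᵉ? s ]· 1) + 1  ≡⟨ ≡.cong (_+ 1) (≡.trans (∑-∈? (edge H s)) (uniform s)) ⟩
      k + 1                   ≡⟨ arith k ⟩
      1 + (k + 0)             ∎
      where
      open ≡-Reasoning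
      arith : ∀ k → k + 1 ≡ 1 + (k + 0)
      arith = solve-∀
    Grown⇒coveredCount (grow {es} {j} {w} g j∉ w∈ cw only) = begin
      coveredCount (j ∷ es) + suc (length es)     ≡⟨ ≡.sym (ℕ.+-assoc (coveredCount (j ∷ es)) 1 (length es)) ⟩
      coveredCount (j ∷ es) + 1 + length es       ≡⟨ ≡.cong (_+ length es) total ⟩
      k + coveredCount es + length es             ≡⟨ ℕ.+-assoc k _ _ ⟩
      k + (coveredCount es + length es)           ≡⟨ ≡.cong (k +_) (Grown⇒coveredCount g) ⟩
      k + (1 + length es * k)                     ≡⟨ ℕ.+-suc k _ ⟩
      1 + (k + length es * k)                     ∎
      where
      open ≡-Reasoning
      Vs = allFin (order H)
      -- Inclusion-exclusion at a single vertex; the intersection of j with the covered set is {w}.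
      pointwise : ∀ v → [ covered? (j ∷ es) v ]· 1 + [ v Fin.≟ w ]· 1 ≡ [ v ∈ᵉ? j ]· 1 + [ covered? es v ]· 1
      pointwise v with v ∈ᵉ? j | covered? es v | v Fin.≟ w
      ... | yes _   | yes _  | yes _      = refl
      ... | yes v∈  | yes cv | no v≢w     = ⊥-elim (v≢w (only v∈ cv))
      ... | yes _   | no v∉  | yes refl = ⊥-elim (v∉ cw)
      ... | yes _   | no _   | no _       = refl
      ... | no w∉   | _      | yes refl = ⊥-elim (w∉ w∈)
      ... | no _    | yes _  | no _       = refl
      ... | no _    | no _   | no _       = refl
      total : coveredCount (j ∷ es) + 1 ≡ k + coveredCount es
      total = begin
        coveredCount (j ∷ es) + 1
          ≡⟨ ≡.cong (coveredCount (j ∷ es) +_) (∑-≟ w) ⟨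
        coveredCount (j ∷ es) + ∑ Vs (λ v → [ v Fin.≟ w ]· 1)
          ≡⟨ ∑ℕ.∑-+ Vs ⟨
        ∑ Vs (λ v → [ covered? (j ∷ es) v ]· 1 + [ v Fin.≟ w ]· 1)
          ≡⟨ ∑ℕ.∑-cong Vs pointwise ⟩
        ∑ Vs (λ v → [ v ∈ᵉ? j ]· 1 + [ covered? es v ]· 1)
          ≡⟨ ∑ℕ.∑-+ Vs ⟩
        ∑ Vs (λ v → [ v ∈ᵉ? j ]· 1) + coveredCount es
          ≡⟨ ≡.cong (_+ coveredCount es) (≡.trans (∑-∈? (edge H j)) (uniform j)) ⟩
        k + coveredCount es ∎

    inSomeEdge : 1 ≤ size H → ∀ v → ∃[ j ] v ∈ᵉ j
    inSomeEdge 1≤m v with u , u∈ ← someVertex (fromℕ< 1≤m) = first (connected v u) u∈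
      where
      first : ∀ {u j} → Star (Adjacent H) v u → u ∈ᵉ j → ∃[ j ] v ∈ᵉ j
      first {j = j} ε u∈ = j , u∈
      first ((j , v∈ , _) ◅ _) _ = j , v∈

    degree≥1 : 1 ≤ size H → ∀ v → 1 ≤ degree H v
    degree≥1 1≤m v with j , v∈ ← inSomeEdge 1≤m v = ℕ.≤-trans
      (ℕ.≤-trans (ℕ.≤-reflexive (≡.sym (∑ℕ.[]·-yes (v ∈ᵉ? j) v∈))) (∑ℕ.∑-≥ {f = λ j → [ v ∈ᵉ? j ]· 1} (∈-allFin j)))
      (ℕ.≤-reflexive (≡.sym (degree≡∑ v)))

    order≡ : 1 ≤ size H → order H + size H ≡ 1 + size H * k
    order≡ 1≤m with es , g , len ← growAll (fromℕ< 1≤m) = begin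
      order H + size H              ≡⟨ ≡.cong₂ _+_ all (≡.sym len) ⟩
      coveredCount es + length es   ≡⟨ Grown⇒coveredCount g ⟩
      1 + length es * k             ≡⟨ ≡.cong (λ z → 1 + z * k) len ⟩
      1 + size H * k                ∎
      where
      open ≡-Reasoning
      all : order H ≡ coveredCount es
      all = ≡.sym (≡.trans
        (∑ℕ.∑-cong (allFin (order H)) (λ v → ∑ℕ.[]·-yes (covered? es v)
          (∈⇒Covered (Grown⇒all∈ g len (proj₁ (inSomeEdge 1≤m v))) (proj₂ (inSomeEdge 1≤m v)))))
        (≡.trans (∑-const-1 (allFin (order H))) (List.length-tabulate {n = order H} (λ i → i))))

    ∑-degree : ∑ (allFin (order H)) (degree H) ≡ size H * k
    ∑-degree = begin
      ∑ (allFin (order H)) (degree H)                     ≡⟨ ∑ℕ.∑-cong (allFin (order H)) (λ v → ℕ.*-identityʳ (degree H v)) ⟨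
      ∑ (allFin (order H)) (λ v → degree H v * 1)         ≡⟨ ∑∑-edges (λ _ → 1) ⟨
      ∑ (allFin (size H)) (λ j → ∑ (vertices j) (λ _ → 1)) ≡⟨ ∑ℕ.∑-cong (allFin (size H)) (λ j → ≡.trans (∑-const-1 (vertices j)) (≡.trans (length-vertices j) (≡.sym (ℕ.*-identityʳ k)))) ⟩
      ∑ (allFin (size H)) (λ _ → k * 1)                   ≡⟨ ∑ℕ.∑-*ˡ (allFin (size H)) k ⟨
      k * ∑ (allFin (size H)) (λ _ → 1)                   ≡⟨ ≡.cong (k *_) (≡.trans (∑-const-1 (allFin (size H))) (List.length-tabulate {n = size H} (λ i → i))) ⟩
      k * size H                                          ≡⟨ ℕ.*-comm k _ ⟩
      size H * k                                          ∎
      where open ≡-Reasoning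

-- Recognising the hyperpath by its degrees and excesses

module HyperpathRecognition where

  open import Data.Nat.Base using (_+_; _*_; _≤_; _<_)
  open ListCombinatorics
  open WalkCounting
  open HypertreeGrowth

  open ∑ℕ using (∑; [_]·)

  ∑-⊆-≤ : ∀ {a} {A : Set a} {xs ys : List A} {f : A → ℕ} → Unique ys → (∀ {x} → x ∈ ys → x ∈ xs) → ∑ ys f ≤ ∑ xs f
  ∑-⊆-≤ {ys = ys} {f} u sub with rest , p ← unique-⊆⇒↭++ u sub =
    ℕ.≤-trans (ℕ.m≤m+n _ _) (ℕ.≤-reflexive (≡.sym (≡.trans (∑ℕ.∑-↭ p) (∑ℕ.∑-++ ys rest))))

  ∑-mono-≤ : ∀ {a} {A : Set a} (xs : List A) {f g : A → ℕ} → (∀ x → f x ≤ g x) → ∑ xs f ≤ ∑ xs g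
  ∑-mono-≤ []       le = z≤n
  ∑-mono-≤ (x ∷ xs) le = ℕ.+-mono-≤ (le x) (∑-mono-≤ xs le)

  -- Positions are natural numbers rather than elements of `Fin`, so that they can be shifted by a
  -- block length and compared with `Between`.
  data At {a} {A : Set a} : List A → ℕ → A → Set a where
    here  : ∀ {x xs} → At (x ∷ xs) 0 x
    there : ∀ {x y xs i} → At xs i y → At (x ∷ xs) (suc i) y

  module _ {a} {A : Set a} where

    At-lookup : ∀ (xs : List A) i → At xs (toℕ i) (lookup xs i)
    At-lookup (x ∷ xs) zero    = here
    At-lookup (x ∷ xs) (suc i) = there (At-lookup xs i)

    At⇒∈ : ∀ {xs : List A} {i x} → At xs i x → x ∈ xs
    At⇒∈ here      = here refl
    At⇒∈ (there p) = there (At⇒∈ p)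

    At⇒< : ∀ {xs : List A} {i x} → At xs i x → i < length xs
    At⇒< here      = s≤s z≤n
    At⇒< (there p) = s≤s (At⇒< p)

    At-++⁻ : ∀ (xs : List A) {ys i x} → At (xs ++ ys) i x →
      At xs i x ⊎ ∃[ i′ ] i ≡ length xs + i′ × At ys i′ x
    At-++⁻ []       p    = inj₂ (_ , refl , p)
    At-++⁻ (x ∷ xs) here = inj₁ here
    At-++⁻ (x ∷ xs) (there p) with At-++⁻ xs p
    ... | inj₁ q              = inj₁ (there q)
    ... | inj₂ (i′ , eq , q) = inj₂ (i′ , ≡.cong suc eq , q)

  listBijection : ∀ {m n} (xs : List (Fin n)) → Unique xs → (∀ v → v ∈ xs) → m ≡ length xs → Fin m ↔ Fin n
  listBijection xs u complete refl = mk↔ₛ′ (lookup xs) (λ v → index (complete v))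
    (λ v → ≡.sym (lookup-index (complete v)))
    (λ i → unique-lookup-injective (λ x → x) (≡.subst Unique (≡.sym (List.map-id xs)) u)
      (≡.sym (lookup-index (complete (lookup xs i)))))

  At-bijection : ∀ {m n} (xs : List (Fin n)) u c (eq : m ≡ length xs) i →
    At xs (toℕ i) (Inverse.to (listBijection xs u c eq) i)
  At-bijection xs u c refl i = At-lookup xs i

  complete : ∀ {n} {xs : List (Fin n)} → Unique xs → length xs ≡ n → ∀ v → v ∈ xs
  complete {n} u len v = ∈-resp-↭ (unique-⊆-length⇒↭ u (λ _ → ∈-allFin _)
    (ℕ.≤-reflexive (≡.trans (List.length-tabulate {n = n} (λ i → i)) (≡.sym len)))) (∈-allFin v)

  ∈-interval⁻ : ∀ {k m j i} → i ∈ₛ interval k m j → Between k (toℕ j) (toℕ i)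
  ∈-interval⁻ {k} {m} {j} {i} i∈ = witness (between? k (toℕ j) (toℕ i))
    (≡.trans (≡.sym (Vec.lookup∘tabulate (λ i → does (between? k (toℕ j) (toℕ i))) i)) (Vec.[]=⇒lookup i∈))
    where
    witness : ∀ {A : Set} (a? : Dec A) → does a? ≡ true → A
    witness (yes a) _ = a

  ∈-interval⁺ : ∀ {k m j i} → Between k (toℕ j) (toℕ i) → i ∈ₛ interval k m j
  ∈-interval⁺ {k} {m} {j} {i} b = Vec.lookup⇒[]= i (interval k m j)
    (≡.trans (Vec.lookup∘tabulate (λ i → does (between? k (toℕ j) (toℕ i))) i) (dec-true (between? k (toℕ j) (toℕ i)) b))

  -- The number of hyperedges other than j that meet j, for vertex degrees 1 and 2.
  excess : ∀ (H : Hypergraph) → Fin (size H) → ℕ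
  excess H j = ∑ (members (edge H j)) (λ v → degree H v ∸ 1)

  module Recognition (H : Hypergraph) {k : ℕ} (2≤k : 2 ≤ k) (uniform : Uniform k H)
    (connected : Connected H) (acyclic : ¬ Cycle H) (1≤m : 1 ≤ size H)
    (degree≤2 : ∀ v → degree H v ≤ 2) where
    open Incidence H
    open UniformHypertrees H (ℕ.<⇒≤ 2≤k) uniform connected acyclic

    spacing≡ : suc (spacing k) ≡ k
    spacing≡ = ℕ.m+[n∸m]≡n 2≤k

    order≡spacing : order H ≡ suc (size H * spacing k)
    order≡spacing = ℕ.+-cancelʳ-≡ (size H) _ _ (begin
      order H + size H                  ≡⟨ order≡ 1≤m ⟩
      1 + size H * k                    ≡⟨ ≡.cong (λ z → 1 + size H * z) spacing≡ ⟨
      1 + size H * suc (spacing k)      ≡⟨ arith (size H) (spacing k) ⟩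
      suc (size H * spacing k) + size H ∎)
      where
      open ≡-Reasoning
      arith : ∀ m s → 1 + m * suc s ≡ suc (m * s) + m
      arith = solve-∀

    -- Double counting gives the sum of d (d - 1). For degrees 1 and 2 this is twice the sum of d -
    -- 1, which is mk - n = m - 1.
    ∑-excess : ∑ (allFin (size H)) (excess H) + 2 ≡ 2 * size H
    ∑-excess = begin
      ∑ (allFin (size H)) (excess H) + 2                  ≡⟨ ≡.cong (_+ 2) (∑∑-edges (λ v → degree H v ∸ 1)) ⟩
      ∑ Vs (λ v → degree H v * (degree H v ∸ 1)) + 2      ≡⟨ ≡.cong (_+ 2) (∑ℕ.∑-cong Vs (λ v → double (degree≥1 1≤m v) (degree≤2 v))) ⟩
      ∑ Vs (λ v → 2 * (degree H v ∸ 1)) + 2               ≡⟨ ≡.cong (_+ 2) (∑ℕ.∑-*ˡ Vs 2) ⟨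
      2 * ∑ Vs (λ v → degree H v ∸ 1) + 2                 ≡⟨ ℕ.*-distribˡ-+ 2 (∑ Vs (λ v → degree H v ∸ 1)) 1 ⟨
      2 * (∑ Vs (λ v → degree H v ∸ 1) + 1)               ≡⟨ ≡.cong (2 *_) total ⟩
      2 * size H                                          ∎
      where
      open ≡-Reasoning
      Vs = allFin (order H)
      double : ∀ {d} → 1 ≤ d → d ≤ 2 → d * (d ∸ 1) ≡ 2 * (d ∸ 1)
      double {1} _ _ = refl
      double {2} _ _ = refl
      double {suc (suc (suc _))} _ (s≤s (s≤s ()))
      σ = ∑ Vs (λ v → degree H v ∸ 1)
      total : σ + 1 ≡ size H
      total = ℕ.+-cancelʳ-≡ (size H * k) _ _ (begin
        σ + 1 + size H * k      ≡⟨ ℕ.+-assoc σ 1 (size H * k) ⟩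
        σ + (1 + size H * k)    ≡⟨ ≡.cong (σ +_) (order≡ 1≤m) ⟨
        σ + (order H + size H)  ≡⟨ ℕ.+-assoc σ (order H) (size H) ⟨
        σ + order H + size H    ≡⟨ ≡.cong (_+ size H) sub1 ⟩
        size H * k + size H     ≡⟨ ℕ.+-comm (size H * k) (size H) ⟩
        size H + size H * k     ∎)
        where
        sub1 : ∑ Vs (λ v → degree H v ∸ 1) + order H ≡ size H * k
        sub1 = begin
          ∑ Vs (λ v → degree H v ∸ 1) + order H          ≡⟨ ≡.cong (σ +_) (≡.trans (∑-const-1 Vs) (List.length-tabulate {n = order H} (λ i → i))) ⟨
          ∑ Vs (λ v → degree H v ∸ 1) + ∑ Vs (λ _ → 1)   ≡⟨ ∑ℕ.∑-+ Vs ⟨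
          ∑ Vs (λ v → degree H v ∸ 1 + 1)                ≡⟨ ∑ℕ.∑-cong Vs (λ v → ℕ.m∸n+n≡m (degree≥1 1≤m v)) ⟩
          ∑ Vs (degree H)                                ≡⟨ ∑-degree ⟩
          size H * k                                     ∎

    -- If every excess were at least 2, they would add up to at least 2m, two more than their actual
    -- sum.
    endEdge : ∃[ s ] excess H s ≤ 1
    endEdge = decidable-stable (Fin.any? (λ j → excess H j ℕ.≤? 1)) λ none →
      ℕ.<-irrefl refl (ℕ.<-≤-trans (ℕ.m<m+n (2 * size H) {2} (s≤s z≤n)) (ℕ.≤-trans (ℕ.+-monoˡ-≤ 2 (begin
        2 * size H                     ≡⟨ ≡.cong (2 *_) (≡.trans (∑-const-1 Es) (List.length-tabulate {n = size H} (λ i → i))) ⟨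
        2 * ∑ Es (λ _ → 1)             ≡⟨ ∑ℕ.∑-*ˡ Es 2 ⟩
        ∑ Es (λ _ → 2)                 ≤⟨ ∑-mono-≤ Es (λ j → ℕ.≰⇒> (λ ≤1 → none (j , ≤1))) ⟩
        ∑ Es (excess H)                ∎)) (ℕ.≤-reflexive ∑-excess)))
      where
      open ℕ.≤-Reasoning
      Es = allFin (size H)

    threeEdges : ∀ {v a b c} → v ∈ᵉ a → v ∈ᵉ b → v ∈ᵉ c → a ≢ b → a ≢ c → b ≢ c → ⊥
    threeEdges {v} {a} {b} {c} va vb vc a≢b a≢c b≢c = ℕ.<⇒≱ (s≤s (degree≤2 v))
      (unique-⊆⇒length≤ {ys = a ∷ b ∷ c ∷ []} ((a≢b ∷ a≢c ∷ []) ∷ (b≢c ∷ []) ∷ [] ∷ [])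
        (λ { (here refl) → inc va ; (there (here refl)) → inc vb ; (there (there (here refl))) → inc vc }))
      where
      inc : ∀ {j} → v ∈ᵉ j → j ∈ filter (v ∈ᵉ?_) (allFin (size H))
      inc v∈ = ∈-filter⁺ (v ∈ᵉ?_) (∈-allFin _) v∈

    twoEdges : ∀ {v a b} → v ∈ᵉ a → v ∈ᵉ b → a ≢ b → 2 ≤ degree H v
    twoEdges {v} {a} {b} va vb a≢b = unique-⊆⇒length≤ {ys = a ∷ b ∷ []} ((a≢b ∷ []) ∷ [] ∷ [])
      (λ { (here refl) → inc va ; (there (here refl)) → inc vb })
      where
      inc : ∀ {j} → v ∈ᵉ j → j ∈ filter (v ∈ᵉ?_) (allFin (size H))
      inc v∈ = ∈-filter⁺ (v ∈ᵉ?_) (∈-allFin _) v∈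

    twoJoints : ∀ {j u v} → u ∈ᵉ j → v ∈ᵉ j → u ≢ v → 2 ≤ degree H u → 2 ≤ degree H v → 2 ≤ excess H j
    twoJoints {j} {u} {v} u∈ v∈ u≢v 2≤u 2≤v = ℕ.≤-trans
      (ℕ.+-mono-≤ (ℕ.∸-monoˡ-≤ 1 2≤u) (ℕ.+-mono-≤ (ℕ.∸-monoˡ-≤ 1 2≤v) z≤n))
      (∑-⊆-≤ {ys = u ∷ v ∷ []} ((u≢v ∷ []) ∷ [] ∷ [])
        (λ { (here refl) → ∈-members⁺ (edge H j) u∈ ; (there (here refl)) → ∈-members⁺ (edge H j) v∈ }))

    -- By connectedness some other hyperedge crosses out of `[ j ]`, and the crossing vertex has
    -- degree at least 2.
    excess≥1 : 2 ≤ size H → ∀ j → 1 ≤ excess H j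
    excess≥1 2≤m j with another
      where
      another : ∃[ j′ ] j′ ≢ j
      another = decidable-stable (Fin.any? (λ j′ → ¬? (j′ Fin.≟ j))) (λ none → ℕ.<⇒≱ 2≤m (ℕ.≤-trans
        (ℕ.≤-reflexive (≡.sym (List.length-tabulate {n = size H} (λ i → i))))
        (unique-⊆⇒length≤ {xs = [ j ]} (Unique.allFin⁺ (size H))
          (λ {j′} _ → here (decidable-stable (j′ Fin.≟ j) (λ j′≢j → none (j′ , j′≢j)))))))
    ... | j′ , j′≢j
      with u , u∈ ← someVertex j′
      with v , v∈ ← someVertex j
      with i , w , i∉ , w∈i , here w∈j ← crossing {es = [ j ]} (connected v u) (here v∈) (j′ , (λ { (here eq) → j′≢j eq }) , u∈)
      = ℕ.≤-trans (ℕ.∸-monoˡ-≤ 1 (twoEdges w∈i w∈j (λ i≡j → i∉ (here i≡j))))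
          (∑ℕ.∑-≥ {f = λ v → degree H v ∸ 1} (∈-members⁺ (edge H j) w∈j))

    module _ (excess≤2 : ∀ j → excess H j ≤ 2) where

      threeJoints : ∀ {j u v w} → u ∈ᵉ j → v ∈ᵉ j → w ∈ᵉ j → u ≢ v → u ≢ w → v ≢ w →
        2 ≤ degree H u → 2 ≤ degree H v → 2 ≤ degree H w → ⊥
      threeJoints {j} {u} {v} {w} u∈ v∈ w∈ u≢v u≢w v≢w 2≤u 2≤v 2≤w = ℕ.<⇒≱ (s≤s (excess≤2 j)) (ℕ.≤-trans
        (ℕ.+-mono-≤ (ℕ.∸-monoˡ-≤ 1 2≤u) (ℕ.+-mono-≤ (ℕ.∸-monoˡ-≤ 1 2≤v) (ℕ.+-mono-≤ (ℕ.∸-monoˡ-≤ 1 2≤w) z≤n)))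
        (∑-⊆-≤ {ys = u ∷ v ∷ w ∷ []} ((u≢v ∷ u≢w ∷ []) ∷ (v≢w ∷ []) ∷ [] ∷ [])
          (λ { (here refl) → ∈-members⁺ (edge H j) u∈ ; (there (here refl)) → ∈-members⁺ (edge H j) v∈
             ; (there (there (here refl))) → ∈-members⁺ (edge H j) w∈ })))

      -- Every joint of f already has its second hyperedge in `es`. As degrees are at most 2,
      -- nothing new can be attached to f.
      Saturated : List E → E → Set
      Saturated es f = ∀ v → v ∈ᵉ f → 2 ≤ degree H v → ∃[ g ] g ∈ es × g ≢ f × v ∈ᵉ g

      -- The invariant of a path growing at its newest hyperedge h: all earlier hyperedges are
      -- saturated, and h has at most one joint still open, being either an end hyperedge or already
      -- joined to an earlier one.
      record PathLike (h : E) (es : List E) : Set where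
        field
          tail-saturated : ∀ {f} → f ∈ es → Saturated (h ∷ es) f
          head-joint     : excess H h ≤ 1 ⊎ (∃[ w ] ∃[ g ] w ∈ᵉ h × g ∈ es × w ∈ᵉ g)

      open PathLike

      -- If w lay in an earlier hyperedge f, saturation would give a second old hyperedge at w, and
      -- j would be a third one there.
      attach-new : ∀ {j h es w} → PathLike h es → j ∉ h ∷ es → w ∈ᵉ j → ¬ Covered es w
      attach-new {j} {h} {es} {w} P j∉ w∈ cw with f , f∈ , w∈f ← find cw
        with g , g∈ , g≢f , w∈g ← tail-saturated P f∈ w w∈f (twoEdges w∈ w∈f λ { refl → j∉ (there f∈) })
        = threeEdges w∈ w∈f w∈g (λ { refl → j∉ (there f∈) }) (λ { refl → j∉ g∈ }) (λ f≡g → g≢f (≡.sym f≡g))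

      PathLike-grow : ∀ {j h es w} → PathLike h es → h ∉ es → j ∉ h ∷ es → w ∈ᵉ j → w ∈ᵉ h → ¬ Covered es w →
        PathLike j (h ∷ es)
      PathLike-grow {j} {h} {es} {w} P h∉ j∉ w∈ w∈h w-new = record
        { tail-saturated = λ { (here refl) → saturated-h ; (there f∈) v v∈ 2≤ → lift (tail-saturated P f∈ v v∈ 2≤) }
        ; head-joint = inj₂ (w , h , w∈ , here refl , w∈h) }
        where
        lift : ∀ {f v} → ∃[ g ] g ∈ h ∷ es × g ≢ f × v ∈ᵉ g → ∃[ g ] g ∈ j ∷ h ∷ es × g ≢ f × v ∈ᵉ g
        lift (g , g∈ , rest) = g , there g∈ , rest
        j≢h : j ≢ h
        j≢h refl = j∉ (here refl)
        2≤w : 2 ≤ degree H w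
        2≤w = twoEdges w∈ w∈h j≢h
        saturated-h : Saturated (j ∷ h ∷ es) h
        saturated-h v v∈ 2≤v with v Fin.≟ w
        ... | yes refl = j , here refl , j≢h , w∈
        ... | no v≢w with head-joint P
        -- The starting hyperedge has excess at most 1, so w is its only joint.
        ...   | inj₁ ≤1 = ⊥-elim (ℕ.<⇒≱ (twoJoints v∈ w∈h v≢w 2≤v 2≤w) ≤1)
        ...   | inj₂ (w′ , g , w′∈h , g∈ , w′∈g) with v Fin.≟ w′
        ...     | yes refl = g , there (there g∈) , (λ { refl → h∉ g∈ }) , w′∈g
        -- A joint apart from w, shared with j, and from w′, shared with g, would be a third joint
        -- of h.
        ...     | no v≢w′ = ⊥-elim (threeJoints v∈ w∈h w′∈h v≢w v≢w′ (λ { refl → w-new (∈⇒Covered g∈ w′∈g) })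
                    2≤v 2≤w (twoEdges w′∈h w′∈g (λ { refl → h∉ g∈ })))

      -- Vertex numberings along a path, its hyperedges taken in the order es.
      data Ladder : List E → List V → Set where
        base : ∀ {j xs} → xs ↭ vertices j → Ladder [ j ] xs
        step : ∀ {j es xs w vs} → Ladder es (w ∷ vs) → xs ++ [ w ] ↭ vertices j →
          (∀ {u} → u ∈ xs → ¬ Covered es u) → Ladder (j ∷ es) (xs ++ w ∷ vs)

      -- The numbering must begin at the joint with the next hyperedge, which is not yet known.
      -- Hence a numbering is kept ready for every new vertex x of h as its first vertex.
      Climbable : E → List E → Set
      Climbable h es = ∀ x → x ∈ᵉ h → ¬ Covered es x → ∃[ vs ] Ladder (h ∷ es) (x ∷ vs)

      Climbable-seed : ∀ s → Climbable s []
      Climbable-seed s x x∈ _ with ys , p ← ∈⇒↭∷ (∈-members⁺ (edge H s) x∈) = ys , base (↭-sym p)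

      Climbable-grow : ∀ {j h es w} → Climbable h es → w ∈ᵉ j → w ∈ᵉ h → ¬ Covered es w →
        (∀ {u} → u ∈ᵉ j → Covered (h ∷ es) u → u ≡ w) → Climbable j (h ∷ es)
      Climbable-grow {j} {h} {es} {w} climb w∈ w∈h w-new only x x∈ x-new
        with vs , L ← climb w w∈h w-new
        -- The block of j begins with the requested x and ends with w, which is also the first
        -- vertex of the numbering built so far. The order of the vertices in between is arbitrary.
        with zs , p ← unique-⊆⇒↭++ {ys = w ∷ x ∷ []} {xs = vertices j} (((λ { refl → x-new (here w∈h) }) ∷ []) ∷ [] ∷ [])
               (λ { (here refl) → ∈-members⁺ (edge H j) w∈ ; (there (here refl)) → ∈-members⁺ (edge H j) x∈ })
        with w≢ ∷ _ ← unique-resp-↭ p (members-unique (edge H j))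
        = zs ++ w ∷ vs , step {xs = x ∷ zs} L (trans (↭-sym (∷↭∷ʳ w (x ∷ zs))) (↭-sym p))
            (λ {u} u∈ cu → All.lookup w≢ u∈ (≡.sym (only (∈-members⁻ (edge H j) (∈-resp-↭ (↭-sym p) (there u∈))) cu)))

      climbable : ∀ {s h es} → excess H s ≤ 1 → Grown s (h ∷ es) → PathLike h es × Climbable h es
      climbable {s} ≤1 seed = record { tail-saturated = λ () ; head-joint = inj₁ ≤1 } , Climbable-seed s
      climbable {h = j} ≤1 (grow {h ∷ es} {w = w} g j∉ w∈ cw only)
        with P , climb ← climbable ≤1 g | h∉es ∷ _ ← Grown-unique g
        = PathLike-grow P (λ h∈ → All.lookup h∉es h∈ refl) j∉ w∈ (Any.head w-new cw) w-new ,
          Climbable-grow climb w∈ (Any.head w-new cw) w-new only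
        where
        w-new : ¬ Covered es w
        w-new = attach-new P j∉ w∈

      -- As k ≥ 2, the last hyperedge has a vertex besides its joint; the numbering starts there.
      newVertex : ∀ {s h es} → Grown s (h ∷ es) → ∃[ x ] x ∈ᵉ h × ¬ Covered es x
      newVertex {h = h} seed with x , x∈ ← someVertex h = x , x∈ , λ ()
      newVertex {h = j} (grow {w = w} g j∉ w∈ cw only) with ∈⇒↭∷ (∈-members⁺ (edge H j) w∈)
      ... | [] , p = ⊥-elim (ℕ.<⇒≱ 2≤k (ℕ.≤-reflexive (≡.trans (≡.sym (length-vertices j)) (↭-length p))))
      ... | x ∷ ys , p with (w≢x ∷ _) ∷ _ ← unique-resp-↭ p (members-unique (edge H j)) =
        x , x∈ , λ cx → w≢x (≡.sym (only x∈ cx))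
        where
        x∈ : x ∈ᵉ j
        x∈ = ∈-members⁻ (edge H j) (∈-resp-↭ (↭-sym p) (there (here refl)))

      Ladder-covered : ∀ {es vs v} → Ladder es vs → v ∈ vs → Covered es v
      Ladder-covered (base p) v∈ = here (∈-members⁻ _ (∈-resp-↭ p v∈))
      Ladder-covered (step {xs = xs} L p _) v∈ with ∈-++⁻ xs v∈
      ... | inj₁ v∈xs = here (∈-members⁻ _ (∈-resp-↭ p (∈-++⁺ˡ v∈xs)))
      ... | inj₂ v∈′  = there (Ladder-covered L v∈′)

      Ladder-unique : ∀ {es vs} → Ladder es vs → Unique vs
      Ladder-unique (base p) = unique-resp-↭ (↭-sym p) (members-unique _)
      Ladder-unique (step {xs = xs} L p new) = Unique.++⁺ (prefix xs (unique-resp-↭ (↭-sym p) (members-unique _)))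
        (Ladder-unique L) (λ (v∈xs , v∈′) → new v∈xs (Ladder-covered L v∈′))
        where
        prefix : ∀ xs {ys : List V} → Unique (xs ++ ys) → Unique xs
        prefix []       u        = []
        prefix (x ∷ xs) (x∉ ∷ u) = All.tabulate (λ y∈ → All.lookup x∉ (∈-++⁺ˡ y∈)) ∷ prefix xs u

      block-length : ∀ {j w} xs → xs ++ [ w ] ↭ vertices j → length xs ≡ spacing k
      block-length {j} {w} xs p = ℕ.suc-injective (begin
        suc (length xs)         ≡⟨ ℕ.+-comm (length xs) 1 ⟨
        length xs + 1           ≡⟨ List.length-++ xs ⟨
        length (xs ++ [ w ])    ≡⟨ ↭-length p ⟩
        length (vertices j)     ≡⟨ length-vertices j ⟩
        k                       ≡⟨ spacing≡ ⟨
        suc (spacing k)         ∎)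
        where open ≡-Reasoning

      Ladder-length : ∀ {es vs} → Ladder es vs → length vs ≡ suc (length es * spacing k)
      Ladder-length (base {j} {xs} p) = begin
        length xs            ≡⟨ ↭-length p ⟩
        length (vertices j)  ≡⟨ length-vertices j ⟩
        k                    ≡⟨ spacing≡ ⟨
        suc (spacing k)      ≡⟨ ≡.cong suc (ℕ.+-identityʳ (spacing k)) ⟨
        suc (spacing k + 0)  ∎
        where open ≡-Reasoning
      Ladder-length (step {es = es} {xs} {w} {vs} L p _) = begin
        length (xs ++ w ∷ vs)                    ≡⟨ List.length-++ xs ⟩
        length xs + length (w ∷ vs)              ≡⟨ ≡.cong₂ _+_ (block-length xs p) (Ladder-length L) ⟩
        spacing k + suc (length es * spacing k)  ≡⟨ ℕ.+-suc (spacing k) _ ⟩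
        suc (spacing k + length es * spacing k)  ∎
        where open ≡-Reasoning

      -- Vertices new in block 0 have positions below `spacing k`, and the joint has position
      -- exactly `spacing k`, where block 0 ends and block 1 begins. From there on positions and
      -- hyperedge indices are those of the rest, shifted by one block.
      Ladder-incidence : ∀ {es vs i v j e} → Ladder es vs → At vs i v → At es j e →
        (Between k j i → v ∈ᵉ e) × (v ∈ᵉ e → Between k j i)
      Ladder-incidence L@(base p) ati here =
        (λ _ → ∈-members⁻ _ (∈-resp-↭ p (At⇒∈ ati))) ,
        (λ _ → z≤n , ℕ.≤-pred (ℕ.<-≤-trans (At⇒< ati) (ℕ.≤-reflexive (Ladder-length L))))
      Ladder-incidence (base p) ati (there ())
      Ladder-incidence (step {xs = xs} L p new) ati atj with At-++⁻ xs ati | atj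
      ... | inj₁ q | here =
        (λ _ → ∈-members⁻ _ (∈-resp-↭ p (∈-++⁺ˡ (At⇒∈ q)))) ,
        (λ _ → z≤n , ℕ.≤-trans (ℕ.<⇒≤ (At⇒< q)) (ℕ.≤-trans (ℕ.≤-reflexive (block-length xs p)) (ℕ.m≤m+n _ 0)))
      ... | inj₁ q | there atj′ =
        (λ (sp≤i , _) → ⊥-elim (ℕ.<⇒≱ (At⇒< q)
          (ℕ.≤-trans (ℕ.≤-reflexive (block-length xs p)) (ℕ.≤-trans (ℕ.m≤m+n _ _) sp≤i)))) ,
        (λ v∈ → ⊥-elim (new (At⇒∈ q) (∈⇒Covered (At⇒∈ atj′) v∈)))
      ... | inj₂ (zero , refl , here) | here =
        (λ _ → ∈-members⁻ _ (∈-resp-↭ p (∈-++⁺ʳ xs (here refl)))) ,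
        (λ _ → z≤n , ℕ.+-monoˡ-≤ 0 (ℕ.≤-reflexive (block-length xs p)))
      ... | inj₂ (suc i′ , refl , there q) | here =
        (λ (_ , ≤sp) → ⊥-elim (ℕ.m+1+n≰m (length xs) (ℕ.≤-trans ≤sp
          (ℕ.≤-reflexive (≡.trans (ℕ.+-identityʳ (spacing k)) (≡.sym (block-length xs p))))))) ,
        (λ v∈ → ⊥-elim (outside v∈))
        where
        outside : _ → ⊥
        outside v∈ with ∈-++⁻ xs (∈-resp-↭ (↭-sym p) (∈-members⁺ _ v∈))
        ... | inj₁ v∈xs = new v∈xs (Ladder-covered L (there (At⇒∈ q)))
        ... | inj₂ (here refl) with w∉ ∷ _ ← Ladder-unique L = All.lookup w∉ (At⇒∈ q) refl
      Ladder-incidence {j = suc j} (step {xs = xs} L p new) ati atj | inj₂ (i′ , refl , q) | there atj′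
        with to , from ← Ladder-incidence L q atj′ rewrite block-length xs p =
        (λ (lo , hi) → to (ℕ.+-cancelˡ-≤ (spacing k) _ _ lo , ℕ.+-cancelˡ-≤ (spacing k) _ _ hi)) ,
        (λ v∈ → let lo , hi = from v∈ in ℕ.+-monoʳ-≤ (spacing k) lo , ℕ.+-monoʳ-≤ (spacing k) hi)

      ladder : ∃[ es ] ∃[ vs ] Unique es × length es ≡ size H × Ladder es vs
      ladder with s , ≤1 ← endEdge with growAll s
      ... | h ∷ es , g , len
        with x , x∈ , x-new ← newVertex g
        with vs , L ← proj₂ (climbable ≤1 g) x x∈ x-new
        = h ∷ es , x ∷ vs , Grown-unique g , len , L

      Ladder⇒hyperpath≅ : ∀ {es vs} → Unique es → length es ≡ size H → Ladder es vs → hyperpath k (size H) ≅ H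
      Ladder⇒hyperpath≅ {es} {vs} ues len L = record
        { vertices = listBijection vs (Ladder-unique L) all-vs lenv
        ; edges    = listBijection es ues (complete ues len) (≡.sym len)
        ; incident = λ v j →
            let incidence = Ladder-incidence L (At-bijection vs _ _ lenv v) (At-bijection es _ _ (≡.sym len) j)
            in mk⇔ (λ v∈ → proj₁ incidence (∈-interval⁻ {k} {size H} {j} {v} v∈))
              (λ v∈ → ∈-interval⁺ {k} {size H} {j} {v} (proj₂ incidence v∈))
        }
        where
        lenv : suc (size H * spacing k) ≡ length vs
        lenv = ≡.trans (≡.cong (λ z → suc (z * spacing k)) (≡.sym len)) (≡.sym (Ladder-length L))
        all-vs : ∀ v → v ∈ vs
        all-vs = complete (Ladder-unique L) (≡.trans (≡.sym lenv) (≡.sym order≡spacing))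

      hyperpath≅ : hyperpath k (size H) ≅ H
      hyperpath≅ with es , vs , ues , len , L ← ladder = Ladder⇒hyperpath≅ ues len L

-- Which choices of tensor entries admit a closed walk

module BalancedChoices where

  open import Data.Nat.Base using (_+_; _*_; _≤_; _<_)
  open ListCombinatorics
  open WalkCounting
  open HypertreeGrowth
  open HyperpathRecognition

  open ∑ℕ using (∑; [_]·)

  module Choices (H : Hypergraph) (k : ℕ) where
    open Incidence H

    -- A choice picks, for a row i of the α-tensor, either its diagonal entry
    -- (nothing) or its entries belonging to a hyperedge through i.
    Choice : Set
    Choice = V × Maybe E

    Valid : Choice → Set
    Valid (i , nothing) = ⊤
    Valid (i , just j)  = i ∈ᵉ j

    others : V → E → List V
    others i j = filter (λ v → ¬? (v Fin.≟ i)) (vertices j)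

    arcsOf : Choice → List (Arc (order H))
    arcsOf (i , nothing) = loops (k ∸ 1) i
    arcsOf (i , just j)  = map (i ,_) (others i j)

    arcs : List Choice → List (Arc (order H))
    arcs = concatMap arcsOf

    arcs-↭ : ∀ {ch ch′} → ch ↭ ch′ → arcs ch ↭ arcs ch′
    arcs-↭ = concatMap-↭ arcsOf

    -- The two forms of a nonempty list of fewer than 2k valid choices whose arcs can be arranged
    -- into a closed walk.
    data Shape (ch : List Choice) : Set where
      diagonal : ∀ v → All (_≡ (v , nothing)) ch → Shape ch
      local    : ∀ j r → All (_∈ᵉ j) r →
        ch ↭ map (_, just j) (vertices j) ++ map (_, nothing) r → Shape ch

  module Balance (H : Hypergraph) {k : ℕ} (2≤k : 2 ≤ k) (uniform : Uniform k H)
    (connected : Connected H) (acyclic : ¬ Cycle H) where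
    open Incidence H
    open UniformHypertrees H (ℕ.<⇒≤ 2≤k) uniform connected acyclic
    open Choices H k

    k≡ : suc (k ∸ 1) ≡ k
    k≡ = ℕ.m+[n∸m]≡n (ℕ.<⇒≤ 2≤k)

    ∑-*-const : ∀ {a} {A : Set a} (xs : List A) c → ∑ xs (λ _ → c) ≡ c * length xs
    ∑-*-const xs c = ≡.trans (∑ℕ.∑-cong xs (λ _ → ≡.sym (ℕ.*-identityʳ c)))
      (≡.trans (≡.sym (∑ℕ.∑-*ˡ xs c)) (≡.cong (c *_) (∑-const-1 xs)))

    []·-0 : ∀ {P : Set} (d : Dec P) → [ d ]· 0 ≡ 0
    []·-0 (yes _) = refl
    []·-0 (no _)  = refl

    []·-*[]·-0 : ∀ {P Q : Set} (d : Dec P) (e : Dec Q) → [ d ]· (k * [ e ]· 0) ≡ 0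
    []·-*[]·-0 (yes _) e = ≡.trans (≡.cong (k *_) ([]·-0 e)) (ℕ.*-zeroʳ k)
    []·-*[]·-0 (no _)  e = refl

    -- There is no nonzero circulation on the incidence forest: hyperedges are
    -- peeled off starting from the one grown last, all but one of whose vertices
    -- are private.
    peel : ∀ (x : E → V → ℕ) {s es} → Grown s es →
      (∀ v → ∑ es (λ j → [ v ∈ᵉ? j ]· (k * x j v)) ≡ ∑ es (λ j → [ v ∈ᵉ? j ]· (∑ (vertices j) (x j)))) →
      ∀ {j v} → j ∈ es → v ∈ᵉ j → k * x j v ≡ ∑ (vertices j) (x j)
    peel x {s} seed eq {v = v} (here refl) v∈ = begin
      k * x s v                                   ≡⟨ ∑ℕ.[]·-yes (v ∈ᵉ? s) v∈ ⟨
      [ v ∈ᵉ? s ]· (k * x s v)                    ≡⟨ ℕ.+-identityʳ _ ⟨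
      [ v ∈ᵉ? s ]· (k * x s v) + 0                ≡⟨ eq v ⟩
      [ v ∈ᵉ? s ]· (∑ (vertices s) (x s)) + 0     ≡⟨ ℕ.+-identityʳ _ ⟩
      [ v ∈ᵉ? s ]· (∑ (vertices s) (x s))         ≡⟨ ∑ℕ.[]·-yes (v ∈ᵉ? s) v∈ ⟩
      ∑ (vertices s) (x s)                        ∎
      where open ≡-Reasoning
    peel x (grow {es} {j} {w} g j∉ w∈ cw only) eq = result
      where
      open ≡-Reasoning
      C = ∑ (vertices j) (x j)
      off : ∀ (f : E → V → ℕ) v → ¬ Covered es v → ∑ es (λ i → [ v ∈ᵉ? i ]· (f i v)) ≡ 0
      off f v v∉ = ∑ℕ.∑-0 es (λ {i} i∈ → ∑ℕ.[]·-no (v ∈ᵉ? i) (λ v∈ → v∉ (∈⇒Covered i∈ v∈)))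
      private-vertex : ∀ {u} → u ∈ᵉ j → u ≢ w → k * x j u ≡ C
      private-vertex {u} u∈ u≢w = begin
        k * x j u                           ≡⟨ ∑ℕ.[]·-yes (u ∈ᵉ? j) u∈ ⟨
        [ u ∈ᵉ? j ]· (k * x j u)            ≡⟨ ℕ.+-identityʳ _ ⟨
        [ u ∈ᵉ? j ]· (k * x j u) + 0        ≡⟨ ≡.cong ([ u ∈ᵉ? j ]· (k * x j u) +_) (off (λ i v → k * x i v) u (λ cu → u≢w (only u∈ cu))) ⟨
        [ u ∈ᵉ? j ]· (k * x j u) + ∑ es (λ i → [ u ∈ᵉ? i ]· (k * x i u))  ≡⟨ eq u ⟩
        [ u ∈ᵉ? j ]· C + ∑ es (λ i → [ u ∈ᵉ? i ]· (∑ (vertices i) (x i))) ≡⟨ ≡.cong ([ u ∈ᵉ? j ]· C +_) (off (λ i _ → ∑ (vertices i) (x i)) u (λ cu → u≢w (only u∈ cu))) ⟩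
        [ u ∈ᵉ? j ]· C + 0                  ≡⟨ ℕ.+-identityʳ _ ⟩
        [ u ∈ᵉ? j ]· C                      ≡⟨ ∑ℕ.[]·-yes (u ∈ᵉ? j) u∈ ⟩
        C                                   ∎
      split : ∃[ ys ] vertices j ↭ w ∷ ys
      split = ∈⇒↭∷ (∈-members⁺ (edge H j) w∈)
      ys = proj₁ split
      p = proj₂ split
      |ys| : k ≡ suc (length ys)
      |ys| = ≡.trans (≡.sym (length-vertices j)) (↭-length p)
      -- The private vertices decide the joint: the k numbers k x_j(u) add up to k C, and all of
      -- them except possibly the one at w equal C.
      joint : k * x j w ≡ C
      joint = ℕ.+-cancelʳ-≡ (C * length ys) _ _ (begin
        k * x j w + C * length ys                ≡⟨ ≡.cong (k * x j w +_) (∑-*-const ys C) ⟨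
        k * x j w + ∑ ys (λ _ → C)               ≡⟨ ≡.cong (k * x j w +_) (∑ℕ.∑-cong∈ ys (λ u∈ys → ≡.sym (rest u∈ys))) ⟩
        k * x j w + ∑ ys (λ u → k * x j u)       ≡⟨ ∑ℕ.∑-*ˡ (w ∷ ys) k ⟨
        k * ∑ (w ∷ ys) (x j)                     ≡⟨ ≡.cong (k *_) (∑ℕ.∑-↭ p) ⟨
        k * C                                    ≡⟨ ≡.cong (_* C) |ys| ⟩
        C + length ys * C                        ≡⟨ ≡.cong (C +_) (ℕ.*-comm (length ys) C) ⟩
        C + C * length ys                        ∎)
        where
        rest : ∀ {u} → u ∈ ys → k * x j u ≡ C
        rest u∈ys with w≢ ∷ _ ← unique-resp-↭ p (members-unique (edge H j)) =
          private-vertex (∈-members⁻ _ (∈-resp-↭ (↭-sym p) (there u∈ys))) (λ u≡w → All.lookup w≢ u∈ys (≡.sym u≡w))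
      here-eq : ∀ {v} → v ∈ᵉ j → k * x j v ≡ C
      here-eq {v} v∈ with v Fin.≟ w
      ... | yes refl = joint
      ... | no v≢w   = private-vertex v∈ v≢w
      result : ∀ {i v} → i ∈ j ∷ es → v ∈ᵉ i → k * x i v ≡ ∑ (vertices i) (x i)
      result (here refl) v∈ = here-eq v∈
      -- The contributions of j to both sides agree and cancel, so the remaining hyperedges satisfy
      -- the same equations.
      result (there i∈)  v∈ = peel x g (λ v → ℕ.+-cancelˡ-≡ ([ v ∈ᵉ? j ]· (k * x j v)) _ _
        (≡.trans (eq v) (≡.cong (_+ ∑ es (λ i → [ v ∈ᵉ? i ]· (∑ (vertices i) (x i)))) (∑ℕ.[]·-cong (v ∈ᵉ? j) (λ v∈ → ≡.sym (here-eq v∈)))))) i∈ v∈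

    others-unique : ∀ i j → Unique (others i j)
    others-unique i j = Unique.filter⁺ (λ v → ¬? (v Fin.≟ i)) (members-unique (edge H j))

    vertices↭ : ∀ {i j} → i ∈ᵉ j → vertices j ↭ i ∷ others i j
    vertices↭ {i} {j} i∈ = unique-⊆-length⇒↭ unique sub
      (unique-⊆⇒length≤ (members-unique (edge H j)) sup)
      where
      unique : Unique (i ∷ others i j)
      unique = All.tabulate (λ u∈ i≡u → proj₂ (∈-filter⁻ (λ v → ¬? (v Fin.≟ i)) {xs = vertices j} u∈) (≡.sym i≡u)) ∷ others-unique i j
      sub : ∀ {x} → x ∈ i ∷ others i j → x ∈ vertices j
      sub (here refl) = ∈-members⁺ (edge H j) i∈
      sub (there x∈)  = proj₁ (∈-filter⁻ (λ v → ¬? (v Fin.≟ i)) x∈)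
      sup : ∀ {x} → x ∈ vertices j → x ∈ i ∷ others i j
      sup {x} x∈ with x Fin.≟ i
      ... | yes refl = here refl
      ... | no x≢i   = there (∈-filter⁺ (λ v → ¬? (v Fin.≟ i)) x∈ x≢i)

    length-others : ∀ {i j} → i ∈ᵉ j → length (others i j) ≡ k ∸ 1
    length-others {j = j} i∈ = ℕ.suc-injective (≡.trans (≡.sym (↭-length (vertices↭ i∈))) (≡.trans (length-vertices j) (≡.sym k≡)))

    -- As k ≥ 2, no choice is without arcs. Thus a closed walk through all arcs visits the row of
    -- every choice.
    first-arc : ∀ c → Valid c → ∃[ t ] (proj₁ c , t) ∈ arcsOf c
    first-arc (i , nothing) _ = i , go (k ∸ 1) (ℕ.m<n⇒0<n∸m 2≤k)
      where
      go : ∀ q → 0 < q → (i , i) ∈ loops q i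
      go (suc q) _ = here refl
    first-arc (i , just l) i∈ = go (others i l) (ℕ.<-≤-trans (ℕ.m<n⇒0<n∸m 2≤k) (ℕ.≤-reflexive (≡.sym (length-others i∈))))
      where
      go : ∀ ts → 0 < length ts → ∃[ t ] (i , t) ∈ map (i ,_) ts
      go (t ∷ _) _ = t , here refl

    hits : E → Maybe E → ℕ
    hits j nothing   = 0
    hits j (just j′) = [ j′ Fin.≟ j ]· 1

    module _ {s es} (g : Grown s es) (full : length es ≡ size H) where

      es∋ : ∀ j → j ∈ es
      es∋ = Grown⇒all∈ g full

      ∑-hits : ∀ j′ (f : E → ℕ → ℕ) → (∀ j → f j 0 ≡ 0) → ∑ es (λ j → f j (hits j (just j′))) ≡ f j′ 1
      ∑-hits j′ f f0 = ≡.trans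
        (∑ℕ.∑-single (Grown-unique g) (es∋ j′) (λ {j} _ j≢j′ →
          ≡.trans (≡.cong (f j) (∑ℕ.[]·-no (j′ Fin.≟ j) (λ j′≡j → j≢j′ (≡.sym j′≡j)))) (f0 j)))
        (≡.cong (f j′) (∑ℕ.[]·-yes (j′ Fin.≟ j′) refl))

      -- The entries of arcsOf (i , just j) at v differ from those needed for
      -- balance by k at v = i and by one at each vertex of j.
      balance₁ : ∀ c → Valid c → ∀ v →
        outdegree v (arcsOf c) + ∑ es (λ j → [ v ∈ᵉ? j ]· (hits j (proj₂ c))) ≡
        indegree v (arcsOf c) + ∑ es (λ j → [ v ∈ᵉ? j ]· (k * [ proj₁ c Fin.≟ v ]· (hits j (proj₂ c))))
      balance₁ (i , nothing) _ v = ≡.cong₂ _+_ (∑ℕ.∑-cong∈ (loops (k ∸ 1) i) (λ a∈ → same a∈))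
        (≡.trans (∑ℕ.∑-0 es (λ {j} _ → []·-0 (v ∈ᵉ? j))) (≡.sym (∑ℕ.∑-0 es (λ {j} _ → []·-*[]·-0 (v ∈ᵉ? j) (i Fin.≟ v)))))
        where
        same : ∀ {n q} {i : Fin n} {v a} → a ∈ loops q i → [ proj₁ a Fin.≟ v ]· 1 ≡ [ proj₂ a Fin.≟ v ]· 1
        same {q = suc q} (here refl) = refl
        same {q = suc q} (there a∈)  = same {q = q} a∈
      balance₁ (i , just j) i∈ v = begin
        outdegree v A + ∑ es (λ j′ → [ v ∈ᵉ? j′ ]· (hits j′ (just j)))
          ≡⟨ ≡.cong₂ _+_ out (∑-hits j (λ j′ → [ v ∈ᵉ? j′ ]·) (λ j′ → []·-0 (v ∈ᵉ? j′))) ⟩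
        [ i Fin.≟ v ]· 1 * (k ∸ 1) + [ v ∈ᵉ? j ]· 1
          ≡⟨ compare (i Fin.≟ v) ⟩
        indegree v A + [ v ∈ᵉ? j ]· (k * [ i Fin.≟ v ]· 1)
          ≡⟨ ≡.cong (indegree v A +_) (∑-hits j (λ j′ h → [ v ∈ᵉ? j′ ]· (k * [ i Fin.≟ v ]· h)) (λ j′ → []·-*[]·-0 (v ∈ᵉ? j′) (i Fin.≟ v))) ⟨
        indegree v A + ∑ es (λ j′ → [ v ∈ᵉ? j′ ]· (k * [ i Fin.≟ v ]· (hits j′ (just j)))) ∎
        where
        open ≡-Reasoning
        A = map (i ,_) (others i j)
        out : outdegree v A ≡ [ i Fin.≟ v ]· 1 * (k ∸ 1)
        out = begin
          outdegree v A                                ≡⟨ ∑ℕ.∑-map (i ,_) (others i j) ⟩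
          ∑ (others i j) (λ _ → [ i Fin.≟ v ]· 1)      ≡⟨ ∑-*-const (others i j) _ ⟩
          [ i Fin.≟ v ]· 1 * length (others i j)       ≡⟨ ≡.cong ([ i Fin.≟ v ]· 1 *_) (length-others i∈) ⟩
          [ i Fin.≟ v ]· 1 * (k ∸ 1)                   ∎
        in₀ : ∀ {u} → u ∉ others i j → indegree u A ≡ 0
        in₀ {u} u∉ = ≡.trans (∑ℕ.∑-map (i ,_) (others i j))
          (∑ℕ.∑-0 (others i j) (λ {t} t∈ → ∑ℕ.[]·-no (t Fin.≟ u) (λ { refl → u∉ t∈ })))
        in₁ : ∀ {u} → u ∈ others i j → indegree u A ≡ 1
        in₁ {u} u∈ = ≡.trans (∑ℕ.∑-map (i ,_) (others i j))
          (≡.trans (∑ℕ.∑-single (others-unique i j) u∈ (λ {t} _ t≢u → ∑ℕ.[]·-no (t Fin.≟ u) t≢u)) (∑ℕ.[]·-yes (u Fin.≟ u) refl))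
        compare : (d : Dec (i ≡ v)) → [ d ]· 1 * (k ∸ 1) + [ v ∈ᵉ? j ]· 1 ≡ indegree v A + [ v ∈ᵉ? j ]· (k * [ d ]· 1)
        compare (yes refl) = begin
          1 * (k ∸ 1) + [ i ∈ᵉ? j ]· 1             ≡⟨ ≡.cong₂ _+_ (ℕ.*-identityˡ (k ∸ 1)) (∑ℕ.[]·-yes (i ∈ᵉ? j) i∈) ⟩
          k ∸ 1 + 1                                ≡⟨ ℕ.+-comm (k ∸ 1) 1 ⟩
          suc (k ∸ 1)                              ≡⟨ k≡ ⟩
          k                                        ≡⟨ ℕ.*-identityʳ k ⟨
          0 + k * 1                                ≡⟨ ≡.cong₂ _+_ (in₀ (λ i∈o → proj₂ (∈-filter⁻ (λ v → ¬? (v Fin.≟ i)) {xs = vertices j} i∈o) refl)) (∑ℕ.[]·-yes (i ∈ᵉ? j) i∈) ⟨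
          indegree i A + [ i ∈ᵉ? j ]· (k * 1)      ∎
        compare (no i≢v) with v ∈ᵉ? j
        ... | yes v∈ = ≡.sym (≡.cong₂ _+_ (in₁ (∈-filter⁺ (λ v → ¬? (v Fin.≟ i)) (∈-members⁺ (edge H j) v∈) (λ v≡i → i≢v (≡.sym v≡i)))) (ℕ.*-zeroʳ k))
        ... | no v∉  = ≡.sym (≡.cong (_+ 0) (in₀ (λ v∈o → v∉ (∈-members⁻ (edge H j) (proj₁ (∈-filter⁻ (λ v → ¬? (v Fin.≟ i)) v∈o))))))

      module _ {ch : List Choice} (valid : All Valid ch) where

        count : E → V → ℕ
        count j v = ∑ ch (λ (i , o) → [ i Fin.≟ v ]· (hits j o))

        total : E → ℕ
        total j = ∑ ch (λ (i , o) → hits j o)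

        ∑-count : ∀ j → ∑ (vertices j) (count j) ≡ total j
        ∑-count j = ≡.trans (∑ℕ.∑-swap (vertices j) ch) (∑ℕ.∑-cong∈ ch (λ {c} c∈ → one c (All.lookup valid c∈)))
          where
          one : ∀ c → Valid c → ∑ (vertices j) (λ v → [ proj₁ c Fin.≟ v ]· (hits j (proj₂ c))) ≡ hits j (proj₂ c)
          one (i , nothing) _ = ∑ℕ.∑-0 (vertices j) (λ {v} _ → []·-0 (i Fin.≟ v))
          one (i , just j′) i∈ with j′ Fin.≟ j
          ... | no _ = ∑ℕ.∑-0 (vertices j) (λ {v} _ → []·-0 (i Fin.≟ v))
          ... | yes refl = ≡.trans (∑ℕ.∑-single (members-unique (edge H j)) (∈-members⁺ (edge H j) i∈)
            (λ {v} _ v≢i → ∑ℕ.[]·-no (i Fin.≟ v) (λ i≡v → v≢i (≡.sym i≡v)))) (∑ℕ.[]·-yes (i Fin.≟ i) refl)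

        module _ (N : ℕ) (c≢0 : closedWalks N (arcs ch) ≢ 0) where

          -- Summing `balance₁` over the choices and cancelling the out- and indegrees, which agree
          -- along a closed walk, gives the hypothesis of `peel` for x = `count`.
          balance : ∀ v → ∑ es (λ j → [ v ∈ᵉ? j ]· (k * count j v)) ≡ ∑ es (λ j → [ v ∈ᵉ? j ]· (∑ (vertices j) (count j)))
          balance v = begin
            ∑ es (λ j → [ v ∈ᵉ? j ]· (k * count j v))                    ≡⟨ ∑ℕ.∑-cong es (λ j → ≡.trans (≡.cong [ v ∈ᵉ? j ]· (∑ℕ.∑-*ˡ ch k)) (∑ℕ.[]·-∑ (v ∈ᵉ? j) ch)) ⟩
            ∑ es (λ j → ∑ ch (λ c → ink j c))                            ≡⟨ ∑ℕ.∑-swap es ch ⟩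
            ∑ ch (λ c → ∑ es (λ j → ink j c))                            ≡⟨ ℕ.+-cancelˡ-≡ (indegree v (arcs ch)) _ _ summed ⟨
            ∑ ch (λ c → ∑ es (λ j → [ v ∈ᵉ? j ]· (hits j (proj₂ c))))    ≡⟨ ∑ℕ.∑-swap es ch ⟨
            ∑ es (λ j → ∑ ch (λ c → [ v ∈ᵉ? j ]· (hits j (proj₂ c))))    ≡⟨ ∑ℕ.∑-cong es (λ j → ∑ℕ.[]·-∑ (v ∈ᵉ? j) ch) ⟨
            ∑ es (λ j → [ v ∈ᵉ? j ]· (total j))                          ≡⟨ ∑ℕ.∑-cong es (λ j → ≡.cong [ v ∈ᵉ? j ]· (∑-count j)) ⟨
            ∑ es (λ j → [ v ∈ᵉ? j ]· (∑ (vertices j) (count j)))         ∎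
            where
            open ≡-Reasoning
            ink : E → Choice → ℕ
            ink j (i , o) = [ v ∈ᵉ? j ]· (k * [ i Fin.≟ v ]· (hits j o))
            in# out# : Choice → ℕ
            in# c  = indegree v (arcsOf c)
            out# c = outdegree v (arcsOf c)
            hit# : Choice → ℕ
            hit# c = ∑ es (λ j → [ v ∈ᵉ? j ]· (hits j (proj₂ c)))
            summed : indegree v (arcs ch) + ∑ ch hit# ≡ indegree v (arcs ch) + ∑ ch (λ c → ∑ es (λ j → ink j c))
            summed = begin
              indegree v (arcs ch) + ∑ ch hit#    ≡⟨ ≡.cong (_+ ∑ ch hit#) (closedWalks≢0⇒balanced N (arcs ch) c≢0 v) ⟨
              outdegree v (arcs ch) + ∑ ch hit#   ≡⟨ ≡.cong (_+ ∑ ch hit#) (∑ℕ.∑-concatMap arcsOf ch) ⟩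
              ∑ ch out# + ∑ ch hit#               ≡⟨ ∑ℕ.∑-+ ch ⟨
              ∑ ch (λ c → out# c + hit# c)        ≡⟨ ∑ℕ.∑-cong∈ ch (λ {c} c∈ → balance₁ c (All.lookup valid c∈) v) ⟩
              ∑ ch (λ c → in# c + ∑ es (λ j → ink j c))  ≡⟨ ∑ℕ.∑-+ ch ⟩
              ∑ ch in# + ∑ ch (λ c → ∑ es (λ j → ink j c))  ≡⟨ ≡.cong (_+ ∑ ch (λ c → ∑ es (λ j → ink j c))) (∑ℕ.∑-concatMap arcsOf ch) ⟨
              indegree v (arcs ch) + ∑ ch (λ c → ∑ es (λ j → ink j c)) ∎

          equidistributed : ∀ {j v} → v ∈ᵉ j → k * count j v ≡ total j
          equidistributed {j} {v} v∈ = ≡.trans (peel count g balance (es∋ j) v∈) (∑-count j)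

          -- A closed walk is connected: if no chosen arc joins P to its complement, then all rows
          -- lie on the side of the starting vertex. It is used for the vertex set of a hyperedge
          -- and for a single vertex.
          one-sided : ∀ {P : V → Set} → (∀ v → Dec (P v)) →
            (∀ {s t c} → c ∈ ch → (s , t) ∈ arcsOf c → (P s → P t) × (P t → P s)) →
            (∀ {c} → c ∈ ch → P (proj₁ c)) ⊎ (∀ {c} → c ∈ ch → ¬ P (proj₁ c))
          one-sided {P} P? closed = bySide (P? i)
            where
            L = proj₁ (closedWalks≢0⇒IsWalk N (arcs ch) c≢0)
            i = proj₁ (proj₂ (closedWalks≢0⇒IsWalk N (arcs ch) c≢0))
            p : arcs ch ↭ L
            p = proj₁ (proj₂ (proj₂ (closedWalks≢0⇒IsWalk N (arcs ch) c≢0)))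
            walk : IsWalk L i i
            walk = proj₂ (proj₂ (proj₂ (closedWalks≢0⇒IsWalk N (arcs ch) c≢0)))
            allArcs : ∀ {Q : Arc (order H) → Set} → (∀ {a c} → c ∈ ch → a ∈ arcsOf c → Q a) → All Q L
            allArcs {Q} f = All-resp-↭ p (All.tabulate (λ {a} a∈ →
              let c , c∈ , a∈c = find (∈-concatMap⁻ arcsOf {xs = ch} a∈) in f c∈ a∈c))
            sources : ∀ {Q : V → Set} → All (λ (s , t) → Q s) L → ∀ {c} → c ∈ ch → Q (proj₁ c)
            sources all {c} c∈ = All.lookup all (∈-resp-↭ p
              (∈-concatMap⁺ arcsOf (lose c∈ (proj₂ (first-arc c (All.lookup valid c∈))))))
            bySide : Dec (P i) → (∀ {c} → c ∈ ch → P (proj₁ c)) ⊎ (∀ {c} → c ∈ ch → ¬ P (proj₁ c))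
            bySide (yes Pi) = inj₁ (sources (IsWalk-stays walk (allArcs (λ c∈ a∈ → proj₁ (closed c∈ a∈))) Pi))
            bySide (no ¬Pi) = inj₂ (sources (IsWalk-stays walk (allArcs (λ c∈ a∈ ¬Ps Pt → ¬Ps (proj₂ (closed c∈ a∈) Pt))) ¬Pi))

          loop-arc : ∀ {i s t : V} q → (s , t) ∈ loops q i → s ≡ t
          loop-arc {i} (suc q) (here refl) = refl
          loop-arc {i} (suc q) (there a∈)  = loop-arc q a∈

          -- A hyperedge is used equally often at all its vertices, hence a
          -- multiple of k times in total.
          localise : ∀ {i j} → length ch < k + k → (i , just j) ∈ ch → Shape ch
          localise {i} {j} short ij∈ = local j r r⊆j ch↭
            where
            open ≡-Reasoning
            total-pos : ∀ {i j} → (i , just j) ∈ ch → k ≤ total j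
            total-pos {i} {j} ij∈ = ℕ.≤-trans (ℕ.≤-trans (ℕ.≤-reflexive (≡.sym (ℕ.*-identityʳ k)))
              (ℕ.*-monoʳ-≤ k (ℕ.≤-trans (ℕ.≤-reflexive (≡.sym (≡.trans (∑ℕ.[]·-yes (i Fin.≟ i) refl) (∑ℕ.[]·-yes (j Fin.≟ j) refl))))
                (∑ℕ.∑-≥ {f = λ (i′ , o) → [ i′ Fin.≟ i ]· (hits j o)} ij∈))))
              (ℕ.≤-reflexive (equidistributed (All.lookup valid ij∈)))
            hits≤1 : ∀ j o → hits j o ≤ 1
            hits≤1 j nothing = z≤n
            hits≤1 j (just j′) with j′ Fin.≟ j
            ... | yes _ = s≤s z≤n
            ... | no _  = z≤n
            hits-two : ∀ {j j′} o → j ≢ j′ → hits j o + hits j′ o ≤ 1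
            hits-two nothing _ = z≤n
            hits-two {j} {j′} (just l) j≢j′ with l Fin.≟ j | l Fin.≟ j′
            ... | yes refl | yes refl = ⊥-elim (j≢j′ refl)
            ... | yes _    | no _     = s≤s z≤n
            ... | no _     | yes _    = s≤s z≤n
            ... | no _     | no _     = z≤n
            total<2k : ∀ j → total j < k + k
            total<2k j = ℕ.≤-<-trans (ℕ.≤-trans (∑-mono-≤ ch (λ (i , o) → hits≤1 j o)) (ℕ.≤-reflexive (∑-const-1 ch))) short
            -- Two different hyperedges would each account for at least k choices, but there are
            -- fewer than 2k.
            same-edge : ∀ {i′ j′} → (i′ , just j′) ∈ ch → j ≡ j′
            same-edge {i′} {j′} ij′∈ = decidable-stable (j Fin.≟ j′) λ j≢j′ → ℕ.<⇒≱ short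
              (ℕ.≤-trans (ℕ.+-mono-≤ (total-pos ij∈) (total-pos ij′∈))
                (ℕ.≤-trans (ℕ.≤-reflexive (≡.sym (∑ℕ.∑-+ ch)))
                  (ℕ.≤-trans (∑-mono-≤ ch (λ (i , o) → hits-two o j≢j′)) (ℕ.≤-reflexive (∑-const-1 ch)))))
            -- The total use of j is a multiple of k, at least k and below 2k, so every vertex of j
            -- uses it exactly once.
            k*1 : ∀ {x} → k ≤ k * x → k * x < k + k → x ≡ 1
            k*1 {zero}        k≤ _ = ⊥-elim (ℕ.<⇒≱ (ℕ.<⇒≤ 2≤k) (ℕ.≤-trans k≤ (ℕ.≤-reflexive (ℕ.*-zeroʳ k))))
            k*1 {suc zero}    _ _ = refl
            k*1 {suc (suc x)} _ lt = ⊥-elim (ℕ.<⇒≱ lt (ℕ.≤-trans (ℕ.≤-reflexive (double k)) (ℕ.*-monoʳ-≤ k (s≤s (s≤s z≤n)))))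
              where
              double : ∀ k → k + k ≡ k * 2
              double = solve-∀
            count≡1 : ∀ {v} → v ∈ᵉ j → count j v ≡ 1
            count≡1 v∈ = k*1 (ℕ.≤-trans (total-pos ij∈) (ℕ.≤-reflexive (≡.sym (equidistributed v∈))))
              (ℕ.≤-<-trans (ℕ.≤-reflexive (equidistributed v∈)) (total<2k j))
            total≡k : total j ≡ k
            total≡k = ≡.trans (≡.sym (equidistributed i∈))
              (≡.trans (≡.cong (k *_) (count≡1 i∈)) (ℕ.*-identityʳ k))
              where i∈ = All.lookup valid ij∈
            ys : List Choice
            ys = map (_, just j) (vertices j)
            ys⊆ch : ∀ {c} → c ∈ ys → c ∈ ch
            ys⊆ch c∈ with v , v∈ , refl ← ∈-map⁻ _ c∈
              with (i′ , o) , c∈ch , ≢0 ← ∑ℕ.∑-≢0 ch (λ z → ℕ.0≢1+n (≡.trans (≡.sym z) (count≡1 (∈-members⁻ _ v∈))))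
              with refl , h≢0 ← ∑ℕ.[]·-≢0 (i′ Fin.≟ v) ≢0 = hit o h≢0 c∈ch
              where
              hit : ∀ {v} o → hits j o ≢ 0 → (v , o) ∈ ch → (v , just j) ∈ ch
              hit nothing  0≢0 _ = ⊥-elim (0≢0 refl)
              hit (just l) h≢0 c∈ with refl , _ ← ∑ℕ.[]·-≢0 (l Fin.≟ j) h≢0 = c∈
            split : ∃[ rest ] ch ↭ ys ++ rest
            split = unique-⊆⇒↭++ (Unique.map⁺ (λ { refl → refl }) (members-unique (edge H j))) ys⊆ch
            rest = proj₁ split
            hits-ys : ∑ ys (λ (i , o) → hits j o) ≡ k
            hits-ys = begin
              ∑ ys (λ (i , o) → hits j o)                  ≡⟨ ∑ℕ.∑-map (_, just j) (vertices j) ⟩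
              ∑ (vertices j) (λ _ → [ j Fin.≟ j ]· 1)      ≡⟨ ∑ℕ.∑-cong (vertices j) (λ _ → ∑ℕ.[]·-yes (j Fin.≟ j) refl) ⟩
              ∑ (vertices j) (λ _ → 1)                     ≡⟨ ∑-const-1 (vertices j) ⟩
              length (vertices j)                          ≡⟨ length-vertices j ⟩
              k                                            ∎
            hits-rest : ∑ rest (λ (i , o) → hits j o) ≡ 0
            hits-rest = ℕ.+-cancelˡ-≡ k _ _ (begin
              k + ∑ rest (λ (i , o) → hits j o)                                ≡⟨ ≡.cong (_+ ∑ rest (λ (i , o) → hits j o)) hits-ys ⟨
              ∑ ys (λ (i , o) → hits j o) + ∑ rest (λ (i , o) → hits j o)      ≡⟨ ∑ℕ.∑-++ ys rest ⟨
              ∑ (ys ++ rest) (λ (i , o) → hits j o)                            ≡⟨ ∑ℕ.∑-↭ (proj₂ split) ⟨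
              total j                                                          ≡⟨ total≡k ⟩
              k                                                                ≡⟨ ℕ.+-identityʳ k ⟨
              k + 0                                                            ∎)
            diagonal-rest : ∀ {i o} → (i , o) ∈ rest → o ≡ nothing
            diagonal-rest {o = nothing} _ = refl
            diagonal-rest {i} {just l} c∈ with refl ← same-edge (∈-resp-↭ (↭-sym (proj₂ split)) (∈-++⁺ʳ ys c∈)) =
              ⊥-elim (ℕ.<⇒≱ (ℕ.≤-trans (ℕ.≤-reflexive (≡.sym (∑ℕ.[]·-yes (j Fin.≟ j) refl))) (∑ℕ.∑-≥ {f = λ (i , o) → hits j o} c∈))
                (ℕ.≤-reflexive hits-rest))
            r : List V
            r = map proj₁ rest
            rest≡ : rest ≡ map (_, nothing) r
            rest≡ = go rest diagonal-rest
              where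
              go : ∀ (cs : List Choice) → (∀ {i o} → (i , o) ∈ cs → o ≡ nothing) → cs ≡ map (_, nothing) (map proj₁ cs)
              go []             _   = refl
              go ((i , o) ∷ cs) all with refl ← all (here refl) = ≡.cong ((i , nothing) ∷_) (go cs (all ∘ there))
            ch↭ : ch ↭ ys ++ map (_, nothing) r
            ch↭ = ↭-trans (proj₂ split) (↭-reflexive (≡.cong (ys ++_) rest≡))
            -- No other hyperedge is in use, so no arc crosses the boundary of j. Hence the
            -- remaining diagonal entries also sit at vertices of j.
            edge-arc : ∀ {c s t} → c ∈ ch → (s , t) ∈ arcsOf c → (s ∈ᵉ j → t ∈ᵉ j) × (t ∈ᵉ j → s ∈ᵉ j)
            edge-arc {_ , nothing} _ a∈ with refl ← loop-arc (k ∸ 1) a∈ = (λ s∈ → s∈) , (λ s∈ → s∈)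
            edge-arc {u , just l} c∈ a∈ with refl ← same-edge c∈ with t , t∈ , refl ← ∈-map⁻ (u ,_) a∈ =
              (λ _ → ∈-members⁻ _ (proj₁ (∈-filter⁻ (λ v → ¬? (v Fin.≟ u)) t∈))) , (λ _ → All.lookup valid c∈)
            r⊆j : All (_∈ᵉ j) r
            r⊆j with one-sided (_∈ᵉ? j) edge-arc
            ... | inj₂ none = ⊥-elim (none ij∈ (All.lookup valid ij∈))
            ... | inj₁ all  = All.tabulate (λ v∈ →
              let c , c∈ , v≡ = ∈-map⁻ proj₁ v∈
              in ≡.subst (_∈ᵉ j) (≡.sym v≡) (all (∈-resp-↭ (↭-sym (proj₂ split)) (∈-++⁺ʳ ys c∈))))

          shape : 0 < length ch → length ch < k + k → Shape ch
          shape 0< short with Any.any? isJust? ch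
            where
            isJust? : ∀ (c : Choice) → Dec (∃[ j ] proj₂ c ≡ just j)
            isJust? (_ , just j)  = yes (j , refl)
            isJust? (_ , nothing) = no λ ()
          ... | yes some with (_ , just j) , c∈ , (_ , refl) ← find some = localise short c∈
          ... | no none = diagonal v₀ (All.tabulate (λ c∈ → ≡.cong₂ _,_ (sides c∈) (all-nothing c∈)))
            where
            firstOf : ∀ (cs : List Choice) → 0 < length cs → ∃[ c ] c ∈ cs
            firstOf (c ∷ _) _ = c , here refl
            c₀ = firstOf ch 0<
            v₀ = proj₁ (proj₁ c₀)
            all-nothing : ∀ {c} → c ∈ ch → proj₂ c ≡ nothing
            all-nothing {_ , nothing} _  = refl
            all-nothing {_ , just j}  c∈ = ⊥-elim (none (lose c∈ (j , refl)))
            still : ∀ {c s t} → c ∈ ch → (s , t) ∈ arcsOf c → s ≡ t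
            still {_ , nothing} _ a∈ = loop-arc (k ∸ 1) a∈
            still {_ , just j} c∈ _ with () ← all-nothing c∈
            sides : ∀ {c} → c ∈ ch → proj₁ c ≡ v₀
            -- Without hyperedge choices all arcs are loops, so no arc leaves or enters {v₀}.
            sides c∈ with one-sided (Fin._≟ v₀) (λ c∈ a∈ → ≡.subst (λ t → (_ → t ≡ v₀) × (t ≡ v₀ → _)) (still c∈ a∈) ((λ s≡ → s≡) , (λ s≡ → s≡)))
            ... | inj₁ all  = all c∈
            ... | inj₂ none = ⊥-elim (none (proj₂ c₀) refl)

-- Rows of the tensor as sums over incident hyperedges

module TensorContraction where

  open ListCombinatorics
  open WalkCounting
  open TracePairing
  open HypertreeGrowth
  open BalancedChoices

  ∈-⋃⁻ : ∀ {n} (xs : List (Fin n)) {v} → v ∈ₛ ⋃ (map ⁅_⁆ xs) → v ∈ xs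
  ∈-⋃⁻ []       v∈ = ⊥-elim (∉⊥ v∈)
  ∈-⋃⁻ (x ∷ xs) v∈ with x∈p∪q⁻ ⁅ x ⁆ _ v∈
  ... | inj₁ v∈x  = here (x∈⁅y⁆⇒x≡y x v∈x)
  ... | inj₂ v∈xs = there (∈-⋃⁻ xs v∈xs)

  ∈-⋃⁺ : ∀ {n} {xs : List (Fin n)} {v} → v ∈ xs → v ∈ₛ ⋃ (map ⁅_⁆ xs)
  ∈-⋃⁺ {xs = x ∷ _} (here refl) = x∈p∪q⁺ (inj₁ (x∈⁅x⁆ x))
  ∈-⋃⁺ {xs = x ∷ _} (there v∈)  = x∈p∪q⁺ (inj₂ (∈-⋃⁺ v∈))

  -- The number of ways to spell γ with the positions of ℓ. For a duplicate-free ℓ it is the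
  -- indicator of γ being an ordering of ℓ, in a form whose sum over all words can be computed by
  -- induction.
  arrangements : ∀ {n l} → Vec (Fin n) l → List (Fin n) → ℕ
  arrangements []      []      = 1
  arrangements []      (_ ∷ _) = 0
  arrangements (g ∷ γ) ℓ       = ∑ℕ.∑ (select ℓ) (λ (h , ℓ′) → ∑ℕ.[ h Fin.≟ g ]· (arrangements γ ℓ′))

  module _ {n : ℕ} where

    arrangements-↭ : ∀ {l} (γ : Vec (Fin n) l) {ℓ ℓ′} → ℓ ↭ ℓ′ → arrangements γ ℓ ≡ arrangements γ ℓ′
    arrangements-↭ [] {[]}    {[]}    p = refl
    arrangements-↭ [] {[]}    {_ ∷ _} p with () ← ↭-length p
    arrangements-↭ [] {_ ∷ _} {[]}    p with () ← ↭-length p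
    arrangements-↭ [] {_ ∷ _} {_ ∷ _} p = refl
    arrangements-↭ (g ∷ γ) p = ∑ℕ.∑-select-↭ (λ {h} q → ∑ℕ.[]·-cong (h Fin.≟ g) (λ _ → arrangements-↭ γ q)) p

    arrangements≢0⇒↭ : ∀ {l} (γ : Vec (Fin n) l) ℓ → arrangements γ ℓ ≢ 0 → Vec.toList γ ↭ ℓ
    arrangements≢0⇒↭ []      []      _   = _↭_.refl
    arrangements≢0⇒↭ []      (_ ∷ _) 0≢0 = ⊥-elim (0≢0 refl)
    arrangements≢0⇒↭ (g ∷ γ) ℓ ≢0
      with (h , ℓ′) , ∈sel , f≢0 ← ∑ℕ.∑-≢0 (select ℓ) ≢0
      with refl , a≢0 ← ∑ℕ.[]·-≢0 (h Fin.≟ g) f≢0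
      = trans (prep g (arrangements≢0⇒↭ γ ℓ′ a≢0)) (↭-sym (∈-select⇒↭ ℓ ∈sel))

    arrangements-self : ∀ {l} (γ : Vec (Fin n) l) → Unique (Vec.toList γ) → arrangements γ (Vec.toList γ) ≡ 1
    arrangements-self []      u = refl
    arrangements-self (g ∷ γ) (g∉ ∷ u) = ≡.cong₂ ℕ._+_
      (≡.trans (∑ℕ.[]·-yes (g Fin.≟ g) refl) (arrangements-self γ u))
      (≡.trans (∑ℕ.∑-map _ (select (Vec.toList γ))) (∑ℕ.∑-0 (select (Vec.toList γ)) (λ {(h , ℓ′)} ∈sel →
        ∑ℕ.[]·-no (h Fin.≟ g) (λ h≡g → All.lookup g∉
          (∈-resp-↭ (↭-sym (∈-select⇒↭ (Vec.toList γ) ∈sel)) (here refl)) (≡.sym h≡g)))))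

    arrangements-unique : ∀ {l} (γ : Vec (Fin n) l) {ℓ} → Unique ℓ → Vec.toList γ ↭ ℓ → arrangements γ ℓ ≡ 1
    arrangements-unique γ u p =
      ≡.trans (arrangements-↭ γ (↭-sym p)) (arrangements-self γ (unique-resp-↭ (↭-sym p) u))

  assignments : ∀ {A O : Set} → (A → List O) → List A → List (List (A × O))
  assignments opts []       = [ [] ]
  assignments opts (x ∷ xs) = concatMap (λ o → map ((x , o) ∷_) (assignments opts xs)) (opts x)

  module Contraction {c ℓ₁ ℓ₂ : Level} (F : OrderedField c ℓ₁ ℓ₂) (H : Hypergraph) {k : ℕ} (2≤k : 2 ℕ.≤ k)
    (uniform : Uniform k H) (connected : Connected H) (acyclic : ¬ Cycle H) (α : OrderedField.Carrier F) where
    open OrderedFieldProperties F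
    open Spectral F
    open PolynomialPairing F
    open ListSum semiring
    open Incidence H
    open UniformHypertrees H (ℕ.<⇒≤ 2≤k) uniform connected acyclic
    open Choices H k
    open Balance H 2≤k uniform connected acyclic using (vertices↭; length-others; others-unique; k≡)
    open import Relation.Binary.Reasoning.Setoid (CommutativeRing.setoid commutativeRing)
    open import Algebra.Properties.CommutativeSemigroup (CommutativeSemiring.*-commutativeSemigroup semiring)
      using (x∙yz≈y∙xz)

    n = order H
    Vs = allFin n
    Es = allFin (size H)

    ∑-words-diagonal : ∀ l i {f : Vec V l → Carrier} → (∀ γ → ¬ VecAll.All (_≡ i) γ → f γ ≈ 0#) →
      ∑ (words n l) f ≈ f (Vec.replicate l i)
    ∑-words-diagonal zero    i {f} vanish = +-identityʳ _
    ∑-words-diagonal (suc l) i {f} vanish = begin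
      ∑ (words n (suc l)) f                              ≈⟨ ∑-cartesianProductWith _∷_ Vs (words n l) ⟩
      ∑ Vs (λ g → ∑ (words n l) (λ γ → f (g ∷ γ)))       ≈⟨ ∑-single (Unique.allFin⁺ n) (∈-allFin i) (λ _ g≢i →
                                                              ∑-0 (words n l) (λ _ → vanish _ (λ { (g≡i ∷ _) → g≢i g≡i }))) ⟩
      ∑ (words n l) (λ γ → f (i ∷ γ))                    ≈⟨ ∑-words-diagonal l i (λ γ ¬all → vanish _ (λ { (_ ∷ all) → ¬all all })) ⟩
      f (i ∷ Vec.replicate l i)                          ∎

    -- Each of the draws of a first letter leaves the same sum for the remaining letters, because f
    -- ignores order; their number supplies the next factor of the factorial.
    ∑-arrangements : ∀ l (f : List V → Carrier) → (∀ {ℓ ℓ′} → ℓ ↭ ℓ′ → f ℓ ≈ f ℓ′) → ∀ ℓ → length ℓ ≡ l →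
      ∑ (words n l) (λ γ → fromℕ (arrangements γ ℓ) * f (Vec.toList γ)) ≈ fromℕ (l !) * f ℓ
    ∑-arrangements zero    f resp []       _   = +-identityʳ _
    ∑-arrangements (suc l) f resp ℓ len = begin
      ∑ (words n (suc l)) (λ γ → fromℕ (arrangements γ ℓ) * f (Vec.toList γ))
        ≈⟨ ∑-cartesianProductWith _∷_ Vs (words n l) ⟩
      ∑ Vs (λ g → ∑ (words n l) (λ γ → fromℕ (∑ℕ.∑ sel (λ (h , ℓ′) → ∑ℕ.[ h Fin.≟ g ]· (arrangements γ ℓ′))) * f (g ∷ Vec.toList γ)))
        ≈⟨ ∑-cong Vs (λ g → ∑-cong (words n l) (λ γ → distribute g γ)) ⟩
      ∑ Vs (λ g → ∑ (words n l) (λ γ → ∑ sel (λ (h , ℓ′) → [ h Fin.≟ g ]· (fromℕ (arrangements γ ℓ′) * f (h ∷ Vec.toList γ)))))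
        ≈⟨ ∑-cong Vs (λ g → ∑-swap (words n l) sel) ⟩
      ∑ Vs (λ g → ∑ sel (λ (h , ℓ′) → ∑ (words n l) (λ γ → [ h Fin.≟ g ]· (fromℕ (arrangements γ ℓ′) * f (h ∷ Vec.toList γ)))))
        ≈⟨ ∑-swap Vs sel ⟩
      ∑ sel (λ (h , ℓ′) → ∑ Vs (λ g → ∑ (words n l) (λ γ → [ h Fin.≟ g ]· (fromℕ (arrangements γ ℓ′) * f (h ∷ Vec.toList γ)))))
        ≈⟨ ∑-cong∈ sel (λ {(h , ℓ′)} ∈sel → one h ℓ′ ∈sel) ⟩
      ∑ sel (λ _ → fromℕ (l !) * f ℓ)
        ≈⟨ ∑-constant sel (fromℕ (l !) * f ℓ) ⟩
      fromℕ (length sel) * (fromℕ (l !) * f ℓ)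
        ≈⟨ *-assoc _ _ _ ⟨
      fromℕ (length sel) * fromℕ (l !) * f ℓ
        ≈⟨ *-congʳ (≈-trans (≈-sym (fromℕ-* (length sel) (l !))) (fromℕ-≡ (≡.cong (ℕ._* l !) (≡.trans (length-select ℓ) len)))) ⟩
      fromℕ (suc l !) * f ℓ ∎
      where
      sel = select ℓ
      length-select : ∀ {A : Set} (xs : List A) → length (select xs) ≡ length xs
      length-select []       = refl
      length-select (x ∷ xs) = ≡.cong suc (≡.trans (List.length-map _ (select xs)) (length-select xs))
      ∑-constant : ∀ {A : Set} (xs : List A) y → ∑ xs (λ _ → y) ≈ fromℕ (length xs) * y
      ∑-constant []       y = ≈-sym (zeroˡ y)
      ∑-constant (x ∷ xs) y = ≈-sym (≈-trans (distribʳ y 1# _) (+-cong (*-identityˡ y) (≈-sym (∑-constant xs y))))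
      distribute : ∀ g (γ : Vec V l) →
        fromℕ (∑ℕ.∑ sel (λ (h , ℓ′) → ∑ℕ.[ h Fin.≟ g ]· (arrangements γ ℓ′))) * f (g ∷ Vec.toList γ) ≈
        ∑ sel (λ (h , ℓ′) → [ h Fin.≟ g ]· (fromℕ (arrangements γ ℓ′) * f (h ∷ Vec.toList γ)))
      distribute g γ = begin
        fromℕ (∑ℕ.∑ sel (λ (h , ℓ′) → ∑ℕ.[ h Fin.≟ g ]· (arrangements γ ℓ′))) * f (g ∷ Vec.toList γ)
          ≈⟨ ≈-trans (*-congʳ (fromℕ-∑ sel)) (*-comm _ _) ⟩
        f (g ∷ Vec.toList γ) * ∑ sel (λ (h , ℓ′) → fromℕ (∑ℕ.[ h Fin.≟ g ]· (arrangements γ ℓ′)))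
          ≈⟨ ∑-*ˡ sel _ ⟩
        ∑ sel (λ (h , ℓ′) → f (g ∷ Vec.toList γ) * fromℕ (∑ℕ.[ h Fin.≟ g ]· (arrangements γ ℓ′)))
          ≈⟨ ∑-cong sel (λ (h , ℓ′) → ≈-trans (*-congˡ (fromℕ-[] (h Fin.≟ g) _)) (≈-trans ([]·-*ˡ (h Fin.≟ g) _ _)
               ([]·-cong (h Fin.≟ g) (λ { refl → *-comm _ _ })))) ⟩
        ∑ sel (λ (h , ℓ′) → [ h Fin.≟ g ]· (fromℕ (arrangements γ ℓ′) * f (h ∷ Vec.toList γ))) ∎
      one : ∀ h ℓ′ → (h , ℓ′) ∈ sel →
        ∑ Vs (λ g → ∑ (words n l) (λ γ → [ h Fin.≟ g ]· (fromℕ (arrangements γ ℓ′) * f (h ∷ Vec.toList γ)))) ≈ fromℕ (l !) * f ℓ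
      one h ℓ′ ∈sel = begin
        ∑ Vs (λ g → ∑ (words n l) (λ γ → [ h Fin.≟ g ]· (fromℕ (arrangements γ ℓ′) * f (h ∷ Vec.toList γ))))
          ≈⟨ ∑-single (Unique.allFin⁺ n) (∈-allFin h) (λ {g} _ g≢h → ∑-0 (words n l) (λ _ → []·-no (h Fin.≟ g) (λ h≡g → g≢h (≡.sym h≡g)))) ⟩
        ∑ (words n l) (λ γ → [ h Fin.≟ h ]· (fromℕ (arrangements γ ℓ′) * f (h ∷ Vec.toList γ)))
          ≈⟨ ∑-cong (words n l) (λ γ → []·-yes (h Fin.≟ h) refl) ⟩
        ∑ (words n l) (λ γ → fromℕ (arrangements γ ℓ′) * f (h ∷ Vec.toList γ))
          ≈⟨ ∑-arrangements l (λ xs → f (h ∷ xs)) (λ p → resp (prep h p)) ℓ′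
               (ℕ.suc-injective (≡.trans (≡.sym (↭-length (∈-select⇒↭ ℓ ∈sel))) len)) ⟩
        fromℕ (l !) * f (h ∷ ℓ′)
          ≈⟨ *-congˡ (resp (↭-sym (∈-select⇒↭ ℓ ∈sel))) ⟩
        fromℕ (l !) * f ℓ ∎

    support : V → Vec V (k ∸ 1) → Subset n
    support i γ = ⋃ (map ⁅_⁆ (i ∷ Vec.toList γ))

    -- k entries that exhaust a set of k elements cannot repeat, so the word γ orders the other
    -- vertices of j.
    support≡⇒ : ∀ {i γ j} → edge H j ≡ support i γ → i ∈ᵉ j × Vec.toList γ ↭ others i j
    support≡⇒ {i} {γ} {j} eq = i∈ , drop-∷ (trans listed (vertices↭ i∈))
      where
      i∈ : i ∈ᵉ j
      i∈ = ≡.subst (i ∈ₛ_) (≡.sym eq) (∈-⋃⁺ {xs = i ∷ Vec.toList γ} (here refl))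
      listed : i ∷ Vec.toList γ ↭ vertices j
      listed = unique-⊆-length⇒↭ (members-unique (edge H j))
        (λ v∈ → ∈-⋃⁻ (i ∷ Vec.toList γ) (≡.subst (_ ∈ₛ_) eq (∈-members⁻ (edge H j) v∈)))
        (ℕ.≤-reflexive (≡.trans (≡.cong suc (Vec.length-toList γ)) (≡.trans k≡ (≡.sym (length-vertices j)))))

    support≡⇐ : ∀ {i γ j} → i ∈ᵉ j → Vec.toList γ ↭ others i j → edge H j ≡ support i γ
    support≡⇐ {i} {γ} {j} i∈ p = ⊆-antisym
      (λ v∈ → ∈-⋃⁺ (∈-resp-↭ listed (∈-members⁺ _ v∈)))
      (λ v∈ → ∈-members⁻ _ (∈-resp-↭ (↭-sym listed) (∈-⋃⁻ (i ∷ Vec.toList γ) v∈)))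
      where
      listed : vertices j ↭ i ∷ Vec.toList γ
      listed = trans (vertices↭ i∈) (prep i (↭-sym p))

    infix 4 _≟ₛ_
    _≟ₛ_ : ∀ (S S′ : Subset n) → Dec (S ≡ S′)
    _≟ₛ_ = Vec.≡-dec Bool._≟_

    -- By `edge-distinct` at most one summand is nonzero. Written as a sum, the test for being a
    -- hyperedge can be exchanged with the sum over words.
    adjacency-∑ : ∀ i γ → adjacencyTensor k H i γ ≈ ∑ Es (λ j → [ edge H j ≟ₛ support i γ ]· (1/ (k ∸ 1) !))
    adjacency-∑ i γ = go (isEdge? H (support i γ))
      where
      ρ = 1/ (k ∸ 1) !
      go : (d : Dec (IsEdge H (support i γ))) → (if does d then ρ else 0#) ≈ ∑ Es (λ j → [ edge H j ≟ₛ support i γ ]· ρ)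
      go (no none)      = ≈-sym (∑-0 Es (λ {j} _ → []·-no (edge H j ≟ₛ support i γ) (λ eq → none (j , eq))))
      go (yes (j , eq)) = ≈-sym (≈-trans
        (∑-single (Unique.allFin⁺ (size H)) (∈-allFin j) (λ {j′} _ j′≢j →
          []·-no (edge H j′ ≟ₛ support i γ) (λ eq′ → j′≢j (edge-distinct H (≡.trans eq′ (≡.sym eq))))))
        ([]·-yes (edge H j ≟ₛ support i γ) eq))

    -- A row of the adjacency tensor: each hyperedge through i is met by (k-1)!
    -- words, which cancels the factor 1/(k-1)!.
    ∑-adjacency : ∀ i (f : List V → Carrier) → (∀ {ℓ ℓ′} → ℓ ↭ ℓ′ → f ℓ ≈ f ℓ′) →
      ∑ (words n (k ∸ 1)) (λ γ → adjacencyTensor k H i γ * f (Vec.toList γ)) ≈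
      ∑ Es (λ j → [ i ∈ᵉ? j ]· (f (others i j)))
    ∑-adjacency i f resp = begin
      ∑ ws (λ γ → adjacencyTensor k H i γ * f (Vec.toList γ))
        ≈⟨ ∑-cong ws (λ γ → ≈-trans (*-congʳ (adjacency-∑ i γ)) (≈-trans (*-comm _ _)
             (≈-trans (∑-*ˡ Es _) (∑-cong Es (λ j → ≈-trans ([]·-*ˡ (edge H j ≟ₛ support i γ) _ ρ)
               ([]·-cong (edge H j ≟ₛ support i γ) (λ _ → *-comm _ ρ))))))) ⟩
      ∑ ws (λ γ → ∑ Es (λ j → [ edge H j ≟ₛ support i γ ]· (ρ * f (Vec.toList γ))))
        ≈⟨ ∑-swap ws Es ⟩
      ∑ Es (λ j → ∑ ws (λ γ → [ edge H j ≟ₛ support i γ ]· (ρ * f (Vec.toList γ))))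
        ≈⟨ ∑-cong Es (λ j → perEdge j (i ∈ᵉ? j)) ⟩
      ∑ Es (λ j → [ i ∈ᵉ? j ]· (f (others i j))) ∎
      where
      ws = words n (k ∸ 1)
      ρ = 1/ (k ∸ 1) !
      indicator : ∀ j γ → i ∈ᵉ j → [ edge H j ≟ₛ support i γ ]· (ρ * f (Vec.toList γ)) ≈
        ρ * (fromℕ (arrangements γ (others i j)) * f (Vec.toList γ))
      indicator j γ i∈ with edge H j ≟ₛ support i γ
      ... | yes eq = *-congˡ (≈-sym (≈-trans (*-congʳ (≈-trans
        (fromℕ-≡ (arrangements-unique γ (others-unique i j) (proj₂ (support≡⇒ {γ = γ} eq)))) fromℕ-1)) (*-identityˡ _)))
      ... | no ≢ with arrangements γ (others i j) ℕ.≟ 0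
      ...   | yes z = ≈-sym (≈-trans (*-congˡ (≈-trans (*-congʳ (fromℕ-≡ z)) (zeroˡ _))) (zeroʳ ρ))
      ...   | no nz = ⊥-elim (≢ (support≡⇐ {γ = γ} i∈ (arrangements≢0⇒↭ γ (others i j) nz)))
      perEdge : ∀ j (d : Dec (i ∈ᵉ j)) → ∑ ws (λ γ → [ edge H j ≟ₛ support i γ ]· (ρ * f (Vec.toList γ))) ≈ [ d ]· (f (others i j))
      perEdge j (no i∉)  = ∑-0 ws (λ {γ} _ → []·-no (edge H j ≟ₛ support i γ) (λ eq → i∉ (proj₁ (support≡⇒ {γ = γ} eq))))
      perEdge j (yes i∈) = begin
        ∑ ws (λ γ → [ edge H j ≟ₛ support i γ ]· (ρ * f (Vec.toList γ)))
          ≈⟨ ∑-cong ws (λ γ → indicator j γ i∈) ⟩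
        ∑ ws (λ γ → ρ * (fromℕ (arrangements γ (others i j)) * f (Vec.toList γ)))
          ≈⟨ ∑-*ˡ ws ρ ⟨
        ρ * ∑ ws (λ γ → fromℕ (arrangements γ (others i j)) * f (Vec.toList γ))
          ≈⟨ *-congˡ (∑-arrangements (k ∸ 1) f resp (others i j) (length-others i∈)) ⟩
        ρ * (fromℕ ((k ∸ 1) !) * f (others i j))
          ≈⟨ *-assoc _ _ _ ⟨
        ρ * fromℕ ((k ∸ 1) !) * f (others i j)
          ≈⟨ *-congʳ (recip-inverse ((k ∸ 1) !) {{(k ∸ 1) ℕ.!≢0}}) ⟩
        1# * f (others i j)
          ≈⟨ *-identityˡ _ ⟩
        f (others i j) ∎

    T : Tensor k n
    T = alphaTensor k α H

    value : Choice → Carrier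
    value (i , nothing) = α * fromℕ (degree H i)
    value (i , just _)  = 1# - α

    incidentEdges : V → List E
    incidentEdges i = filter (i ∈ᵉ?_) Es

    options : V → List (Maybe E)
    options i = nothing ∷ map just (incidentEdges i)

    ∑-row : ∀ i (f : List V → Carrier) → (∀ {ℓ ℓ′} → ℓ ↭ ℓ′ → f ℓ ≈ f ℓ′) →
      ∑ (words n (k ∸ 1)) (λ γ → T i γ * f (Vec.toList γ)) ≈
      value (i , nothing) * f (replicate (k ∸ 1) i) + ∑ (incidentEdges i) (λ j → value (i , just j) * f (others i j))
    ∑-row i f resp = begin
      ∑ ws (λ γ → T i γ * f (Vec.toList γ))
        ≈⟨ ∑-cong ws (λ γ → ≈-trans (distribʳ _ _ _) (+-cong (*-assoc _ _ _) (*-assoc _ _ _))) ⟩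
      ∑ ws (λ γ → α * (degreeTensor k H i γ * f (Vec.toList γ)) + (1# - α) * (adjacencyTensor k H i γ * f (Vec.toList γ)))
        ≈⟨ ∑-+ ws ⟩
      ∑ ws (λ γ → α * (degreeTensor k H i γ * f (Vec.toList γ))) + ∑ ws (λ γ → (1# - α) * (adjacencyTensor k H i γ * f (Vec.toList γ)))
        ≈⟨ +-cong diagonal-part adjacency-part ⟩
      value (i , nothing) * f (replicate (k ∸ 1) i) + ∑ (incidentEdges i) (λ j → (1# - α) * f (others i j)) ∎
      where
      ws = words n (k ∸ 1)
      d = fromℕ (degree H i)
      onDiagonal : ∀ (γ : Vec V (k ∸ 1)) (a : Dec (VecAll.All (_≡ i) γ)) → ¬ VecAll.All (_≡ i) γ → α * ((if does a then d else 0#) * f (Vec.toList γ)) ≈ 0#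
      onDiagonal γ (yes all) ¬all = ⊥-elim (¬all all)
      onDiagonal γ (no _)    ¬all = ≈-trans (*-congˡ (zeroˡ _)) (zeroʳ α)
      atDiagonal : ∀ {γ : Vec V (k ∸ 1)} (a : Dec (VecAll.All (_≡ i) γ)) → VecAll.All (_≡ i) γ → (if does a then d else 0#) ≈ d
      atDiagonal (yes _)   _   = ≈-refl
      atDiagonal (no ¬all) all = ⊥-elim (¬all all)
      all-replicate : ∀ l → VecAll.All (_≡ i) (Vec.replicate l i)
      all-replicate zero    = []
      all-replicate (suc l) = refl ∷ all-replicate l
      toList-replicate : ∀ l → Vec.toList (Vec.replicate l i) ≡ replicate l i
      toList-replicate zero    = refl
      toList-replicate (suc l) = ≡.cong (i ∷_) (toList-replicate l)
      diagonal-part : ∑ ws (λ γ → α * (degreeTensor k H i γ * f (Vec.toList γ))) ≈ value (i , nothing) * f (replicate (k ∸ 1) i)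
      diagonal-part = begin
        ∑ ws (λ γ → α * (degreeTensor k H i γ * f (Vec.toList γ)))
          ≈⟨ ∑-words-diagonal (k ∸ 1) i (λ γ → onDiagonal γ (VecAll.all? (Fin._≟ i) γ)) ⟩
        α * (degreeTensor k H i (Vec.replicate (k ∸ 1) i) * f (Vec.toList (Vec.replicate (k ∸ 1) i)))
          ≈⟨ *-congˡ (*-cong (atDiagonal (VecAll.all? (Fin._≟ i) (Vec.replicate (k ∸ 1) i)) (all-replicate (k ∸ 1)))
               (resp (↭-reflexive (toList-replicate (k ∸ 1))))) ⟩
        α * (d * f (replicate (k ∸ 1) i))
          ≈⟨ *-assoc _ _ _ ⟨
        α * d * f (replicate (k ∸ 1) i) ∎
      adjacency-part : ∑ ws (λ γ → (1# - α) * (adjacencyTensor k H i γ * f (Vec.toList γ))) ≈ ∑ (incidentEdges i) (λ j → (1# - α) * f (others i j))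
      adjacency-part = begin
        ∑ ws (λ γ → (1# - α) * (adjacencyTensor k H i γ * f (Vec.toList γ)))
          ≈⟨ ∑-*ˡ ws (1# - α) ⟨
        (1# - α) * ∑ ws (λ γ → adjacencyTensor k H i γ * f (Vec.toList γ))
          ≈⟨ *-congˡ (∑-adjacency i f resp) ⟩
        (1# - α) * ∑ Es (λ j → [ i ∈ᵉ? j ]· (f (others i j)))
          ≈⟨ ∑-*ˡ Es (1# - α) ⟩
        ∑ Es (λ j → (1# - α) * [ i ∈ᵉ? j ]· (f (others i j)))
          ≈⟨ ∑-cong Es (λ j → []·-*ˡ (i ∈ᵉ? j) _ _) ⟩
        ∑ Es (λ j → [ i ∈ᵉ? j ]· ((1# - α) * f (others i j)))
          ≈⟨ ∑-filter (i ∈ᵉ?_) Es ⟨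
        ∑ (incidentEdges i) (λ j → (1# - α) * f (others i j)) ∎

    module _ (φ : List (Arc n) → Carrier) (φ-↭ : ∀ {L L′} → L ↭ L′ → φ L ≈ φ L′) where

      contract-↭ : ∀ is {L L′} → L ↭ L′ → contract k T is φ L ≈ contract k T is φ L′
      contract-↭ []       p = φ-↭ p
      contract-↭ (i ∷ is) {L} {L′} p = ∑-cong (words n (k ∸ 1)) (λ γ → *-congˡ (contract-↭ is
        (trans (push-↭ i γ L) (trans (++⁺ˡ _ p) (↭-sym (push-↭ i γ L′))))))

      contract-∷ : ∀ i is L → contract k T (i ∷ is) φ L ≈
        ∑ (options i) (λ o → value (i , o) * contract k T is φ (arcsOf (i , o) ++ L))
      contract-∷ i is L = begin
        ∑ (words n (k ∸ 1)) (λ γ → T i γ * contract k T is φ (push i γ L))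
          ≈⟨ ∑-cong (words n (k ∸ 1)) (λ γ → *-congˡ (contract-↭ is (push-↭ i γ L))) ⟩
        ∑ (words n (k ∸ 1)) (λ γ → T i γ * f (Vec.toList γ))
          ≈⟨ ∑-row i f (λ p → contract-↭ is (++⁺ʳ L (map⁺ (i ,_) p))) ⟩
        value (i , nothing) * f (replicate (k ∸ 1) i) + ∑ (incidentEdges i) (λ j → value (i , just j) * f (others i j))
          ≈⟨ +-cong (*-congˡ (contract-↭ is (↭-reflexive (≡.cong (_++ L) (List.map-replicate (i ,_) (k ∸ 1) i)))))
               (≈-sym (∑-map just (incidentEdges i))) ⟩
        ∑ (options i) (λ o → value (i , o) * contract k T is φ (arcsOf (i , o) ++ L)) ∎
        where
        f : List V → Carrier
        f ℓ = contract k T is φ (map (i ,_) ℓ ++ L)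

    choices : List V → List (List Choice)
    choices = assignments options

    values : List Choice → Carrier
    values = foldr (λ c x → value c * x) 1#

    -- Iterating the row formula expands the product over rows. Orderings of the same hyperedge have
    -- been merged, so choices replace words and no factorial of k - 1 remains.
    contract≈∑choices : ∀ (φ : List (Arc n) → Carrier) → (∀ {L L′} → L ↭ L′ → φ L ≈ φ L′) → ∀ is L →
      contract k T is φ L ≈ ∑ (choices is) (λ ch → values ch * φ (arcs ch ++ L))
    contract≈∑choices φ φ-↭ []       L = ≈-sym (≈-trans (+-identityʳ _) (*-identityˡ _))
    contract≈∑choices φ φ-↭ (i ∷ is) L = begin
      contract k T (i ∷ is) φ L
        ≈⟨ contract-∷ φ φ-↭ i is L ⟩
      ∑ (options i) (λ o → value (i , o) * contract k T is φ (arcsOf (i , o) ++ L))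
        ≈⟨ ∑-cong (options i) (λ o → ≈-trans (*-congˡ (contract≈∑choices φ φ-↭ is (arcsOf (i , o) ++ L)))
             (≈-trans (∑-*ˡ (choices is) _) (≈-trans (∑-cong (choices is) (λ ch → ≈-trans (≈-sym (*-assoc _ _ _))
               (*-congˡ (φ-↭ (trans (shifts (arcs ch) (arcsOf (i , o))) (↭-sym (++-assoc (arcsOf (i , o)) (arcs ch) L)))))))
               (≈-sym (∑-map ((i , o) ∷_) (choices is)))))) ⟩
      ∑ (options i) (λ o → ∑ (map ((i , o) ∷_) (choices is)) (λ ch → values ch * φ (arcs ch ++ L)))
        ≈⟨ ∑-concatMap (λ o → map ((i , o) ∷_) (choices is)) (options i) ⟨
      ∑ (choices (i ∷ is)) (λ ch → values ch * φ (arcs ch ++ L)) ∎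

-- Contributions of a single hyperedge

module LocalContributions where

  open ListCombinatorics
  open WalkCounting
  open TracePairing
  open HypertreeGrowth
  open BalancedChoices
  open TensorContraction

  assignments-domain : ∀ {A O : Set} {opts : A → List O} xs {ch} → ch ∈ assignments opts xs → map proj₁ ch ≡ xs
  assignments-domain []       (here refl) = refl
  assignments-domain {opts = opts} (x ∷ xs) ch∈
    with o , _ , ch∈′ ← find (∈-concatMap⁻ _ {xs = opts x} ch∈)
    with ch′ , ch′∈ , refl ← ∈-map⁻ _ ch∈′ = ≡.cong (x ∷_) (assignments-domain xs ch′∈)

  assignments-options : ∀ {A O : Set} {opts : A → List O} xs {ch} → ch ∈ assignments opts xs →
    All (λ (x , o) → o ∈ opts x) ch
  assignments-options []       (here refl) = []
  assignments-options {opts = opts} (x ∷ xs) ch∈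
    with o , o∈ , ch∈′ ← find (∈-concatMap⁻ _ {xs = opts x} ch∈)
    with ch′ , ch′∈ , refl ← ∈-map⁻ _ ch∈′ = o∈ ∷ assignments-options xs ch′∈

  module AssignmentSum {c ℓ} (S : CommutativeSemiring c ℓ) where
    open CommutativeSemiring S
      renaming (refl to ≈-refl; sym to ≈-sym; trans to ≈-trans; zero to *-zero)
    open ListSum S
    open import Relation.Binary.Reasoning.Setoid setoid

    module _ {A O : Set} where

      ∑-assignments-∷ : ∀ (opts : A → List O) x xs {f : List (A × O) → Carrier} →
        ∑ (assignments opts (x ∷ xs)) f ≈ ∑ (opts x) (λ o → ∑ (assignments opts xs) (λ ch → f ((x , o) ∷ ch)))
      ∑-assignments-∷ opts x xs = ≈-trans (∑-concatMap _ (opts x))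
        (∑-cong (opts x) (λ o → ∑-map ((x , o) ∷_) (assignments opts xs)))

      ∑-assignments-↭ : ∀ (opts : A → List O) {xs ys} {f : List (A × O) → Carrier} →
        (∀ {ch ch′} → ch ↭ ch′ → f ch ≈ f ch′) → xs ↭ ys → ∑ (assignments opts xs) f ≈ ∑ (assignments opts ys) f
      ∑-assignments-↭ opts resp _↭_.refl = ≈-refl
      ∑-assignments-↭ opts {x ∷ xs} {x ∷ ys} resp (prep x p) = ≈-trans (∑-assignments-∷ opts x xs)
        (≈-trans (∑-cong (opts x) (λ o → ∑-assignments-↭ opts (λ q → resp (prep (x , o) q)) p))
          (≈-sym (∑-assignments-∷ opts x ys)))
      ∑-assignments-↭ opts {x ∷ y ∷ xs} {y ∷ x ∷ ys} {f} resp (swap x y p) = begin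
        ∑ (assignments opts (x ∷ y ∷ xs)) f
          ≈⟨ twice x y xs ⟩
        ∑ (opts x) (λ o → ∑ (opts y) (λ o′ → ∑ (assignments opts xs) (λ ch → f ((x , o) ∷ (y , o′) ∷ ch))))
          ≈⟨ ∑-swap (opts x) (opts y) ⟩
        ∑ (opts y) (λ o′ → ∑ (opts x) (λ o → ∑ (assignments opts xs) (λ ch → f ((x , o) ∷ (y , o′) ∷ ch))))
          ≈⟨ ∑-cong (opts y) (λ o′ → ∑-cong (opts x) (λ o → ≈-trans
               (∑-cong (assignments opts xs) (λ ch → resp (swap (x , o) (y , o′) ↭-refl)))
               (∑-assignments-↭ opts (λ q → resp (prep (y , o′) (prep (x , o) q))) p))) ⟩
        ∑ (opts y) (λ o′ → ∑ (opts x) (λ o → ∑ (assignments opts ys) (λ ch → f ((y , o′) ∷ (x , o) ∷ ch))))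
          ≈⟨ twice y x ys ⟨
        ∑ (assignments opts (y ∷ x ∷ ys)) f ∎
        where
        twice : ∀ x y zs → ∑ (assignments opts (x ∷ y ∷ zs)) f ≈
          ∑ (opts x) (λ o → ∑ (opts y) (λ o′ → ∑ (assignments opts zs) (λ ch → f ((x , o) ∷ (y , o′) ∷ ch))))
        twice x y zs = ≈-trans (∑-assignments-∷ opts x (y ∷ zs)) (∑-cong (opts x) (λ o → ∑-assignments-∷ opts y zs))
      ∑-assignments-↭ opts resp (trans p q) = ≈-trans (∑-assignments-↭ opts resp p) (∑-assignments-↭ opts resp q)

      -- Discards, position by position, the options that lead only to vanishing summands. This is
      -- how the other hyperedges through a vertex disappear from the sum.
      ∑-assignments-restrict : ∀ {opts opts′ : A → List O} (Bad : A × O → Set) xs {f : List (A × O) → Carrier} →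
        (∀ {x} → x ∈ xs → ∃[ rest ] opts x ↭ opts′ x ++ rest × (∀ {o} → o ∈ rest → Bad (x , o))) →
        (∀ {ch} → ch ∈ assignments opts xs → Any Bad ch → f ch ≈ 0#) →
        ∑ (assignments opts xs) f ≈ ∑ (assignments opts′ xs) f
      ∑-assignments-restrict Bad [] split vanish = ≈-refl
      ∑-assignments-restrict {opts} {opts′} Bad (x ∷ xs) {f} split vanish with rest , p , bad ← split (here refl) = begin
        ∑ (assignments opts (x ∷ xs)) f
          ≈⟨ ∑-assignments-∷ opts x xs ⟩
        ∑ (opts x) g
          ≈⟨ ≈-trans (∑-↭ p) (∑-++ (opts′ x) rest) ⟩
        ∑ (opts′ x) g + ∑ rest g
          ≈⟨ +-cong (∑-cong∈ (opts′ x) (λ {o} o∈ → ∑-assignments-restrict Bad xs (split ∘ there)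
               (λ ch∈ any → vanish (extend o (∈-resp-↭ (↭-sym p) (∈-++⁺ˡ o∈)) ch∈) (there any))))
             (∑-0 rest (λ {o} o∈ → ∑-0 (assignments opts xs) (λ ch∈ →
               vanish (extend o (∈-resp-↭ (↭-sym p) (∈-++⁺ʳ (opts′ x) o∈)) ch∈) (here (bad o∈))))) ⟩
        ∑ (opts′ x) (λ o → ∑ (assignments opts′ xs) (λ ch → f ((x , o) ∷ ch))) + 0#
          ≈⟨ +-identityʳ _ ⟩
        ∑ (opts′ x) (λ o → ∑ (assignments opts′ xs) (λ ch → f ((x , o) ∷ ch)))
          ≈⟨ ∑-assignments-∷ opts′ x xs ⟨
        ∑ (assignments opts′ (x ∷ xs)) f ∎
        where
        g : O → Carrier
        g o = ∑ (assignments opts xs) (λ ch → f ((x , o) ∷ ch))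
        extend : ∀ o {ch} → o ∈ opts x → ch ∈ assignments opts xs → (x , o) ∷ ch ∈ assignments opts (x ∷ xs)
        extend o o∈ ch∈ = ∈-concatMap⁺ _
          (lose o∈ (∈-map⁺ ((x , o) ∷_) ch∈))

    ∑-assignments-map : ∀ {A A′ O O′ : Set} (φ : A → A′) (ψ : O → O′) {opts : A → List O} {opts′ : A′ → List O′} →
      (∀ x → opts′ (φ x) ≡ map ψ (opts x)) → ∀ xs {f : List (A′ × O′) → Carrier} →
      ∑ (assignments opts′ (map φ xs)) f ≈ ∑ (assignments opts xs) (λ ch → f (map (λ (x , o) → φ x , ψ o) ch))
    ∑-assignments-map φ ψ eq [] = ≈-refl
    ∑-assignments-map φ ψ {opts} {opts′} eq (x ∷ xs) {f} = begin
      ∑ (assignments opts′ (φ x ∷ map φ xs)) f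
        ≈⟨ ∑-assignments-∷ opts′ (φ x) (map φ xs) ⟩
      ∑ (opts′ (φ x)) (λ o → ∑ (assignments opts′ (map φ xs)) (λ ch → f ((φ x , o) ∷ ch)))
        ≡⟨ ≡.cong (λ os → ∑ os (λ o → ∑ (assignments opts′ (map φ xs)) (λ ch → f ((φ x , o) ∷ ch)))) (eq x) ⟩
      ∑ (map ψ (opts x)) (λ o → ∑ (assignments opts′ (map φ xs)) (λ ch → f ((φ x , o) ∷ ch)))
        ≈⟨ ∑-map ψ (opts x) ⟩
      ∑ (opts x) (λ o → ∑ (assignments opts′ (map φ xs)) (λ ch → f ((φ x , ψ o) ∷ ch)))
        ≈⟨ ∑-cong (opts x) (λ o → ∑-assignments-map φ ψ eq xs) ⟩
      ∑ (opts x) (λ o → ∑ (assignments opts xs) (λ ch → f ((φ x , ψ o) ∷ map (λ (x , o) → φ x , ψ o) ch)))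
        ≈⟨ ∑-assignments-∷ opts x xs ⟨
      ∑ (assignments opts (x ∷ xs)) (λ ch → f (map (λ (x , o) → φ x , ψ o) ch)) ∎

  module ListProduct {c ℓ} (S : CommutativeSemiring c ℓ) where
    open CommutativeSemiring S
      renaming (refl to ≈-refl; sym to ≈-sym; trans to ≈-trans; zero to *-zero)
    open import Algebra.Properties.CommutativeSemigroup *-commutativeSemigroup using (x∙yz≈y∙xz)

    ∏ : ∀ {a} {A : Set a} → List A → (A → Carrier) → Carrier
    ∏ xs f = foldr (λ x y → f x * y) 1# xs

    module _ {a} {A : Set a} where

      ∏-cong∈ : ∀ (xs : List A) {f g : A → Carrier} → (∀ {x} → x ∈ xs → f x ≈ g x) → ∏ xs f ≈ ∏ xs g
      ∏-cong∈ []       eq = ≈-refl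
      ∏-cong∈ (x ∷ xs) eq = *-cong (eq (here refl)) (∏-cong∈ xs (eq ∘ there))

      ∏-cong : ∀ (xs : List A) {f g : A → Carrier} → (∀ x → f x ≈ g x) → ∏ xs f ≈ ∏ xs g
      ∏-cong xs eq = ∏-cong∈ xs (λ {x} _ → eq x)

      ∏-1 : ∀ (xs : List A) {f : A → Carrier} → (∀ {x} → x ∈ xs → f x ≈ 1#) → ∏ xs f ≈ 1#
      ∏-1 []       eq = ≈-refl
      ∏-1 (x ∷ xs) eq = ≈-trans (*-cong (eq (here refl)) (∏-1 xs (eq ∘ there))) (*-identityˡ 1#)

      ∏-++ : ∀ (xs ys : List A) {f : A → Carrier} → ∏ (xs ++ ys) f ≈ ∏ xs f * ∏ ys f
      ∏-++ []       ys = ≈-sym (*-identityˡ _)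
      ∏-++ (x ∷ xs) ys = ≈-trans (*-congˡ (∏-++ xs ys)) (≈-sym (*-assoc _ _ _))

      ∏-↭ : ∀ {xs ys : List A} {f : A → Carrier} → xs ↭ ys → ∏ xs f ≈ ∏ ys f
      ∏-↭ _↭_.refl     = ≈-refl
      ∏-↭ (prep x p)   = *-congˡ (∏-↭ p)
      ∏-↭ (swap x y p) = ≈-trans (x∙yz≈y∙xz _ _ _) (*-congˡ (*-congˡ (∏-↭ p)))
      ∏-↭ (trans p q)  = ≈-trans (∏-↭ p) (∏-↭ q)

      ∏-support : ∀ {ys xs : List A} {f : A → Carrier} → Unique ys → Unique xs →
        (∀ {x} → x ∈ ys → x ∈ xs) → (∀ {x} → x ∉ ys → f x ≈ 1#) → ∏ xs f ≈ ∏ ys f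
      ∏-support {ys} {xs} {f} uys uxs sub trivial with rest , p ← unique-⊆⇒↭++ uys sub =
        ≈-trans (∏-↭ p) (≈-trans (∏-++ ys rest) (≈-trans
          (*-congˡ (∏-1 rest (λ x∈ → trivial (λ x∈ys → unique-++-disjoint ys (unique-resp-↭ p uxs) x∈ys x∈))))
          (*-identityʳ _)))

    ∏-map : ∀ {a b} {A : Set a} {B : Set b} (g : A → B) (xs : List A) {f : B → Carrier} → ∏ (map g xs) f ≈ ∏ xs (f ∘ g)
    ∏-map g []       = ≈-refl
    ∏-map g (x ∷ xs) = *-congˡ (∏-map g xs)

  ++-cancelˡ-↭ : ∀ {A : Set} (xs : List A) {ys zs} → xs ++ ys ↭ xs ++ zs → ys ↭ zs
  ++-cancelˡ-↭ []       p = p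
  ++-cancelˡ-↭ (x ∷ xs) p = ++-cancelˡ-↭ xs (drop-∷ p)

  module CompleteArcs (k : ℕ) where

    rest : Fin k → List (Fin k)
    rest p = filter (λ q → ¬? (q Fin.≟ p)) (allFin k)

    -- The model of a hyperedge: at each of its k vertices one picks either the
    -- diagonal entry (false) or the hyperedge itself (true).
    modelArcsOf : Fin k × Bool → List (Arc k)
    modelArcsOf (p , false) = loops (k ∸ 1) p
    modelArcsOf (p , true)  = map (p ,_) (rest p)

    modelArcs : List (Fin k × Bool) → List (Arc k)
    modelArcs = concatMap modelArcsOf

    modelArcs-↭ : ∀ {ch ch′} → ch ↭ ch′ → modelArcs ch ↭ modelArcs ch′
    modelArcs-↭ = concatMap-↭ modelArcsOf

    modelOptions : Fin k → List Bool
    modelOptions _ = false ∷ true ∷ []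

    -- The count that all hypertrees share: it sees only k, the number of steps and the pattern `ps`
    -- of rows among the standard vertices.
    modelCount : ℕ → List (Fin k) → ℕ
    modelCount N ps = ∑ℕ.∑ (assignments modelOptions ps) (λ ch → closedWalks N (modelArcs ch))

  module Evaluation {c ℓ₁ ℓ₂ : Level} (F : OrderedField c ℓ₁ ℓ₂) (H : Hypergraph) {k : ℕ} (2≤k : 2 ℕ.≤ k)
    (uniform : Uniform k H) (connected : Connected H) (acyclic : ¬ Cycle H) (1≤m : 1 ℕ.≤ size H)
    (α : OrderedField.Carrier F) where
    open OrderedFieldProperties F
    open Spectral F
    open PolynomialPairing F
    open ListSum semiring
    open ListProduct semiring
    open AssignmentSum semiring
    open Incidence H
    open UniformHypertrees H (ℕ.<⇒≤ 2≤k) uniform connected acyclic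
    open Choices H k
    open Balance H 2≤k uniform connected acyclic using (vertices↭; length-others; others-unique; k≡; shape)
    open Contraction F H 2≤k uniform connected acyclic α
    open CompleteArcs k
    open import Relation.Binary.Reasoning.Setoid (CommutativeRing.setoid commutativeRing)
    module ∑ℕᵃ = AssignmentSum ℕ.+-*-commutativeSemiring

    choices-valid : ∀ is {ch} → ch ∈ choices is → All Valid ch
    choices-valid is ch∈ = All.map valid (assignments-options is ch∈)
      where
      valid : ∀ {c} → proj₂ c ∈ options (proj₁ c) → Valid c
      valid {_ , nothing} _ = tt
      valid {i , just j} (there o∈) with _ , j∈ , refl ← ∈-map⁻ just o∈ = proj₂ (∈-filter⁻ (i ∈ᵉ?_) {xs = Es} j∈)

    choices-length : ∀ is {ch} → ch ∈ choices is → length ch ≡ length is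
    choices-length is {ch} ch∈ = ≡.trans (≡.sym (List.length-map proj₁ ch)) (≡.cong length (assignments-domain is ch∈))

    choices-shape : ∀ N is {ch} → 0 ℕ.< length is → length is ℕ.< k ℕ.+ k → ch ∈ choices is →
      closedWalks N (arcs ch) ≢ 0 → Shape ch
    choices-shape N is {ch} 0< short ch∈ c≢0
      with es , g , full ← growAll (fromℕ< 1≤m)
      = shape g full (choices-valid is ch∈) N c≢0
          (ℕ.<-≤-trans 0< (ℕ.≤-reflexive (≡.sym (choices-length is ch∈))))
          (ℕ.≤-<-trans (ℕ.≤-reflexive (choices-length is ch∈)) short)

    contracted : ℕ → List V → Carrier
    contracted N is = contract k T is (λ L → fromℕ (closedWalks N L)) []

    contracted≈ : ∀ N is → contracted N is ≈ ∑ (choices is) (λ ch → values ch * fromℕ (closedWalks N (arcs ch)))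
    contracted≈ N is = ≈-trans (contract≈∑choices _ (λ p → fromℕ-≡ (closedWalks-↭ N p)) is [])
      (∑-cong (choices is) (λ ch → *-congˡ (fromℕ-≡ (≡.cong (closedWalks N) (List.++-identityʳ (arcs ch))))))

    diagonalWeight : V → Carrier
    diagonalWeight v = α * fromℕ (degree H v)

    -- As the additional rows lie in the hyperedge, the vertices that occur in the list are exactly
    -- those of j; `edge-distinct` then recovers j.
    sameEdge : ∀ {j j′ r r′} → All (_∈ᵉ j) r → All (_∈ᵉ j′) r′ → vertices j ++ r ↭ vertices j′ ++ r′ → j ≡ j′
    sameEdge {j} {j′} {r} {r′} r⊆ r′⊆ p = edge-distinct H (⊆-antisym
      (λ v∈ → back r′⊆ (∈-resp-↭ p (∈-++⁺ˡ (∈-members⁺ _ v∈))))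
      (λ v∈ → back r⊆ (∈-resp-↭ (↭-sym p) (∈-++⁺ˡ (∈-members⁺ _ v∈)))))
      where
      back : ∀ {j r v} → All (_∈ᵉ j) r → v ∈ vertices j ++ r → v ∈ᵉ j
      back {j} r⊆ v∈ with ∈-++⁻ (vertices j) v∈
      ... | inj₁ v∈j = ∈-members⁻ _ v∈j
      ... | inj₂ v∈r = All.lookup r⊆ v∈r

    -- As k ≥ 2, a list containing all vertices of a hyperedge cannot repeat a single vertex; this
    -- separates the two shapes.
    notConstant : ∀ {j v} → (∀ {u} → u ∈ vertices j → u ≡ v) → ⊥
    notConstant {j} {v} const = ℕ.<⇒≱ 2≤k (ℕ.≤-trans (ℕ.≤-reflexive (≡.sym (length-vertices j)))
      (unique-⊆⇒length≤ {xs = [ v ]} (members-unique (edge H j)) (λ u∈ → here (const u∈))))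

    local-domain : ∀ j r → map proj₁ (map (_, just j) (vertices j) ++ map (_, nothing) r) ≡ vertices j ++ r
    local-domain j r = ≡.trans (List.map-++ proj₁ (map (_, just j) (vertices j)) _)
      (≡.cong₂ _++_ (≡.trans (≡.sym (List.map-∘ (vertices j))) (List.map-id (vertices j)))
        (≡.trans (≡.sym (List.map-∘ r)) (List.map-id r)))

    module _ {j : E} {r : List V} (r⊆j : All (_∈ᵉ j) r) {is : List V} (is↭ : is ↭ vertices j ++ r)
      (short : length is ℕ.< k ℕ.+ k) where

      0<is : 0 ℕ.< length is
      0<is = ℕ.≤-trans (ℕ.<⇒≤ 2≤k) (ℕ.≤-trans (ℕ.m≤m+n k (length r)) (ℕ.≤-reflexive (≡.sym
        (≡.trans (↭-length is↭) (≡.trans (List.length-++ (vertices j)) (≡.cong (ℕ._+ length r) (length-vertices j)))))))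

      -- The rows determine the choices: they contain all vertices of j, which excludes the diagonal
      -- shape, and by `sameEdge` no other hyperedge fits. Hence all contributing choices have the
      -- same value.
      localForm : ∀ N {ch} → ch ∈ choices is → closedWalks N (arcs ch) ≢ 0 →
        ch ↭ map (_, just j) (vertices j) ++ map (_, nothing) r
      localForm N {ch} ch∈ c≢0 with choices-shape N is 0<is short ch∈ c≢0
      ... | diagonal v all = ⊥-elim (notConstant {j} {v} (λ {u} u∈ → const (∈-resp-↭ (↭-sym is↭) (∈-++⁺ˡ u∈))))
        where
        const : ∀ {u} → u ∈ is → u ≡ v
        const u∈ with c , c∈ , refl ← ∈-map⁻ proj₁ (≡.subst (_ ∈_) (≡.sym (assignments-domain is ch∈)) u∈) =
          ≡.cong proj₁ (All.lookup all c∈)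
      ... | local j′ r′ r′⊆ p = fromShape r′⊆ p (trans (↭-reflexive (≡.sym (local-domain j′ r′))) (trans (↭-sym (map⁺ proj₁ p))
          (trans (↭-reflexive (assignments-domain is ch∈)) is↭)))
        where
        fromShape : ∀ {j′ r′} → All (_∈ᵉ j′) r′ → ch ↭ map (_, just j′) (vertices j′) ++ map (_, nothing) r′ →
          vertices j′ ++ r′ ↭ vertices j ++ r → ch ↭ map (_, just j) (vertices j) ++ map (_, nothing) r
        fromShape r′⊆ p domains with refl ← sameEdge r⊆j r′⊆ (↭-sym domains) =
          trans p (++⁺ˡ _ (map⁺ (_, nothing) (++-cancelˡ-↭ (vertices j) domains)))

      localOptions : V → List (Maybe E)
      localOptions _ = nothing ∷ just j ∷ []

      localValue : Carrier
      localValue = ∏ (vertices j) (λ _ → 1# - α) * ∏ r diagonalWeight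

      -- A choice with nonzero count has value `localValue`, and for zero count the value is
      -- irrelevant, so `localValue` can be put into every summand and taken out. Options naming
      -- another hyperedge give count zero and are dropped.
      localised : ∀ N → contracted N is ≈
        localValue * fromℕ (∑ℕ.∑ (assignments localOptions is) (λ ch → closedWalks N (arcs ch)))
      localised N = begin
        contracted N is
          ≈⟨ contracted≈ N is ⟩
        ∑ (choices is) (λ ch → values ch * fromℕ (closedWalks N (arcs ch)))
          ≈⟨ ∑-cong∈ (choices is) value≈ ⟩
        ∑ (choices is) (λ ch → localValue * fromℕ (closedWalks N (arcs ch)))
          ≈⟨ ∑-assignments-restrict Bad is split vanish ⟩
        ∑ (assignments localOptions is) (λ ch → localValue * fromℕ (closedWalks N (arcs ch)))
          ≈⟨ ∑-*ˡ (assignments localOptions is) localValue ⟨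
        localValue * ∑ (assignments localOptions is) (λ ch → fromℕ (closedWalks N (arcs ch)))
          ≈⟨ *-congˡ (fromℕ-∑ (assignments localOptions is)) ⟨
        localValue * fromℕ (∑ℕ.∑ (assignments localOptions is) (λ ch → closedWalks N (arcs ch))) ∎
        where
        Bad : Choice → Set
        Bad (_ , o) = ∃[ j′ ] o ≡ just j′ × j′ ≢ j
        value≈ : ∀ {ch} → ch ∈ choices is → values ch * fromℕ (closedWalks N (arcs ch)) ≈ localValue * fromℕ (closedWalks N (arcs ch))
        value≈ {ch} ch∈ with closedWalks N (arcs ch) ℕ.≟ 0
        ... | yes z = ≈-trans (*-congˡ (fromℕ-≡ z)) (≈-trans (zeroʳ _) (≈-sym (≈-trans (*-congˡ (fromℕ-≡ z)) (zeroʳ _))))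
        ... | no c≢0 = *-congʳ (≈-trans (∏-↭ (localForm N ch∈ c≢0)) (≈-trans (∏-++ (map (_, just j) (vertices j)) _)
          (*-cong (∏-map _ (vertices j)) (∏-map _ r))))
        vanish : ∀ {ch} → ch ∈ choices is → Any Bad ch → localValue * fromℕ (closedWalks N (arcs ch)) ≈ 0#
        vanish {ch} ch∈ bad with closedWalks N (arcs ch) ℕ.≟ 0
        ... | yes z = ≈-trans (*-congˡ (fromℕ-≡ z)) (zeroʳ _)
        ... | no c≢0 with (i , _) , c∈ , (j′ , refl , j′≢j) ← find bad
          with ∈-++⁻ (map (_, just j) (vertices j)) (∈-resp-↭ (localForm N ch∈ c≢0) c∈)
        ...   | inj₁ c∈′ with _ , _ , refl ← ∈-map⁻ _ c∈′ = ⊥-elim (j′≢j refl)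
        ...   | inj₂ c∈′ with _ , _ , () ← ∈-map⁻ _ c∈′
        inEdge : ∀ {i} → i ∈ is → i ∈ᵉ j
        inEdge i∈ with ∈-++⁻ (vertices j) (∈-resp-↭ is↭ i∈)
        ... | inj₁ i∈j = ∈-members⁻ _ i∈j
        ... | inj₂ i∈r = All.lookup r⊆j i∈r
        split : ∀ {i} → i ∈ is → ∃[ rest ] options i ↭ localOptions i ++ rest × (∀ {o} → o ∈ rest → Bad (i , o))
        split {i} i∈ with rest , p ← ∈⇒↭∷ (∈-filter⁺ (i ∈ᵉ?_) (∈-allFin j) (inEdge i∈))
          with j≢ ∷ _ ← unique-resp-↭ p (Unique.filter⁺ (i ∈ᵉ?_) (Unique.allFin⁺ (size H)))
          = map just rest , prep nothing (map⁺ just p) , λ o∈ →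
              let j′ , j′∈ , o≡ = ∈-map⁻ just o∈ in j′ , o≡ , λ j′≡j → All.lookup j≢ j′∈ (≡.sym j′≡j)

    -- A numbering of the vertices of j by the standard ones. The image is fixed only up to order,
    -- which leaves the freedom to prescribe which vertices come first.
    record Frame (j : E) (φ : Fin k → V) : Set where
      field
        injective : Injective _≡_ _≡_ φ
        image     : map φ (allFin k) ↭ vertices j

    module _ {j : E} {φ : Fin k → V} (frame : Frame j φ) where
      open Frame frame

      φ∈ : ∀ p → φ p ∈ᵉ j
      φ∈ p = ∈-members⁻ _ (∈-resp-↭ image (∈-map⁺ φ (∈-allFin p)))

      others-φ : ∀ p → others (φ p) j ↭ map φ (rest p)
      others-φ p = unique-⇔⇒↭ (others-unique (φ p) j)
        (Unique.map⁺ injective (Unique.filter⁺ (λ q → ¬? (q Fin.≟ p)) (Unique.allFin⁺ k))) to from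
        where
        to : ∀ {v} → v ∈ others (φ p) j → v ∈ map φ (rest p)
        to v∈ with v∈j , v≢ ← ∈-filter⁻ (λ v → ¬? (v Fin.≟ φ p)) v∈
          with q , _ , refl ← ∈-map⁻ φ (∈-resp-↭ (↭-sym image) v∈j)
          = ∈-map⁺ φ (∈-filter⁺ (λ q → ¬? (q Fin.≟ p)) (∈-allFin q) (λ { refl → v≢ refl }))
        from : ∀ {v} → v ∈ map φ (rest p) → v ∈ others (φ p) j
        from v∈ with q , q∈ , refl ← ∈-map⁻ φ v∈ =
          ∈-filter⁺ (λ v → ¬? (v Fin.≟ φ p)) (∈-members⁺ _ (φ∈ q))
            (λ φq≡φp → proj₂ (∈-filter⁻ (λ q → ¬? (q Fin.≟ p)) {xs = allFin k} q∈) (injective φq≡φp))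

      toOption : Bool → Maybe E
      toOption false = nothing
      toOption true  = just j

      toChoice : Fin k × Bool → Choice
      toChoice (p , b) = φ p , toOption b

      arcs-toChoice : ∀ ch → arcs (map toChoice ch) ↭ relabel φ (modelArcs ch)
      arcs-toChoice [] = _↭_.refl
      arcs-toChoice ((p , b) ∷ ch) = trans (++⁺ (one b) (arcs-toChoice ch))
        (↭-reflexive (≡.sym (List.map-++ _ (modelArcsOf (p , b)) (modelArcs ch))))
        where
        one : ∀ b → arcsOf (φ p , toOption b) ↭ relabel φ (modelArcsOf (p , b))
        one false = ↭-reflexive (≡.sym (List.map-replicate _ (k ∸ 1) (p , p)))
        one true  = trans (map⁺ (φ p ,_) (others-φ p))
          (↭-reflexive (≡.trans (≡.sym (List.map-∘ (rest p))) (List.map-∘ (rest p))))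

      localCount≡ : ∀ {N} → 0 ℕ.< N → ∀ ps {is} → is ↭ map φ ps →
        ∑ℕ.∑ (assignments (λ _ → nothing ∷ just j ∷ []) is) (λ ch → closedWalks N (arcs ch)) ≡ modelCount N ps
      localCount≡ {N} 0<N ps {is} p = ≡.trans
        (∑ℕᵃ.∑-assignments-↭ (λ _ → nothing ∷ just j ∷ []) (λ q → closedWalks-↭ N (arcs-↭ q)) p)
        (≡.trans (∑ℕᵃ.∑-assignments-map φ toOption (λ _ → refl) ps)
          (∑ℕ.∑-cong (assignments modelOptions ps) (λ ch → ≡.trans (closedWalks-↭ N (arcs-toChoice ch))
            (closedWalks-relabel φ injective 0<N (modelArcs ch)))))

      contracted-local : ∀ {N} → 0 ℕ.< N → ∀ rs {is} → is ↭ map φ (allFin k ++ rs) → length is ℕ.< k ℕ.+ k →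
        contracted N is ≈ ∏ (allFin k) (λ _ → 1# - α) * ∏ rs (λ p → diagonalWeight (φ p)) *
          fromℕ (modelCount N (allFin k ++ rs))
      contracted-local {N} 0<N rs {is} p short = ≈-trans (localised r⊆j is↭ short N)
        (*-cong (*-cong (≈-trans (∏-↭ (↭-sym image)) (∏-map φ (allFin k))) (∏-map φ rs)) (fromℕ-≡ (localCount≡ 0<N (allFin k ++ rs) p)))
        where
        r⊆j : All (_∈ᵉ j) (map φ rs)
        r⊆j = All.map⁺ (All.universal φ∈ rs)
        is↭ : is ↭ vertices j ++ map φ rs
        is↭ = trans p (trans (↭-reflexive (List.map-++ φ (allFin k) rs)) (++⁺ʳ (map φ rs) image))

-- Compositions as multisets of vertices

module CompositionReindexing where

  open ListCombinatorics
  open WalkCounting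
  open TracePairing
  open HypertreeGrowth
  open BalancedChoices
  open TensorContraction
  open LocalContributions

  module _ {n : ℕ} where

    count : Fin n → List (Fin n) → ℕ
    count v xs = ∑ℕ.∑ xs (λ x → ∑ℕ.[ x Fin.≟ v ]· 1)

    -- Together with `expansion`, this identifies compositions with lists of vertices up to order.
    content : List (Fin n) → Vec ℕ n
    content xs = Vec.tabulate (λ v → count v xs)

    lookup-content : ∀ xs v → Vec.lookup (content xs) v ≡ count v xs
    lookup-content xs v = Vec.lookup∘tabulate (λ v → count v xs) v

    count≢0⇒∈ : ∀ {v} xs → count v xs ≢ 0 → v ∈ xs
    count≢0⇒∈ {v} xs ≢0 with x , x∈ , f≢0 ← ∑ℕ.∑-≢0 xs ≢0 with refl , _ ← ∑ℕ.[]·-≢0 (x Fin.≟ v) f≢0 = x∈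

    counts≡⇒↭ : ∀ {xs ys} → (∀ v → count v xs ≡ count v ys) → xs ↭ ys
    counts≡⇒↭ {[]} {[]}     eq = ↭-refl
    counts≡⇒↭ {[]} {y ∷ ys} eq =
      ⊥-elim (ℕ.0≢1+n (≡.trans (eq y) (≡.cong (ℕ._+ count y ys) (∑ℕ.[]·-yes (y Fin.≟ y) refl))))
    counts≡⇒↭ {x ∷ xs} {ys} eq
      with ys′ , p ← ∈⇒↭∷ (count≢0⇒∈ ys (λ z → ℕ.0≢1+n (≡.trans (≡.sym z) (≡.trans (≡.sym (eq x))
             (≡.cong (ℕ._+ count x xs) (∑ℕ.[]·-yes (x Fin.≟ x) refl))))))
      = trans (prep x (counts≡⇒↭ (λ v → ℕ.+-cancelˡ-≡ (∑ℕ.[ x Fin.≟ v ]· 1) _ _ (≡.trans (eq v) (∑ℕ.∑-↭ p))))) (↭-sym p)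

    content-↭ : ∀ {xs ys} → xs ↭ ys → content xs ≡ content ys
    content-↭ p = Vec.tabulate-cong (λ v → ∑ℕ.∑-↭ p)

    content≡⇒↭ : ∀ {xs ys} → content xs ≡ content ys → xs ↭ ys
    content≡⇒↭ {xs} {ys} eq = counts≡⇒↭ (λ v →
      ≡.trans (≡.sym (lookup-content xs v)) (≡.trans (≡.cong (λ d → Vec.lookup d v) eq) (lookup-content ys v)))

    expansion : (Fin n → ℕ) → List (Fin n)
    expansion d = concatMap (λ i → replicate (d i) i) (allFin n)

    count-expansion : ∀ d v → count v (expansion d) ≡ d v
    count-expansion d v = begin
      count v (expansion d)                                          ≡⟨ ∑ℕ.∑-concatMap (λ i → replicate (d i) i) (allFin n) ⟩
      ∑ℕ.∑ (allFin n) (λ i → count v (replicate (d i) i))            ≡⟨ ∑ℕ.∑-single (Unique.allFin⁺ n) (∈-allFin v) (λ {i} _ i≢v → off i i≢v (d i)) ⟩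
      count v (replicate (d v) v)                                    ≡⟨ on (d v) ⟩
      d v                                                            ∎
      where
      open ≡-Reasoning
      off : ∀ i → i ≢ v → ∀ q → count v (replicate q i) ≡ 0
      off i i≢v zero    = refl
      off i i≢v (suc q) = ≡.cong₂ ℕ._+_ (∑ℕ.[]·-no (i Fin.≟ v) i≢v) (off i i≢v q)
      on : ∀ q → count v (replicate q v) ≡ q
      on zero    = refl
      on (suc q) = ≡.cong₂ ℕ._+_ (∑ℕ.[]·-yes (v Fin.≟ v) refl) (on q)

    content-expansion : ∀ d → content (expansion (Vec.lookup d)) ≡ d
    content-expansion d = ≡.trans (Vec.tabulate-cong (count-expansion (Vec.lookup d))) (Vec.tabulate∘lookup d)

    expansion-content : ∀ xs → expansion (Vec.lookup (content xs)) ↭ xs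
    expansion-content xs = content≡⇒↭ (content-expansion (content xs))

  sum-tabulate : ∀ {n} (f : Fin n → ℕ) → Vec.sum (Vec.tabulate f) ≡ ∑ℕ.∑ (allFin n) f
  sum-tabulate {zero}  f = refl
  sum-tabulate {suc n} f = ≡.trans (≡.cong (f zero ℕ.+_) (sum-tabulate (f ∘ suc))) (≡.sym (∑-allFin-suc f))

  sum-content : ∀ {n} (xs : List (Fin n)) → Vec.sum (content xs) ≡ length xs
  sum-content {n} xs = begin
    Vec.sum (content xs)                                          ≡⟨ sum-tabulate (λ v → count v xs) ⟩
    ∑ℕ.∑ (allFin n) (λ v → count v xs)                            ≡⟨ ∑ℕ.∑-swap (allFin n) xs ⟩
    ∑ℕ.∑ xs (λ x → ∑ℕ.∑ (allFin n) (λ v → ∑ℕ.[ x Fin.≟ v ]· 1))   ≡⟨ ∑ℕ.∑-cong xs (λ x → ≡.trans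
        (∑ℕ.∑-single (Unique.allFin⁺ n) (∈-allFin x) (λ {v} _ v≢x → ∑ℕ.[]·-no (x Fin.≟ v) (λ x≡v → v≢x (≡.sym x≡v))))
        (∑ℕ.[]·-yes (x Fin.≟ x) refl)) ⟩
    ∑ℕ.∑ xs (λ _ → 1)                                             ≡⟨ ∑-const-1 xs ⟩
    length xs                                                     ∎
    where open ≡-Reasoning

  length-expansion : ∀ {n} (d : Vec ℕ n) → length (expansion (Vec.lookup d)) ≡ Vec.sum d
  length-expansion d = ≡.trans (≡.sym (sum-content (expansion (Vec.lookup d)))) (≡.cong Vec.sum (content-expansion d))

  ∈-compositions⁺ : ∀ {n} (d : Vec ℕ n) {D} → Vec.sum d ≡ D → d ∈ compositions n D
  ∈-compositions⁺ []      refl = here refl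
  ∈-compositions⁺ {suc n} (i ∷ d) {D} refl = ∈-concatMap⁺ (λ i → map (i ∷_) (compositions n (D ∸ i)))
    (lose (∈-upTo⁺ (s≤s (ℕ.m≤m+n i (Vec.sum d)))) (∈-map⁺ (i ∷_) (∈-compositions⁺ d (≡.sym (ℕ.m+n∸m≡n i (Vec.sum d))))))

  ∈-compositions⁻ : ∀ {n} (d : Vec ℕ n) {D} → d ∈ compositions n D → Vec.sum d ≡ D
  ∈-compositions⁻ []      {zero} d∈ = refl
  ∈-compositions⁻ {suc n} (i ∷ d) {D} d∈
    with i′ , i∈ , d∈′ ← find (∈-concatMap⁻ (λ i → map (i ∷_) (compositions n (D ∸ i))) {xs = upTo (suc D)} d∈)
    with _ , d″∈ , refl ← ∈-map⁻ (i′ ∷_) d∈′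
    = ≡.trans (≡.cong (i ℕ.+_) (∈-compositions⁻ d d″∈)) (ℕ.m+[n∸m]≡n (ℕ.≤-pred (∈-upTo⁻ i∈)))

  compositions-unique : ∀ n D → Unique (compositions n D)
  compositions-unique zero    zero    = [] ∷ []
  compositions-unique zero    (suc D) = []
  compositions-unique (suc n) D = Unique.concat⁺
    (All.map⁺ (All.universal (λ i → Unique.map⁺ Vec.∷-injectiveʳ (compositions-unique n (D ∸ i))) (upTo (suc D))))
    (AllPairs.map⁺ (AllPairs.map disjoint (Unique.upTo⁺ (suc D))))
    where
    disjoint : ∀ {i j} → i ≢ j → ∀ {d} → ¬ (d ∈ map (i ∷_) (compositions n (D ∸ i)) × d ∈ map (j ∷_) (compositions n (D ∸ j)))
    disjoint {i} {j} i≢j (d∈i , d∈j) with _ , _ , refl ← ∈-map⁻ (i ∷_) d∈i with _ , _ , eq ← ∈-map⁻ (j ∷_) d∈j =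
      i≢j (Vec.∷-injectiveˡ eq)

  count-map : ∀ {l n} (φ : Fin l → Fin n) → Injective _≡_ _≡_ φ → ∀ p ps → count (φ p) (map φ ps) ≡ count p ps
  count-map φ inj p ps = ≡.trans (∑ℕ.∑-map φ ps)
    (∑ℕ.∑-cong ps (λ q → ∑ℕ.[]·-⇔ (φ q Fin.≟ φ p) (q Fin.≟ p) inj (≡.cong φ) refl))

  -- The contributions of single compositions to the traces, read off on k
  -- standard vertices; they depend on k, D and α only.
  module Constants {c ℓ₁ ℓ₂ : Level} (F : OrderedField c ℓ₁ ℓ₂) (k : ℕ) (α : OrderedField.Carrier F) where
    open OrderedFieldProperties F
    open ListProduct semiring
    open CompleteArcs k

    contentWeight : ∀ {l} → List (Fin l) → Carrier
    contentWeight {l} ps = ∏ (allFin l) (λ p → 1/ (count p ps ℕ.* (k ∸ 1)) !)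

    diagonalCount : ℕ → ℕ → ℕ
    diagonalCount N D = closedWalks N (concatMap (loops (k ∸ 1)) (replicate D (zero {0})))

    diagonalConstant : ℕ → Carrier
    diagonalConstant D = contentWeight (replicate D (zero {0})) * fromℕ (diagonalCount (D ℕ.* (k ∸ 1)) D)

    localConstant : ℕ → List (Fin k) → Carrier
    localConstant D rs = contentWeight (allFin k ++ rs) *
      (∏ (allFin k) (λ _ → 1# - α) * fromℕ (modelCount (D ℕ.* (k ∸ 1)) (allFin k ++ rs)))

    diagonalPower : ℕ → ℕ → Carrier
    diagonalPower D d = ∏ (replicate D d) (λ d → α * fromℕ d)

  module Reindexing {c ℓ₁ ℓ₂ : Level} (F : OrderedField c ℓ₁ ℓ₂) (H : Hypergraph) {k : ℕ} (2≤k : 2 ℕ.≤ k)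
    (uniform : Uniform k H) (connected : Connected H) (acyclic : ¬ Cycle H) (1≤m : 1 ℕ.≤ size H)
    (α : OrderedField.Carrier F) where
    open OrderedFieldProperties F
    open Spectral F
    open PolynomialPairing F
    open ListSum semiring
    open ListProduct semiring
    open AssignmentSum semiring
    open Incidence H
    open UniformHypertrees H (ℕ.<⇒≤ 2≤k) uniform connected acyclic
    open Choices H k
    open Contraction F H 2≤k uniform connected acyclic α
    open CompleteArcs k
    open Evaluation F H 2≤k uniform connected acyclic 1≤m α
    open Constants F k α
    open import Relation.Binary.Reasoning.Setoid (CommutativeRing.setoid commutativeRing)

    1/0! : 1/ 0 ! ≈ 1#
    1/0! = ≈-trans (≈-sym (≈-trans (*-congˡ fromℕ-1) (*-identityʳ _))) (recip-inverse 1)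

    -- Vertices outside the image of φ have multiplicity 0 and contribute 1/0! = 1, so the weight
    -- can be read off on the standard vertices.
    weight-content : ∀ {l} (φ : Fin l → V) → Injective _≡_ _≡_ φ → ∀ ps {is} → is ↭ map φ ps →
      weight k T Vs (Vec.lookup (content is)) ≈ contentWeight ps
    weight-content {l} φ inj ps {is} p = begin
      ∏ Vs (λ v → 1/ (Vec.lookup (content is) v ℕ.* (k ∸ 1)) !)
        ≈⟨ ∏-support {ys = map φ (allFin l)} (Unique.map⁺ inj (Unique.allFin⁺ l)) (Unique.allFin⁺ n) (λ _ → ∈-allFin _)
             (λ {v} v∉ → ≈-trans (g-cong (absent v v∉)) 1/0!) ⟩
      ∏ (map φ (allFin l)) (λ v → 1/ (Vec.lookup (content is) v ℕ.* (k ∸ 1)) !)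
        ≈⟨ ∏-map φ (allFin l) ⟩
      ∏ (allFin l) (λ q → 1/ (Vec.lookup (content is) (φ q) ℕ.* (k ∸ 1)) !)
        ≈⟨ ∏-cong (allFin l) (λ q → g-cong (≡.trans (lookup-content is (φ q)) (≡.trans (∑ℕ.∑-↭ p) (count-map φ inj q ps)))) ⟩
      contentWeight ps ∎
      where
      g-cong : ∀ {a b} → a ≡ b → 1/ (a ℕ.* (k ∸ 1)) ! ≈ 1/ (b ℕ.* (k ∸ 1)) !
      g-cong refl = ≈-refl
      absent : ∀ v → v ∉ map φ (allFin l) → Vec.lookup (content is) v ≡ 0
      absent v v∉ = ≡.trans (lookup-content is v) (∑ℕ.∑-0 is (λ {i} i∈ → ∑ℕ.[]·-no (i Fin.≟ v) (λ { refl → outside i∈ })))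
        where
        outside : v ∈ is → ⊥
        outside v∈ with q , _ , refl ← ∈-map⁻ φ (∈-resp-↭ p v∈) = v∉ (∈-map⁺ φ (∈-allFin q))

    module _ {v : V} {is : List V} (all≡ : All (_≡ v) is) (0< : 0 ℕ.< length is) (short : length is ℕ.< k ℕ.+ k) where

      diagonalForm : ∀ N {ch} → ch ∈ choices is → closedWalks N (arcs ch) ≢ 0 → All (λ c → proj₂ c ≡ nothing) ch
      diagonalForm N {ch} ch∈ c≢0 with choices-shape N is 0< short ch∈ c≢0
      ... | diagonal _ all = All.map (≡.cong proj₂) all
      ... | local j r r⊆ p = ⊥-elim (notConstant {j} {v} (λ u∈ → All.lookup all≡ (≡.subst (_ ∈_) (assignments-domain is ch∈)
              (∈-resp-↭ (↭-sym (map⁺ proj₁ p)) (≡.subst (_ ∈_) (≡.sym (local-domain j r)) (∈-++⁺ˡ u∈))))))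

      contracted-diagonal : ∀ N → contracted N is ≈ ∏ is diagonalWeight * fromℕ (closedWalks N (arcs (map (_, nothing) is)))
      contracted-diagonal N = begin
        contracted N is
          ≈⟨ contracted≈ N is ⟩
        ∑ (choices is) f
          ≈⟨ ∑-assignments-restrict (λ c → proj₂ c ≢ nothing) is
               (λ {i} _ → map just (incidentEdges i) , ↭-refl , λ o∈ o≡ → just≢ (∈-map⁻ just o∈) o≡) vanish ⟩
        ∑ (assignments (λ _ → [ nothing ]) is) f
          ≈⟨ ∑-constant is f ⟩
        f (map (_, nothing) is)
          ≈⟨ *-congʳ (∏-map (_, nothing) is) ⟩
        ∏ is diagonalWeight * fromℕ (closedWalks N (arcs (map (_, nothing) is))) ∎
        where
        f : List Choice → Carrier
        f ch = values ch * fromℕ (closedWalks N (arcs ch))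
        just≢ : ∀ {o : Maybe E} {js : List E} → (∃[ j ] j ∈ js × o ≡ just j) → o ≢ nothing
        just≢ (_ , _ , refl) ()
        vanish : ∀ {ch} → ch ∈ choices is → Any (λ c → proj₂ c ≢ nothing) ch → f ch ≈ 0#
        vanish {ch} ch∈ bad with closedWalks N (arcs ch) ℕ.≟ 0
        ... | yes z = ≈-trans (*-congˡ (fromℕ-≡ z)) (zeroʳ _)
        ... | no c≢0 with _ , c∈ , o≢ ← find bad = ⊥-elim (o≢ (All.lookup (diagonalForm N ch∈ c≢0) c∈))
        ∑-constant : ∀ (xs : List V) (f : List Choice → Carrier) → ∑ (assignments (λ _ → [ nothing ]) xs) f ≈ f (map (_, nothing) xs)
        ∑-constant []       f = +-identityʳ _
        ∑-constant (x ∷ xs) f = ≈-trans (∑-assignments-∷ (λ _ → [ nothing ]) x xs)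
          (≈-trans (+-identityʳ _) (∑-constant xs (λ ch → f ((x , nothing) ∷ ch))))

    arcs-diagonal : ∀ {l} (φ : Fin l → V) ps → arcs (map (_, nothing) (map φ ps)) ≡ relabel φ (concatMap (loops (k ∸ 1)) ps)
    arcs-diagonal φ []       = refl
    arcs-diagonal φ (p ∷ ps) = ≡.trans (≡.cong₂ _++_ (≡.sym (List.map-replicate _ (k ∸ 1) (p , p))) (arcs-diagonal φ ps))
      (≡.sym (List.map-++ _ (loops (k ∸ 1) p) _))

    module _ {D : ℕ} (0<D : 0 ℕ.< D) (D<2k : D ℕ.< k ℕ.+ k) where

      N = D ℕ.* (k ∸ 1)

      0<N : 0 ℕ.< N
      0<N = ℕ.*-mono-≤ 0<D (ℕ.∸-monoˡ-≤ 1 2≤k)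

      term : Vec ℕ n → Carrier
      term d = weight k T Vs (Vec.lookup d) * contracted N (expansion (Vec.lookup d))

      term-diagonal : ∀ v → term (content (replicate D v)) ≈ diagonalConstant D * diagonalPower D (degree H v)
      term-diagonal v = begin
        weight k T Vs (Vec.lookup (content (replicate D v))) * contracted N is
          ≈⟨ *-cong (weight-content φ φ-inj ps (↭-reflexive (≡.sym map-ps)))
               (contracted-diagonal all≡ (ℕ.<-≤-trans 0<D (ℕ.≤-reflexive (≡.sym len))) (ℕ.≤-<-trans (ℕ.≤-reflexive len) D<2k) N) ⟩
        contentWeight ps * (∏ is diagonalWeight * fromℕ (closedWalks N (arcs (map (_, nothing) is))))
          ≈⟨ *-congˡ (*-cong power≈ (fromℕ-≡ count≡)) ⟩
        contentWeight ps * (diagonalPower D (degree H v) * fromℕ (diagonalCount N D))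
          ≈⟨ ≈-trans (*-congˡ (*-comm _ _)) (≈-sym (*-assoc _ _ _)) ⟩
        diagonalConstant D * diagonalPower D (degree H v) ∎
        where
        ps = replicate D (zero {0})
        φ : Fin 1 → V
        φ _ = v
        φ-inj : Injective _≡_ _≡_ φ
        φ-inj {zero} {zero} _ = refl
        map-ps : map φ ps ≡ replicate D v
        map-ps = List.map-replicate φ D zero
        is = expansion (Vec.lookup (content (replicate D v)))
        is↭ : is ↭ replicate D v
        is↭ = expansion-content (replicate D v)
        len : length is ≡ D
        len = ≡.trans (↭-length is↭) (List.length-replicate D)
        all≡ : All (_≡ v) is
        all≡ = All-resp-↭ (↭-sym is↭) (All.replicate⁺ D refl)
        power≈ : ∏ is diagonalWeight ≈ diagonalPower D (degree H v)
        power≈ = begin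
          ∏ is diagonalWeight               ≈⟨ ∏-↭ is↭ ⟩
          ∏ (replicate D v) diagonalWeight  ≈⟨ ∏-map (degree H) (replicate D v) ⟨
          ∏ (map (degree H) (replicate D v)) (λ d → α * fromℕ d)  ≡⟨ ≡.cong (λ ds → ∏ ds (λ d → α * fromℕ d)) (List.map-replicate (degree H) D v) ⟩
          diagonalPower D (degree H v)      ∎
        count≡ : closedWalks N (arcs (map (_, nothing) is)) ≡ diagonalCount N D
        count≡ = ≡.trans (closedWalks-↭ N (arcs-↭ (map⁺ (_, nothing) (trans is↭ (↭-reflexive (≡.sym map-ps))))))
          (≡.trans (≡.cong (closedWalks N) (arcs-diagonal φ ps)) (closedWalks-relabel φ φ-inj 0<N (concatMap (loops (k ∸ 1)) ps)))

      term-local : ∀ {j φ} → Frame j φ → ∀ rs {xs} → k ℕ.+ length rs ≡ D → xs ≡ map φ rs →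
        term (content (vertices j ++ xs)) ≈ localConstant D rs * ∏ rs (λ p → diagonalWeight (φ p))
      term-local {j} {φ} frame rs len refl = begin
        weight k T Vs (Vec.lookup (content (vertices j ++ map φ rs))) * contracted N is
          ≈⟨ *-cong (weight-content φ (Frame.injective frame) (allFin k ++ rs) ys↭)
               (contracted-local frame 0<N rs (trans is↭ ys↭) (ℕ.≤-<-trans (ℕ.≤-reflexive is-len) D<2k)) ⟩
        contentWeight (allFin k ++ rs) * (∏ (allFin k) (λ _ → 1# - α) * ∏ rs (λ p → diagonalWeight (φ p)) * fromℕ (modelCount N (allFin k ++ rs)))
          ≈⟨ ≈-trans (*-congˡ (≈-trans (*-assoc _ _ _) (≈-trans (*-congˡ (*-comm _ _)) (≈-sym (*-assoc _ _ _))))) (≈-sym (*-assoc _ _ _)) ⟩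
        localConstant D rs * ∏ rs (λ p → diagonalWeight (φ p)) ∎
        where
        ys↭ : vertices j ++ map φ rs ↭ map φ (allFin k ++ rs)
        ys↭ = trans (++⁺ʳ (map φ rs) (↭-sym (Frame.image frame))) (↭-reflexive (≡.sym (List.map-++ φ (allFin k) rs)))
        is = expansion (Vec.lookup (content (vertices j ++ map φ rs)))
        is↭ : is ↭ vertices j ++ map φ rs
        is↭ = expansion-content (vertices j ++ map φ rs)
        is-len : length is ≡ D
        is-len = ≡.trans (↭-length is↭) (≡.trans (List.length-++ (vertices j))
          (≡.trans (≡.cong₂ ℕ._+_ (length-vertices j) (List.length-map φ rs)) len))

      -- RL lists the multisets of size D - k, each once.
      module _ (RL : List (List V)) (RL-unique : Unique RL)
        (RL-sound : ∀ {r} → r ∈ RL → k ℕ.+ length r ≡ D)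
        (RL-canonical : ∀ {r r′} → r ∈ RL → r′ ∈ RL → r ↭ r′ → r ≡ r′)
        (RL-complete : ∀ r → k ℕ.+ length r ≡ D → ∃[ r′ ] r′ ∈ RL × r ↭ r′) where

        within? : ∀ (x : E × List V) → Dec (All (_∈ᵉ proj₁ x) (proj₂ x))
        within? (j , r) = All.all? (_∈ᵉ? j) r

        localIndices : List (E × List V)
        localIndices = filter within? (cartesianProduct Es RL)

        diagonalContents localContents : List (Vec ℕ n)
        diagonalContents = map (λ v → content (replicate D v)) Vs
        localContents    = map (λ (j , r) → content (vertices j ++ r)) localIndices

        RL∋ : ∀ {j r} → (j , r) ∈ localIndices → r ∈ RL × All (_∈ᵉ j) r
        RL∋ {j} {r} jr∈ with jr∈′ , r⊆ ← ∈-filter⁻ within? {xs = cartesianProduct Es RL} jr∈ =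
          proj₂ (∈-cartesianProduct⁻ Es RL jr∈′) , r⊆

        replicate-∈ : ∀ {u v : V} q → u ∈ replicate q v → u ≡ v
        replicate-∈ (suc q) (here u≡v) = u≡v
        replicate-∈ (suc q) (there u∈) = replicate-∈ q u∈

        ∈-replicate : ∀ {v : V} {q} → 0 ℕ.< q → v ∈ replicate q v
        ∈-replicate {q = suc q} _ = here refl

        -- No composition is met twice: a local content determines its hyperedge and its canonical
        -- r, and a diagonal content repeats a single vertex.
        contents-unique : Unique (diagonalContents ++ localContents)
        contents-unique = Unique.++⁺
          (unique-map-on _ (λ {u} _ _ eq → replicate-∈ D (∈-resp-↭ (content≡⇒↭ eq) (∈-replicate 0<D))) (Unique.allFin⁺ n))
          (unique-map-on _ injective (Unique.filter⁺ within? (Unique.cartesianProduct⁺ (Unique.allFin⁺ (size H)) RL-unique)))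
          disjoint
          where
          injective : ∀ {x y} → x ∈ localIndices → y ∈ localIndices →
            content (vertices (proj₁ x) ++ proj₂ x) ≡ content (vertices (proj₁ y) ++ proj₂ y) → x ≡ y
          injective {j , r} {j′ , r′} x∈ y∈ eq
            with refl ← sameEdge (proj₂ (RL∋ x∈)) (proj₂ (RL∋ y∈)) (content≡⇒↭ eq)
            = ≡.cong (j ,_) (RL-canonical (proj₁ (RL∋ x∈)) (proj₁ (RL∋ y∈)) (++-cancelˡ-↭ (vertices j) (content≡⇒↭ eq)))
          disjoint : ∀ {d} → ¬ (d ∈ diagonalContents × d ∈ localContents)
          disjoint (d∈ , d∈′) with v , _ , refl ← ∈-map⁻ _ d∈ with (j , r) , _ , eq ← ∈-map⁻ _ d∈′ =
            notConstant {j} {v} (λ u∈ → replicate-∈ D (∈-resp-↭ (content≡⇒↭ (≡.sym eq)) (∈-++⁺ˡ u∈)))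

        contents-sound : ∀ {d} → d ∈ diagonalContents ++ localContents → d ∈ compositions n D
        contents-sound d∈ with ∈-++⁻ diagonalContents d∈
        ... | inj₁ d∈′ with v , _ , refl ← ∈-map⁻ _ d∈′ =
          ∈-compositions⁺ _ (≡.trans (sum-content (replicate D v)) (List.length-replicate D))
        ... | inj₂ d∈′ with (j , r) , jr∈ , refl ← ∈-map⁻ _ d∈′ =
          ∈-compositions⁺ _ (≡.trans (sum-content (vertices j ++ r)) (≡.trans (List.length-++ (vertices j))
            (≡.trans (≡.cong (ℕ._+ length r) (length-vertices j)) (RL-sound (proj₁ (RL∋ jr∈))))))

        -- A nonzero count in the term yields a choice with a closed walk, and the shape of that
        -- choice exhibits d as one of the listed contents.
        term-vanishes : ∀ {d} → d ∈ compositions n D → d ∉ diagonalContents ++ localContents → term d ≈ 0#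
        term-vanishes {d} d∈ d∉ = ≈-trans (*-congˡ (≈-trans (contracted≈ N is) (∑-0 (choices is) vanish))) (zeroʳ _)
          where
          is = expansion (Vec.lookup d)
          len : length is ≡ D
          len = ≡.trans (length-expansion d) (∈-compositions⁻ d d∈)
          domains : ∀ {ch j r} → ch ∈ choices is → ch ↭ map (_, just j) (vertices j) ++ map (_, nothing) r → is ↭ vertices j ++ r
          domains {j = j} {r} ch∈ p = trans (↭-reflexive (≡.sym (assignments-domain is ch∈))) (trans (map⁺ proj₁ p) (↭-reflexive (local-domain j r)))
          listed : ∀ {ch} → ch ∈ choices is → Shape ch → d ∈ diagonalContents ++ localContents
          listed {ch} ch∈ (diagonal v all) = ∈-++⁺ˡ (≡.subst (_∈ diagonalContents) d≡ (∈-map⁺ _ (∈-allFin v)))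
            where
            is-replicate : ∀ (xs : List V) → All (_≡ v) xs → xs ≡ replicate (length xs) v
            is-replicate []       []         = refl
            is-replicate (x ∷ xs) (refl ∷ a) = ≡.cong (x ∷_) (is-replicate xs a)
            is≡ : is ≡ replicate D v
            is≡ = ≡.trans (is-replicate is (≡.subst (All (_≡ v)) (assignments-domain is ch∈) (All.map⁺ (All.map (≡.cong proj₁) all))))
              (≡.cong (λ q → replicate q v) len)
            d≡ : content (replicate D v) ≡ d
            d≡ = ≡.trans (≡.cong content (≡.sym is≡)) (content-expansion d)
          listed {ch} ch∈ (local j r r⊆ p)
            with r′ , r′∈ , q ← RL-complete r (≡.trans (≡.cong (ℕ._+ length r) (≡.sym (length-vertices j)))
                   (≡.trans (≡.sym (List.length-++ (vertices j))) (≡.trans (≡.sym (↭-length (domains ch∈ p))) len)))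
            = ∈-++⁺ʳ diagonalContents (≡.subst (_∈ localContents)
                (≡.trans (content-↭ (↭-sym (trans (domains ch∈ p) (++⁺ˡ (vertices j) q)))) (content-expansion d))
                (∈-map⁺ (λ (j , r) → content (vertices j ++ r)) (∈-filter⁺ within? (∈-cartesianProduct⁺ (∈-allFin j) r′∈) (All-resp-↭ q r⊆))))
          vanish : ∀ {ch} → ch ∈ choices is → values ch * fromℕ (closedWalks N (arcs ch)) ≈ 0#
          vanish {ch} ch∈ with closedWalks N (arcs ch) ℕ.≟ 0
          ... | yes z  = ≈-trans (*-congˡ (fromℕ-≡ z)) (zeroʳ _)
          ... | no c≢0 = ⊥-elim (d∉ (listed ch∈ (choices-shape N is
            (ℕ.<-≤-trans 0<D (ℕ.≤-reflexive (≡.sym len))) (ℕ.≤-<-trans (ℕ.≤-reflexive len) D<2k) ch∈ c≢0)))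

        ∑-terms : ∑ (compositions n D) term ≈
          diagonalConstant D * ∑ Vs (λ v → diagonalPower D (degree H v)) +
          ∑ Es (λ j → ∑ RL (λ r → [ within? (j , r) ]· (term (content (vertices j ++ r)))))
        ∑-terms = begin
          ∑ (compositions n D) term
            ≈⟨ ∑-support contents-unique (compositions-unique n D) contents-sound term-vanishes ⟩
          ∑ (diagonalContents ++ localContents) term
            ≈⟨ ∑-++ diagonalContents localContents ⟩
          ∑ diagonalContents term + ∑ localContents term
            ≈⟨ +-cong (≈-trans (∑-map _ Vs) (≈-trans (∑-cong Vs term-diagonal) (≈-sym (∑-*ˡ Vs (diagonalConstant D)))))
                 (≈-trans (∑-map _ localIndices) (≈-trans (∑-filter within? (cartesianProduct Es RL)) (∑-cartesianProductWith _,_ Es RL))) ⟩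
          diagonalConstant D * ∑ Vs (λ v → diagonalPower D (degree H v)) +
            ∑ Es (λ j → ∑ RL (λ r → [ within? (j , r) ]· (term (content (vertices j ++ r))))) ∎

-- The hyperpath is a hypertree with degrees and excesses at most 2

module HyperpathStructure where

  open import Data.Nat.Base using (_+_; _*_; _≤_; _<_; _/_; _%_)
  open import Data.Fin.Base using (fromℕ)
  open ListCombinatorics
  open WalkCounting
  open HypertreeGrowth
  open HyperpathRecognition

  open ∑ℕ using (∑; [_]·)

  argmax : ∀ {n} (f : Fin (suc n) → ℕ) → ∃[ i ] ∀ j → f j ≤ f i
  argmax {zero}  f = zero , λ { zero → ℕ.≤-refl }
  argmax {suc n} f with i , max ← argmax (f ∘ suc) with ℕ.≤-total (f zero) (f (suc i))
  ... | inj₁ le = suc i , λ { zero → le ; (suc j) → max j }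
  ... | inj₂ ge = zero  , λ { zero → ℕ.≤-refl ; (suc j) → ℕ.≤-trans (max j) ge }

  module _ {N : ℕ} where

    next : Fin (2 + N) → Fin (2 + N)
    next i = suc (toℕ i) mod (2 + N)

    toℕ-next : ∀ i → toℕ (next i) ≡ suc (toℕ i) % (2 + N)
    toℕ-next i = Fin.toℕ-fromℕ< (m%n<n (suc (toℕ i)) (2 + N))

    next-< : ∀ i → suc (toℕ i) < 2 + N → toℕ (next i) ≡ suc (toℕ i)
    next-< i lt = ≡.trans (toℕ-next i) (m<n⇒m%n≡m lt)

    next-last : ∀ i → suc (toℕ i) ≡ 2 + N → toℕ (next i) ≡ 0
    next-last i eq = ≡.trans (toℕ-next i) (≡.trans (≡.cong (_% (2 + N)) eq) (n%n≡0 (2 + N)))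

    next≢ : ∀ i → next i ≢ i
    next≢ i eq with suc (toℕ i) ℕ.<? 2 + N
    ... | yes lt = ℕ.1+n≢n (≡.trans (≡.sym (next-< i lt)) (≡.cong toℕ eq))
    ... | no ≮ with last ← ℕ.≤-antisym (Fin.toℕ<n i) (ℕ.≮⇒≥ ≮) =
      ℕ.0≢1+n (≡.trans (≡.sym (next-last i last)) (≡.trans (≡.cong toℕ eq) (ℕ.suc-injective last)))

    previous : ∀ i → ∃[ h ] next h ≡ i
    previous zero    = fromℕ (suc N) , Fin.toℕ-injective (next-last (fromℕ (suc N)) (≡.cong suc (Fin.toℕ-fromℕ (suc N))))
    previous (suc i) = inject₁ i , Fin.toℕ-injective (≡.trans
      (next-< (inject₁ i) (ℕ.≤-trans (ℕ.≤-reflexive (≡.cong (2 +_) (Fin.toℕ-inject₁ i))) (s≤s (Fin.toℕ<n i))))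
      (≡.cong suc (Fin.toℕ-inject₁ i)))

  module Hyperpath {k : ℕ} (2≤k : 2 ≤ k) (m : ℕ) where

    H : Hypergraph
    H = hyperpath k m

    open Incidence H

    s : ℕ
    s = spacing k

    <block : ∀ i → i < suc (i / s) * s
    <block i = ℕ.≤-<-trans (ℕ.≤-reflexive (m≡m%n+[m/n]*n i s)) (ℕ.+-monoˡ-< (i / s * s) (m%n<n i s))

    toBetween : ∀ {v j} → v ∈ᵉ j → Between k (toℕ j) (toℕ v)
    toBetween {v} {j} = ∈-interval⁻ {k} {m} {j} {v}

    fromBetween : ∀ {v j} → Between k (toℕ j) (toℕ v) → v ∈ᵉ j
    fromBetween {v} {j} = ∈-interval⁺ {k} {m} {j} {v}

    vertex : ∀ i → i ≤ m * s → V
    vertex i i≤ = fromℕ< (s≤s i≤)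

    toℕ-vertex : ∀ i (i≤ : i ≤ m * s) → toℕ (vertex i i≤) ≡ i
    toℕ-vertex i i≤ = Fin.toℕ-fromℕ< (s≤s i≤)

    uniform : Uniform k H
    uniform j = ≡.trans (≡.sym (length-members (edge H j)))
      (≡.trans (↭-length (unique-⇔⇒↭ (members-unique (edge H j)) (Unique.map⁺ φ-injective (Unique.allFin⁺ (suc s))) to from))
        (≡.trans (List.length-map φ (allFin (suc s))) (≡.trans (List.length-tabulate {n = suc s} (λ i → i)) (ℕ.m+[n∸m]≡n 2≤k))))
      where
      bound : ∀ (p : Fin (suc s)) → toℕ j * s + toℕ p ≤ m * s
      bound p = ℕ.≤-trans (ℕ.≤-trans (ℕ.+-monoʳ-≤ (toℕ j * s) (ℕ.≤-pred (Fin.toℕ<n p))) (ℕ.≤-reflexive (ℕ.+-comm (toℕ j * s) s)))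
        (ℕ.*-monoˡ-≤ s (Fin.toℕ<n j))
      φ : Fin (suc s) → V
      φ p = vertex (toℕ j * s + toℕ p) (bound p)
      toℕ-φ : ∀ p → toℕ (φ p) ≡ toℕ j * s + toℕ p
      toℕ-φ p = toℕ-vertex _ (bound p)
      φ-injective : ∀ {p q} → φ p ≡ φ q → p ≡ q
      φ-injective {p} {q} eq = Fin.toℕ-injective (ℕ.+-cancelˡ-≡ (toℕ j * s) _ _
        (≡.trans (≡.sym (toℕ-φ p)) (≡.trans (≡.cong toℕ eq) (toℕ-φ q))))
      to : ∀ {v} → v ∈ members (edge H j) → v ∈ map φ (allFin (suc s))
      to {v} v∈ with lo , hi ← toBetween {v} {j} (∈-members⁻ (edge H j) v∈) =
        ≡.subst (_∈ map φ (allFin (suc s))) (Fin.toℕ-injective (≡.trans (toℕ-φ p) (≡.trans (≡.cong (toℕ j * s +_) toℕ-p) (ℕ.m+[n∸m]≡n lo))))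
          (∈-map⁺ φ (∈-allFin p))
        where
        lt : toℕ v ∸ toℕ j * s < suc s
        lt = s≤s (ℕ.≤-trans (ℕ.∸-monoˡ-≤ (toℕ j * s) hi) (ℕ.≤-reflexive (ℕ.m+n∸n≡m s (toℕ j * s))))
        p : Fin (suc s)
        p = fromℕ< lt
        toℕ-p : toℕ p ≡ toℕ v ∸ toℕ j * s
        toℕ-p = Fin.toℕ-fromℕ< lt
      from : ∀ {v} → v ∈ map φ (allFin (suc s)) → v ∈ members (edge H j)
      from v∈ with p , _ , refl ← ∈-map⁻ φ v∈ = ∈-members⁺ (edge H j) (fromBetween {φ p} {j}
        ( ℕ.≤-trans (ℕ.m≤m+n (toℕ j * s) (toℕ p)) (ℕ.≤-reflexive (≡.sym (toℕ-φ p)))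
        , ℕ.≤-trans (ℕ.≤-reflexive (toℕ-φ p)) (ℕ.≤-trans (ℕ.+-monoʳ-≤ (toℕ j * s) (ℕ.≤-pred (Fin.toℕ<n p)))
            (ℕ.≤-reflexive (ℕ.+-comm (toℕ j * s) s)))))

    -- The hyperedge with number i / s starts at or before i and ends after i, so it contains both
    -- positions.
    consecutive : ∀ i (lt : suc i ≤ m * s) → ∃[ j ] vertex i (ℕ.<⇒≤ lt) ∈ᵉ j × vertex (suc i) lt ∈ᵉ j
    consecutive i lt = j , fromBetween {vertex i (ℕ.<⇒≤ lt)} {j} (between-i lower (ℕ.<⇒≤ upper) (toℕ-vertex i (ℕ.<⇒≤ lt)))
                         , fromBetween {vertex (suc i) lt} {j} (between-i (ℕ.m≤n⇒m≤1+n lower) upper (toℕ-vertex (suc i) lt))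
      where
      j<m : i / s < m
      j<m = m<n*o⇒m/o<n lt
      j : E
      j = fromℕ< j<m
      toℕ-j : toℕ j ≡ i / s
      toℕ-j = Fin.toℕ-fromℕ< j<m
      lower : i / s * s ≤ i
      lower = m/n*n≤m i s
      upper : i < suc (i / s) * s
      upper = <block i
      between-i : ∀ {a b} → i / s * s ≤ a → a ≤ suc (i / s) * s → b ≡ a → Between k (toℕ j) b
      between-i lo hi refl rewrite toℕ-j = lo , hi

    upward : ∀ i (i≤ : i ≤ m * s) → Star (Adjacent H) zero (vertex i i≤)
    upward zero    i≤ = ε
    upward (suc i) i≤ with j , u∈ , v∈ ← consecutive i i≤ = upward i (ℕ.<⇒≤ i≤) ◅◅ ((j , u∈ , v∈) ◅ ε)

    downward : ∀ i (i≤ : i ≤ m * s) → Star (Adjacent H) (vertex i i≤) zero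
    downward zero    i≤ = ε
    downward (suc i) i≤ with j , u∈ , v∈ ← consecutive i i≤ = (j , v∈ , u∈) ◅ downward i (ℕ.<⇒≤ i≤)

    connected : Connected H
    connected u v = ≡.subst (λ u → Star (Adjacent H) u zero) (vertex-toℕ u) (downward (toℕ u) (ℕ.≤-pred (Fin.toℕ<n u)))
      ◅◅ ≡.subst (Star (Adjacent H) zero) (vertex-toℕ v) (upward (toℕ v) (ℕ.≤-pred (Fin.toℕ<n v)))
      where
      vertex-toℕ : ∀ u → vertex (toℕ u) (ℕ.≤-pred (Fin.toℕ<n u)) ≡ u
      vertex-toℕ u = Fin.toℕ-injective (toℕ-vertex (toℕ u) (ℕ.≤-pred (Fin.toℕ<n u)))

    -- The upper end of interval i is at most the lower end of interval j, so v is squeezed onto the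
    -- latter.
    meet : ∀ {v i j} → v ∈ᵉ i → v ∈ᵉ j → toℕ i < toℕ j → toℕ v ≡ toℕ j * s
    meet {v} {i} {j} v∈i v∈j i<j = ℕ.≤-antisym
      (ℕ.≤-trans (proj₂ (toBetween {v} {i} v∈i)) (ℕ.*-monoˡ-≤ s i<j)) (proj₁ (toBetween {v} {j} v∈j))

    -- The last hyperedge of a cycle meets all other ones in one vertex only.
    acyclic : ¬ Cycle H
    -- Writing the maximal index as `next h` gives access to the hyperedge before it. Both cycle
    -- vertices in the maximal hyperedge are shared with neighbours of smaller number, hence both
    -- are its left end.
    acyclic C with i , max ← argmax (λ i → toℕ (Cycle.e C i)) with h , refl ← previous i =
      next≢ (next h) (v-distinct (Fin.toℕ-injective (≡.trans leaving (≡.sym entering))))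
      where
      open Cycle C
      below : ∀ {i j} → (∀ i → toℕ (e i) ≤ toℕ (e j)) → i ≢ j → toℕ (e i) < toℕ (e j)
      below {i} max i≢j = ℕ.≤∧≢⇒< (max i) (λ eq → i≢j (e-distinct (Fin.toℕ-injective eq)))
      entering : toℕ (v (next h)) ≡ toℕ (e (next h)) * s
      entering = meet {j = e (next h)} (next∈e h) (v∈e (next h)) (below max (λ eq → next≢ h (≡.sym eq)))
      leaving : toℕ (v (next (next h))) ≡ toℕ (e (next h)) * s
      leaving = meet {j = e (next h)} (v∈e (next (next h))) (next∈e (next h)) (below max (next≢ (next h)))

    incidentEdges : V → List E
    incidentEdges v = filter (v ∈ᵉ?_) (allFin m)

    -- Only the hyperedges numbered q = v / s and q - 1 can contain v. For q = 0 the truncated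
    -- `pred` repeats q, which is harmless in an upper bound.
    degree≤2 : ∀ v → degree H v ≤ 2
    degree≤2 v = ℕ.≤-trans (ℕ.≤-reflexive (≡.sym (List.length-map toℕ (incidentEdges v))))
      (unique-⊆⇒length≤ {xs = q ∷ pred q ∷ []}
        (Unique.map⁺ Fin.toℕ-injective (Unique.filter⁺ (v ∈ᵉ?_) (Unique.allFin⁺ m))) sub)
      where
      q = toℕ v / s
      near : ∀ {j} → j * s ≤ toℕ v → toℕ v ≤ suc j * s → j ≡ q ⊎ j ≡ pred q
      near {j} lo hi with ℕ.m≤n⇒m<n∨m≡n (ℕ.≤-pred (ℕ.*-cancelʳ-< s j (suc q) (ℕ.≤-<-trans lo (<block (toℕ v)))))
      ... | inj₂ j≡q = inj₁ j≡q
      ... | inj₁ j<q = inj₂ (≡.cong pred (ℕ.≤-antisym j<q (ℕ.*-cancelʳ-≤ q (suc j) s (ℕ.≤-trans (m/n*n≤m (toℕ v) s) hi))))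
      sub : ∀ {a} → a ∈ map toℕ (incidentEdges v) → a ∈ q ∷ pred q ∷ []
      sub a∈ with j , j∈ , refl ← ∈-map⁻ toℕ a∈
        with lo , hi ← toBetween {v} {j} (proj₂ (∈-filter⁻ (v ∈ᵉ?_) {xs = allFin m} j∈)) with near lo hi
      ... | inj₁ j≡ = here j≡
      ... | inj₂ j≡ = there (here j≡)

    joint-position : ∀ {v j} → v ∈ᵉ j → 2 ≤ degree H v → toℕ v ≡ toℕ j * s ⊎ toℕ v ≡ suc (toℕ j) * s
    joint-position {v} {j} v∈ 2≤d with Fin.any? (λ j′ → ¬? (j′ Fin.≟ j) ×-dec (v ∈ᵉ? j′))
    ... | no none = ⊥-elim (ℕ.<⇒≱ 2≤d (unique-⊆⇒length≤ {xs = [ j ]} (Unique.filter⁺ (v ∈ᵉ?_) (Unique.allFin⁺ m))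
      (λ {j′} j′∈ → here (decidable-stable (j′ Fin.≟ j) (λ j′≢j → none (j′ , j′≢j , proj₂ (∈-filter⁻ (v ∈ᵉ?_) {xs = allFin m} j′∈)))))))
    ... | yes (j′ , j′≢j , v∈′) with ℕ.<-cmp (toℕ j′) (toℕ j)
    ...   | tri< lt _ _ = inj₁ (meet v∈′ v∈ lt)
    ...   | tri≈ _ eq _ = ⊥-elim (j′≢j (Fin.toℕ-injective eq))
    ...   | tri> _ _ gt = inj₂ (ℕ.≤-antisym (proj₂ (toBetween {v} {j} v∈))
      (ℕ.≤-trans (ℕ.*-monoˡ-≤ s gt) (ℕ.≤-reflexive (≡.sym (meet v∈ v∈′ gt)))))

    -- Each joint counts at most 1, and by `joint-position` joints occupy only the two ends of the
    -- interval.
    excess≤2 : ∀ j → excess H j ≤ 2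
    excess≤2 j = ℕ.≤-trans (∑-mono-≤ (vertices j) (λ v → bounded v (joint? v))) (ℕ.≤-trans (ℕ.≤-reflexive
      (≡.trans (≡.sym (∑ℕ.∑-filter joint? (vertices j))) (∑-const-1 joints)))
      (ℕ.≤-trans (ℕ.≤-reflexive (≡.sym (List.length-map toℕ joints)))
        (unique-⊆⇒length≤ {xs = toℕ j * s ∷ suc (toℕ j) * s ∷ []}
          (Unique.map⁺ Fin.toℕ-injective (Unique.filter⁺ joint? (members-unique (edge H j)))) sub)))
      where
      joint? : ∀ v → Dec (2 ≤ degree H v)
      joint? v = 2 ℕ.≤? degree H v
      joints = filter joint? (vertices j)
      bounded : ∀ v (d : Dec (2 ≤ degree H v)) → degree H v ∸ 1 ≤ [ d ]· 1
      bounded v (yes _) = ℕ.∸-monoˡ-≤ 1 (degree≤2 v)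
      bounded v (no ≱2) = ℕ.≤-reflexive (ℕ.m≤n⇒m∸n≡0 (ℕ.≤-pred (ℕ.≰⇒> ≱2)))
      sub : ∀ {a} → a ∈ map toℕ joints → a ∈ toℕ j * s ∷ suc (toℕ j) * s ∷ []
      sub a∈ with v , v∈ , refl ← ∈-map⁻ toℕ a∈
        with v∈j , 2≤d ← ∈-filter⁻ joint? v∈ with joint-position {v} {j} (∈-members⁻ (edge H j) v∈j) 2≤d
      ... | inj₁ eq = here eq
      ... | inj₂ eq = there (here eq)

-- Trace formulas up to index k + 2 and the signs of their constants

module TraceEvaluation where

  open ListCombinatorics
  open WalkCounting
  open TracePairing
  open HypertreeGrowth
  open BalancedChoices
  open TensorContraction
  open LocalContributions
  open CompositionReindexing

  module _ {n : ℕ} where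

    completeArcs : List (Fin n) → List (Arc n)
    completeArcs ℓ = concatMap (λ p → map (p ,_) (filter (λ q → ¬? (q Fin.≟ p)) ℓ)) ℓ

    detours : Fin n → List (Fin n) → List (Arc n)
    detours x = concatMap (λ z → (x , z) ∷ (z , x) ∷ [])

    -- An Euler tour of the complete digraph.
    tour : List (Fin n) → List (Arc n)
    tour []           = []
    tour (x ∷ [])     = []
    tour (x ∷ y ∷ ys) = (x , y) ∷ tour (y ∷ ys) ++ (y , x) ∷ detours x ys

    IsWalk-detours : ∀ x zs → IsWalk (detours x zs) x x
    IsWalk-detours x []       = []
    IsWalk-detours x (z ∷ zs) = step (step (IsWalk-detours x zs))

    IsWalk-tour : ∀ x xs → IsWalk (tour (x ∷ xs)) x x
    IsWalk-tour x []       = []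
    IsWalk-tour x (y ∷ ys) = step (IsWalk-++ (IsWalk-tour y ys) (step (IsWalk-detours x ys)))

    detours-↭ : ∀ x zs → detours x zs ↭ map (x ,_) zs ++ map (_, x) zs
    detours-↭ x []       = ↭-refl
    detours-↭ x (z ∷ zs) = prep (x , z) (trans (prep (z , x) (detours-↭ x zs))
      (↭-sym (shift (z , x) (map (x ,_) zs) (map (_, x) zs))))

    completeArcs-∷ : ∀ {x xs} → Unique (x ∷ xs) →
      completeArcs (x ∷ xs) ↭ (map (x ,_) xs ++ map (_, x) xs) ++ completeArcs xs
    completeArcs-∷ {x} {xs} (x∉ ∷ u) = trans (++⁺ (↭-reflexive (≡.cong (map (x ,_)) own)) (others xs x∉))
      (↭-reflexive (≡.sym (List.++-assoc (map (x ,_) xs) _ _)))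
      where
      own : filter (λ q → ¬? (q Fin.≟ x)) (x ∷ xs) ≡ xs
      own = ≡.trans (List.filter-reject (λ q → ¬? (q Fin.≟ x)) (λ x≢x → x≢x refl))
        (List.filter-all (λ q → ¬? (q Fin.≟ x)) (All.map (λ x≢q q≡x → x≢q (≡.sym q≡x)) x∉))
      others : ∀ ps → All (x ≢_) ps →
        concatMap (λ p → map (p ,_) (filter (λ q → ¬? (q Fin.≟ p)) (x ∷ xs))) ps ↭
        map (_, x) ps ++ concatMap (λ p → map (p ,_) (filter (λ q → ¬? (q Fin.≟ p)) xs)) ps
      others []       []         = ↭-refl
      others (p ∷ ps) (x≢p ∷ x∉) = trans
        (++⁺ (↭-reflexive (≡.cong (map (p ,_)) (List.filter-accept (λ q → ¬? (q Fin.≟ p)) {xs = xs} x≢p))) (others ps x∉))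
        (prep (p , x) (shifts (map (p ,_) (filter (λ q → ¬? (q Fin.≟ p)) xs)) (map (_, x) ps)))

    tour-↭ : ∀ xs → Unique xs → tour xs ↭ completeArcs xs
    tour-↭ []       u = ↭-refl
    tour-↭ (x ∷ []) u = ↭-sym (completeArcs-∷ u)
    tour-↭ (x ∷ y ∷ ys) u@(_ ∷ u′) = trans (prep (x , y) (trans (++-comm (tour (y ∷ ys)) _)
        (trans (prep (y , x) (++⁺ (detours-↭ x ys) (tour-↭ (y ∷ ys) u′)))
          (++⁺ʳ (completeArcs (y ∷ ys)) (↭-sym (shift (y , x) (map (x ,_) ys) (map (_, x) ys)))))))
      (↭-sym (completeArcs-∷ u))

  ∈-assignments : ∀ {A O : Set} {opts : A → List O} ch → All (λ (x , o) → o ∈ opts x) ch → ch ∈ assignments opts (map proj₁ ch)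
  ∈-assignments []             []        = here refl
  ∈-assignments ((x , o) ∷ ch) (o∈ ∷ all) = ∈-concatMap⁺ _ (lose o∈ (∈-map⁺ ((x , o) ∷_) (∈-assignments ch all)))

  module ConstantsPositive {c ℓ₁ ℓ₂ : Level} (F : OrderedField c ℓ₁ ℓ₂) (q : ℕ) (α : OrderedField.Carrier F)
    (α<1 : OrderedField._<_ F α (OrderedField.1# F)) where
    open OrderedFieldProperties F
    open ListProduct semiring

    k : ℕ
    k = suc (suc q)

    open Constants F k α
    open CompleteArcs k

    ∏-pos : ∀ {a} {A : Set a} (xs : List A) {f : A → Carrier} → (∀ x → 0# < f x) → 0# < ∏ xs f
    ∏-pos []       pos = 0<1
    ∏-pos (x ∷ xs) pos = *-pos (pos x) (∏-pos xs pos)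

    contentWeight-pos : ∀ {l} (ps : List (Fin l)) → 0# < contentWeight ps
    contentWeight-pos ps = ∏-pos (allFin _) (λ p → recip-pos ((count p ps ℕ.* (k ∸ 1)) !) {{(count p ps ℕ.* (k ∸ 1)) ℕ.!≢0}})

    fromℕ-pos′ : ∀ {a} → 0 ℕ.< a → 0# < fromℕ a
    fromℕ-pos′ {a} 0<a = fromℕ-pos a {{ℕ.>-nonZero 0<a}}

    diagonalConstant-pos : ∀ D → 0# < diagonalConstant D
    diagonalConstant-pos D = *-pos (contentWeight-pos (replicate D (zero {0}))) (fromℕ-pos′
      (≡.subst (λ N → 0 ℕ.< closedWalks N L) (len D) (IsWalk⇒closedWalks>0 ↭-refl (walk L))))
      where
      L : List (Arc 1)
      L = concatMap (loops (k ∸ 1)) (replicate D zero)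
      walk : ∀ (L : List (Arc 1)) → IsWalk L zero zero
      walk []                = []
      walk ((zero , zero) ∷ L) = step (walk L)
      len : ∀ D → length (concatMap (loops (k ∸ 1)) (replicate D (zero {0}))) ≡ D ℕ.* (k ∸ 1)
      len zero    = refl
      len (suc D) = ≡.trans (List.length-++ (loops (k ∸ 1) zero)) (≡.cong₂ ℕ._+_ (List.length-replicate (k ∸ 1)) (len D))

    -- One closed walk suffices. Choosing the hyperedge once at every vertex and the diagonal twice,
    -- at 0 and at 1, gives the arcs of the complete digraph with k - 1 loops at each of these two
    -- vertices: an Euler tour with loops inserted.
    modelCount-pos : 0 ℕ.< modelCount ((k ℕ.+ 2) ℕ.* (k ∸ 1)) (allFin k ++ zero ∷ suc zero ∷ [])
    modelCount-pos = ℕ.<-≤-trans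
      (≡.subst (λ N → 0 ℕ.< closedWalks N (modelArcs ch)) total-length (IsWalk⇒closedWalks>0 arranged (proj₂ (proj₂ second))))
      (∑ℕ.∑-≥ {f = λ ch → closedWalks ((k ℕ.+ 2) ℕ.* (k ∸ 1)) (modelArcs ch)} ch∈)
      where
      ch : List (Fin k × Bool)
      ch = map (_, true) (allFin k) ++ (zero , false) ∷ (suc zero , false) ∷ []
      domain : map proj₁ ch ≡ allFin k ++ zero ∷ suc zero ∷ []
      domain = ≡.trans (List.map-++ proj₁ (map (_, true) (allFin k)) _) (≡.cong (_++ zero ∷ suc zero ∷ [])
        (≡.trans (≡.sym (List.map-∘ (allFin k))) (List.map-id (allFin k))))
      ch∈ : ch ∈ assignments modelOptions (allFin k ++ zero ∷ suc zero ∷ [])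
      ch∈ = ≡.subst (λ ps → ch ∈ assignments modelOptions ps) domain (∈-assignments ch
        (All.++⁺ (All.map⁺ (All.universal (λ _ → there (here refl)) (allFin k))) (here refl ∷ here refl ∷ [])))
      K : List (Arc k)
      K = completeArcs (allFin k)
      modelArcs-complete : ∀ ps → modelArcs (map (_, true) ps) ≡ concatMap (λ p → map (p ,_) (rest p)) ps
      modelArcs-complete []       = refl
      modelArcs-complete (p ∷ ps) = ≡.cong (map (p ,_) (rest p) ++_) (modelArcs-complete ps)
      arcs↭ : modelArcs ch ↭ loops (k ∸ 1) zero ++ loops (k ∸ 1) (suc zero) ++ K
      arcs↭ = trans (modelArcs-↭ (++-comm (map (_, true) (allFin k)) ((zero , false) ∷ (suc zero , false) ∷ [])))
        (++⁺ˡ (loops (k ∸ 1) zero) (++⁺ˡ (loops (k ∸ 1) (suc zero)) (↭-reflexive (modelArcs-complete (allFin k)))))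
      K↭ : K ↭ tour (allFin k)
      K↭ = ↭-sym (tour-↭ (allFin k) (Unique.allFin⁺ k))
      first : ∃[ L ] loops (k ∸ 1) (suc zero) ++ tour (allFin k) ↭ L × IsWalk L zero zero
      -- The loops at vertex 1 go in front of an arc leaving it: the arc from 1 back to 0, which
      -- follows the inner tour.
      first = insert-loops (k ∸ 1) (IsWalk-tour zero _) (there (∈-++⁺ʳ (tour (suc zero ∷ _)) (here refl)))
      second : ∃[ L ] loops (k ∸ 1) zero ++ proj₁ first ↭ L × IsWalk L zero zero
      second = insert-loops (k ∸ 1) (proj₂ (proj₂ first))
        (∈-resp-↭ (proj₁ (proj₂ first)) (∈-++⁺ʳ (loops (k ∸ 1) (suc zero)) (here refl)))
      arranged : modelArcs ch ↭ proj₁ second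
      arranged = trans arcs↭ (trans (++⁺ˡ (loops (k ∸ 1) zero) (trans (++⁺ˡ (loops (k ∸ 1) (suc zero)) K↭) (proj₁ (proj₂ first))))
        (proj₁ (proj₂ second)))
      length-rest : ∀ p → length (rest p) ≡ k ∸ 1
      length-rest p = ℕ.suc-injective (≡.trans (≡.sym (↭-length split)) (List.length-tabulate {n = k} (λ i → i)))
        where
        split : allFin k ↭ p ∷ rest p
        split = unique-⇔⇒↭ (Unique.allFin⁺ k)
          (All.tabulate (λ q∈ p≡q → proj₂ (∈-filter⁻ (λ q → ¬? (q Fin.≟ p)) {xs = allFin k} q∈) (≡.sym p≡q))
            ∷ Unique.filter⁺ (λ q → ¬? (q Fin.≟ p)) (Unique.allFin⁺ k))
          (λ {q} _ → to q) (λ _ → ∈-allFin _)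
          where
          to : ∀ q → q ∈ p ∷ rest p
          to q with q Fin.≟ p
          ... | yes q≡p = here q≡p
          ... | no q≢p  = there (∈-filter⁺ (λ q → ¬? (q Fin.≟ p)) (∈-allFin q) q≢p)
      length-modelArcs : ∀ cs → length (modelArcs cs) ≡ length cs ℕ.* (k ∸ 1)
      length-modelArcs []             = refl
      length-modelArcs ((p , b) ∷ cs) = ≡.trans (List.length-++ (modelArcsOf (p , b))) (≡.cong₂ ℕ._+_ (one b) (length-modelArcs cs))
        where
        one : ∀ b → length (modelArcsOf (p , b)) ≡ k ∸ 1
        one false = List.length-replicate (k ∸ 1)
        one true  = ≡.trans (List.length-map (p ,_) (rest p)) (length-rest p)
      total-length : length (modelArcs ch) ≡ (k ℕ.+ 2) ℕ.* (k ∸ 1)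
      total-length = ≡.trans (length-modelArcs ch) (≡.cong (ℕ._* (k ∸ 1)) (≡.trans (List.length-++ (map (_, true) (allFin k)))
        (≡.cong (ℕ._+ 2) (≡.trans (List.length-map (_, true) (allFin k)) (List.length-tabulate {n = k} (λ i → i))))))

    -- This constant multiplies `pairSum`, the quantity that decides at index k + 2. The constant
    -- for a repeated extra row multiplies `squareSum`, which agrees on both sides of that
    -- comparison.
    localConstant-pos : 0# < localConstant (k ℕ.+ 2) (zero ∷ suc zero ∷ [])
    localConstant-pos = *-pos (contentWeight-pos (allFin k ++ zero ∷ suc zero ∷ []))
      (*-pos (∏-pos (allFin k) (λ _ → sub-pos α<1)) (fromℕ-pos′ modelCount-pos))

  module TraceFormulas {c ℓ₁ ℓ₂ : Level} (F : OrderedField c ℓ₁ ℓ₂) (q : ℕ) (α : OrderedField.Carrier F)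
    (H : Hypergraph) (uniform : Uniform (3 ℕ.+ q) H) (connected : Connected H) (acyclic : ¬ Cycle H) (1≤m : 1 ℕ.≤ size H) where
    open OrderedFieldProperties F
    open Spectral F
    open ListSum semiring
    open ListProduct semiring

    k : ℕ
    k = 3 ℕ.+ q

    2≤k : 2 ℕ.≤ k
    2≤k = s≤s (s≤s z≤n)

    open Constants F k α
    open Incidence H
    open Evaluation F H 2≤k uniform connected acyclic 1≤m α using (Frame; diagonalWeight)
    open UniformHypertrees H (ℕ.<⇒≤ 2≤k) uniform connected acyclic using (length-vertices)
    open Reindexing F H 2≤k uniform connected acyclic 1≤m α using (term; term-local; ∑-terms)
    open import Relation.Binary.Reasoning.Setoid (CommutativeRing.setoid commutativeRing)
    open PolynomialPairing F using (Tr≈)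
    open import Algebra.Properties.CommutativeSemigroup (CommutativeSemiring.*-commutativeSemigroup semiring) using (interchange)

    trace : ℕ → Carrier
    trace = Tr k (alphaTensor k α H)

    scaling : Carrier
    scaling = fromℕ ((k ∸ 1) ℕ.^ (order H ∸ 1))

    Vs = allFin (order H)
    Es = allFin (size H)

    diagonalPart : ℕ → Carrier
    diagonalPart D = diagonalConstant D * ∑ Vs (λ v → diagonalPower D (degree H v))

    -- The order ℓ can be prescribed, so the first one or two standard vertices can be made the
    -- extra diagonal rows.
    frame : ∀ j {ℓ} → ℓ ↭ vertices j → ∃[ φ ] Frame j φ × map φ (allFin k) ≡ ℓ
    frame j {ℓ} p = let φ , inj , image , eq = build (≡.trans (↭-length p) (length-vertices j))
      in φ , record { injective = inj ; image = image } , eq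
      where
      build : ∀ {k′} → length ℓ ≡ k′ →
        ∃[ φ ] (∀ {a b : Fin k′} → φ a ≡ φ b → a ≡ b) × map φ (allFin k′) ↭ vertices j × map φ (allFin k′) ≡ ℓ
      build refl = lookup ℓ
        , unique-lookup-injective (λ x → x) (≡.subst Unique (≡.sym (List.map-id ℓ)) (unique-resp-↭ (↭-sym p) (members-unique (edge H j))))
        , trans (↭-reflexive listed) p , listed
        where
        listed : map (lookup ℓ) (allFin (length ℓ)) ≡ ℓ
        listed = ≡.trans (List.map-tabulate (λ i → i) (lookup ℓ)) (List.tabulate-lookup ℓ)

    -- With k ≥ 3 even the index k + 2 stays below 2k, the range in which a second hyperedge cannot
    -- be used.
    k+e<2k : ∀ {e} → e ℕ.≤ 2 → k ℕ.+ e ℕ.< k ℕ.+ k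
    k+e<2k e≤2 = ℕ.+-monoʳ-< k (ℕ.≤-<-trans e≤2 (s≤s (s≤s (s≤s z≤n))))

    trace-below : ∀ {D} → 0 ℕ.< D → D ℕ.< k → trace D ≈ scaling * diagonalPart D
    trace-below {suc D} 0<D D<k = ≈-trans (Tr≈ k (alphaTensor k α H) D) (*-congˡ (≈-trans
      -- Below k there is no room for a hyperedge: no r has k + `length r` = D, so the list of
      -- multisets is empty.
      (∑-terms 0<D (ℕ.<-≤-trans D<k (ℕ.m≤m+n k k)) [] [] (λ ()) (λ ())
        (λ r eq → ⊥-elim (ℕ.<⇒≱ D<k (ℕ.≤-trans (ℕ.m≤m+n k (length r)) (ℕ.≤-reflexive eq)))))
      (≈-trans (+-congˡ (∑-0 Es (λ _ → ≈-refl))) (+-identityʳ _))))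

    -- The only multiset of extra rows is empty, so each hyperedge contributes the same constant.
    -- The index is written k + 0 to match k + `length r`.
    trace-k : trace (k ℕ.+ 0) ≈ scaling * (diagonalPart (k ℕ.+ 0) + ∑ Es (λ _ → localConstant (k ℕ.+ 0) []))
    trace-k = ≈-trans (Tr≈ k (alphaTensor k α H) (2 ℕ.+ q ℕ.+ 0)) (*-congˡ (≈-trans
      (∑-terms 0<D D<2k [ [] ] ([] ∷ []) (λ { (here refl) → refl }) (λ { (here refl) (here refl) _ → refl })
        (λ { [] _ → [] , here refl , ↭-refl ; (_ ∷ r) eq → ⊥-elim (ℕ.1+n≢0 (ℕ.+-cancelˡ-≡ k _ _ eq)) }))
      (+-congˡ (∑-cong Es (λ j → ≈-trans (+-identityʳ _) (one j))))))
      where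
      0<D : 0 ℕ.< k ℕ.+ 0
      0<D = s≤s z≤n
      D<2k : k ℕ.+ 0 ℕ.< k ℕ.+ k
      D<2k = k+e<2k z≤n
      one : ∀ j → term 0<D D<2k (content (vertices j ++ [])) ≈ localConstant (k ℕ.+ 0) []
      one j with φ , fr , _ ← frame j ↭-refl = ≈-trans (term-local 0<D D<2k fr [] refl refl) (*-identityʳ _)

    degreeSum : ℕ
    degreeSum = ∑ℕ.∑ Es (λ j → ∑ℕ.∑ (vertices j) (degree H))

    trace-k+1 : trace (k ℕ.+ 1) ≈
      scaling * (diagonalPart (k ℕ.+ 1) + localConstant (k ℕ.+ 1) [ zero ] * (α * fromℕ degreeSum))
    trace-k+1 = ≈-trans (Tr≈ k (alphaTensor k α H) (2 ℕ.+ q ℕ.+ 1)) (*-congˡ (≈-trans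
      (∑-terms 0<D D<2k (map [_] Vs) (Unique.map⁺ (λ { refl → refl }) (Unique.allFin⁺ (order H))) sound canonical complete)
      (+-congˡ locals)))
      where
      0<D : 0 ℕ.< k ℕ.+ 1
      0<D = s≤s z≤n
      D<2k : k ℕ.+ 1 ℕ.< k ℕ.+ k
      D<2k = k+e<2k (s≤s z≤n)
      sound : ∀ {r} → r ∈ map [_] Vs → k ℕ.+ length r ≡ k ℕ.+ 1
      sound r∈ with _ , _ , refl ← ∈-map⁻ [_] r∈ = refl
      canonical : ∀ {r r′} → r ∈ map [_] Vs → r′ ∈ map [_] Vs → r ↭ r′ → r ≡ r′
      canonical r∈ r′∈ p with _ , _ , refl ← ∈-map⁻ [_] r∈ with _ , _ , refl ← ∈-map⁻ [_] r′∈ = ↭-singleton-inv p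
      complete : ∀ r → k ℕ.+ length r ≡ k ℕ.+ 1 → ∃[ r′ ] r′ ∈ map [_] Vs × r ↭ r′
      complete []          eq with () ← ℕ.+-cancelˡ-≡ k 0 1 eq
      complete (a ∷ [])    eq = [ a ] , ∈-map⁺ [_] (∈-allFin a) , ↭-refl
      complete (_ ∷ _ ∷ r) eq with () ← ℕ.+-cancelˡ-≡ k (2 ℕ.+ length r) 1 eq
      κ = localConstant (k ℕ.+ 1) [ zero ]
      one : ∀ j a (d : Dec (All (_∈ᵉ j) [ a ])) →
        [ d ]· (term 0<D D<2k (content (vertices j ++ [ a ]))) ≈ κ * (α * [ a ∈ᵉ? j ]· (fromℕ (degree H a)))
      one j a (no a∉) = ≈-sym (≈-trans (*-congˡ (≈-trans (*-congˡ ([]·-no (a ∈ᵉ? j) (λ a∈ → a∉ (a∈ ∷ [])))) (zeroʳ α))) (zeroʳ κ))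
      one j a (yes (a∈ ∷ []))
        with ys , p ← ∈⇒↭∷ (∈-members⁺ (edge H j) a∈)
        with φ , fr , eq ← frame j (↭-sym p)
        = begin
          term 0<D D<2k (content (vertices j ++ [ a ]))
            ≈⟨ term-local 0<D D<2k fr [ zero ] refl (≡.cong [_] (≡.sym (List.∷-injectiveˡ eq))) ⟩
          κ * (diagonalWeight (φ zero) * 1#)
            ≈⟨ *-congˡ (*-identityʳ _) ⟩
          κ * diagonalWeight (φ zero)
            ≡⟨ ≡.cong (λ v → κ * diagonalWeight v) (List.∷-injectiveˡ eq) ⟩
          κ * diagonalWeight a
            ≈⟨ *-congˡ (*-congˡ ([]·-yes (a ∈ᵉ? j) a∈)) ⟨
          κ * (α * [ a ∈ᵉ? j ]· (fromℕ (degree H a))) ∎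
      locals : ∑ Es (λ j → ∑ (map [_] Vs) (λ r → [ All.all? (_∈ᵉ? j) r ]· (term 0<D D<2k (content (vertices j ++ r))))) ≈
        κ * (α * fromℕ degreeSum)
      locals = begin
        ∑ Es (λ j → ∑ (map [_] Vs) (λ r → [ All.all? (_∈ᵉ? j) r ]· (term 0<D D<2k (content (vertices j ++ r)))))
          ≈⟨ ∑-cong Es (λ j → ≈-trans (∑-map [_] Vs) (∑-cong Vs (λ a → one j a (All.all? (_∈ᵉ? j) [ a ])))) ⟩
        ∑ Es (λ j → ∑ Vs (λ a → κ * (α * [ a ∈ᵉ? j ]· (fromℕ (degree H a)))))
          ≈⟨ ∑-cong Es (λ j → ≈-trans (≈-sym (∑-*ˡ Vs κ)) (*-congˡ (≈-sym (∑-*ˡ Vs α)))) ⟩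
        ∑ Es (λ j → κ * (α * ∑ Vs (λ a → [ a ∈ᵉ? j ]· (fromℕ (degree H a)))))
          ≈⟨ ∑-cong Es (λ j → *-congˡ (*-congˡ (≈-trans (≈-sym (∑-filter (_∈ᵉ? j) Vs)) (≈-sym (fromℕ-∑ (vertices j)))))) ⟩
        ∑ Es (λ j → κ * (α * fromℕ (∑ℕ.∑ (vertices j) (degree H))))
          ≈⟨ ≈-trans (*-congˡ (≈-trans (*-congˡ (fromℕ-∑ Es)) (∑-*ˡ Es α))) (∑-*ˡ Es κ) ⟨
        κ * (α * fromℕ degreeSum) ∎

    localDegree : E → V → ℕ
    localDegree j a = ∑ℕ.[ a ∈ᵉ? j ]· (degree H a)

    squareTerm pairTerm : E → V → V → ℕ
    squareTerm j a b = ∑ℕ.[ a Fin.≟ b ]· (localDegree j a ℕ.* localDegree j b)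
    pairTerm   j a b = ∑ℕ.[ toℕ a ℕ.<? toℕ b ]· (localDegree j a ℕ.* localDegree j b)

    squareSum pairSum : ℕ
    squareSum = ∑ℕ.∑ Es (λ j → ∑ℕ.∑ Vs (λ a → ∑ℕ.∑ Vs (squareTerm j a)))
    pairSum   = ∑ℕ.∑ Es (λ j → ∑ℕ.∑ Vs (λ a → ∑ℕ.∑ Vs (pairTerm j a)))

    trace-k+2 : trace (k ℕ.+ 2) ≈ scaling * (diagonalPart (k ℕ.+ 2) +
      (localConstant (k ℕ.+ 2) (zero ∷ zero ∷ []) * (α * α) * fromℕ squareSum +
       localConstant (k ℕ.+ 2) (zero ∷ suc zero ∷ []) * (α * α) * fromℕ pairSum))
    trace-k+2 = ≈-trans (Tr≈ k (alphaTensor k α H) (2 ℕ.+ q ℕ.+ 2)) (*-congˡ (≈-trans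
      (∑-terms 0<D D<2k RL (Unique.map⁺ (λ { refl → refl }) (Unique.filter⁺ ≤?
        (Unique.cartesianProduct⁺ (Unique.allFin⁺ (order H)) (Unique.allFin⁺ (order H))))) sound canonical complete)
      (+-congˡ locals)))
      where
      0<D : 0 ℕ.< k ℕ.+ 2
      0<D = s≤s z≤n
      D<2k : k ℕ.+ 2 ℕ.< k ℕ.+ k
      D<2k = k+e<2k (s≤s (s≤s z≤n))
      ≤? : ∀ (ab : V × V) → Dec (toℕ (proj₁ ab) ℕ.≤ toℕ (proj₂ ab))
      ≤? (a , b) = toℕ a ℕ.≤? toℕ b
      pair : V × V → List V
      pair (a , b) = a ∷ b ∷ []
      -- A multiset of two vertices is represented by its sorted pair, repetition allowed.
      RL : List (List V)
      RL = map pair (filter ≤? (cartesianProduct Vs Vs))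
      ∈RL⁺ : ∀ {a b} → toℕ a ℕ.≤ toℕ b → a ∷ b ∷ [] ∈ RL
      ∈RL⁺ {a} {b} a≤b = ∈-map⁺ pair (∈-filter⁺ ≤? (∈-cartesianProduct⁺ (∈-allFin a) (∈-allFin b)) a≤b)
      ∈RL⁻ : ∀ {r} → r ∈ RL → ∃[ a ] ∃[ b ] r ≡ a ∷ b ∷ [] × toℕ a ℕ.≤ toℕ b
      ∈RL⁻ r∈ with (a , b) , ab∈ , refl ← ∈-map⁻ pair r∈ =
        a , b , refl , proj₂ (∈-filter⁻ ≤? {xs = cartesianProduct Vs Vs} ab∈)
      sound : ∀ {r} → r ∈ RL → k ℕ.+ length r ≡ k ℕ.+ 2
      sound r∈ with _ , _ , refl , _ ← ∈RL⁻ r∈ = refl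
      same : ∀ {a b c d : V} → toℕ a ℕ.≤ toℕ b → toℕ c ℕ.≤ toℕ d → a ∷ b ∷ [] ↭ c ∷ d ∷ [] → a ∷ b ∷ [] ≡ c ∷ d ∷ []
      same {a} a≤b c≤d p with ∈-resp-↭ p (here refl)
      ... | here refl = ≡.cong (a ∷_) (↭-singleton-inv (drop-∷ p))
      same {a} {b} {c} a≤b c≤d p | there (here refl) with refl ← ↭-singleton-inv (drop-∷ (trans p (swap c a ↭-refl))) =
        ≡.cong₂ (λ x y → x ∷ y ∷ []) a≡c (≡.sym a≡c)
        where a≡c = Fin.toℕ-injective (ℕ.≤-antisym a≤b c≤d)
      canonical : ∀ {r r′} → r ∈ RL → r′ ∈ RL → r ↭ r′ → r ≡ r′
      canonical r∈ r′∈ p with _ , _ , refl , a≤b ← ∈RL⁻ r∈ with _ , _ , refl , c≤d ← ∈RL⁻ r′∈ = same a≤b c≤d p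
      complete : ∀ r → k ℕ.+ length r ≡ k ℕ.+ 2 → ∃[ r′ ] r′ ∈ RL × r ↭ r′
      complete []              eq with () ← ℕ.+-cancelˡ-≡ k 0 2 eq
      complete (_ ∷ [])        eq with () ← ℕ.+-cancelˡ-≡ k 1 2 eq
      complete (a ∷ b ∷ [])    eq with ℕ.≤-total (toℕ a) (toℕ b)
      ... | inj₁ a≤b = a ∷ b ∷ [] , ∈RL⁺ a≤b , ↭-refl
      ... | inj₂ b≤a = b ∷ a ∷ [] , ∈RL⁺ b≤a , swap a b ↭-refl
      complete (_ ∷ _ ∷ _ ∷ r) eq with () ← ℕ.+-cancelˡ-≡ k (3 ℕ.+ length r) 2 eq
      κ₀ κ₁ : Carrier
      κ₀ = localConstant (k ℕ.+ 2) (zero ∷ zero ∷ []) * (α * α)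
      κ₁ = localConstant (k ℕ.+ 2) (zero ∷ suc zero ∷ []) * (α * α)
      product : ∀ κ a b → κ * (diagonalWeight a * (diagonalWeight b * 1#)) ≈ κ * (α * α) * fromℕ (degree H a ℕ.* degree H b)
      product κ a b = begin
        κ * (diagonalWeight a * (diagonalWeight b * 1#))          ≈⟨ *-congˡ (*-congˡ (*-identityʳ _)) ⟩
        κ * (diagonalWeight a * diagonalWeight b)                 ≈⟨ *-congˡ (interchange α _ α _) ⟩
        κ * (α * α * (fromℕ (degree H a) * fromℕ (degree H b)))   ≈⟨ *-congˡ (*-congˡ (fromℕ-* (degree H a) (degree H b))) ⟨
        κ * (α * α * fromℕ (degree H a ℕ.* degree H b))           ≈⟨ *-assoc _ _ _ ⟨
        κ * (α * α) * fromℕ (degree H a ℕ.* degree H b)           ∎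
      τ : E → V → V → Carrier
      τ j a b = term 0<D D<2k (content (vertices j ++ a ∷ b ∷ []))
      value₀ : ∀ j a → a ∈ᵉ j → τ j a a ≈ κ₀ * fromℕ (degree H a ℕ.* degree H a)
      value₀ j a a∈
        with ys , p ← ∈⇒↭∷ (∈-members⁺ (edge H j) a∈)
        with φ , fr , eq ← frame j (↭-sym p)
        with refl ← List.∷-injectiveˡ eq
        = ≈-trans (term-local 0<D D<2k fr (zero ∷ zero ∷ []) refl refl) (product _ (φ zero) (φ zero))
      value₁ : ∀ j a b → a ∈ᵉ j → b ∈ᵉ j → a ≢ b → τ j a b ≈ κ₁ * fromℕ (degree H a ℕ.* degree H b)
      value₁ j a b a∈ b∈ a≢b
        with ys , p ← unique-⊆⇒↭++ {ys = a ∷ b ∷ []} {xs = vertices j} ((a≢b ∷ []) ∷ [] ∷ [])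
               (λ { (here refl) → ∈-members⁺ (edge H j) a∈ ; (there (here refl)) → ∈-members⁺ (edge H j) b∈ })
        with φ , fr , eq ← frame j (↭-sym p)
        with refl ← List.∷-injectiveˡ eq
        with refl ← List.∷-injectiveˡ (List.∷-injectiveʳ eq)
        = ≈-trans (term-local 0<D D<2k fr (zero ∷ suc zero ∷ []) refl refl) (product _ (φ zero) (φ (suc zero)))
      localDegree-∈ : ∀ {j a} → a ∈ᵉ j → localDegree j a ≡ degree H a
      localDegree-∈ {j} {a} a∈ = ∑ℕ.[]·-yes (a ∈ᵉ? j) a∈
      localDegree-∉ : ∀ {j a} → ¬ a ∈ᵉ j → localDegree j a ≡ 0
      localDegree-∉ {j} {a} a∉ = ∑ℕ.[]·-no (a ∈ᵉ? j) a∉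
      combine : ∀ {x y x′ y′} → x ≡ x′ → y ≡ y′ → κ₀ * fromℕ x + κ₁ * fromℕ y ≈ κ₀ * fromℕ x′ + κ₁ * fromℕ y′
      combine refl refl = ≈-refl
      only₀ : ∀ x → κ₀ * fromℕ x + κ₁ * fromℕ 0 ≈ κ₀ * fromℕ x
      only₀ x = ≈-trans (+-congˡ (zeroʳ κ₁)) (+-identityʳ _)
      only₁ : ∀ x → κ₀ * fromℕ 0 + κ₁ * fromℕ x ≈ κ₁ * fromℕ x
      only₁ x = ≈-trans (+-congʳ (zeroʳ κ₀)) (+-identityˡ _)
      vanishing : ∀ j a b → ¬ All (_∈ᵉ j) (a ∷ b ∷ []) → localDegree j a ℕ.* localDegree j b ≡ 0
      vanishing j a b ∉ with a ∈ᵉ? j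
      ... | no _ = refl
      ... | yes a∈ = ≡.trans (≡.cong (degree H a ℕ.*_) (localDegree-∉ {j} {b} (λ b∈ → ∉ (a∈ ∷ b∈ ∷ [])))) (ℕ.*-zeroʳ (degree H a))
      []·-0ℕ : ∀ {P : Set} (d : Dec P) {x} → x ≡ 0 → ∑ℕ.[ d ]· x ≡ 0
      []·-0ℕ (yes _) eq = eq
      []·-0ℕ (no _)  eq = refl
      one : ∀ j a b → [ toℕ a ℕ.≤? toℕ b ]· ([ All.all? (_∈ᵉ? j) (a ∷ b ∷ []) ]· (τ j a b)) ≈
        κ₀ * fromℕ (squareTerm j a b) + κ₁ * fromℕ (pairTerm j a b)
      one j a b = go (All.all? (_∈ᵉ? j) (a ∷ b ∷ []))
        where
        go : (d : Dec (All (_∈ᵉ j) (a ∷ b ∷ []))) → [ toℕ a ℕ.≤? toℕ b ]· ([ d ]· (τ j a b)) ≈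
          κ₀ * fromℕ (squareTerm j a b) + κ₁ * fromℕ (pairTerm j a b)
        go (no ∉) = ≈-trans ([]·-zero (toℕ a ℕ.≤? toℕ b)) (≈-sym (≈-trans
          (combine ([]·-0ℕ (a Fin.≟ b) (vanishing j a b ∉)) ([]·-0ℕ (toℕ a ℕ.<? toℕ b) (vanishing j a b ∉)))
          (≈-trans (only₀ 0) (zeroʳ κ₀))))
          where
          []·-zero : ∀ {P : Set} (d : Dec P) → [ d ]· 0# ≈ 0#
          []·-zero (yes _) = ≈-refl
          []·-zero (no _)  = ≈-refl
        go (yes (a∈ ∷ b∈ ∷ [])) with ℕ.<-cmp (toℕ a) (toℕ b)
        ... | tri< a<b a≢b _ = ≈-trans ([]·-yes (toℕ a ℕ.≤? toℕ b) (ℕ.<⇒≤ a<b)) (≈-trans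
          (value₁ j a b a∈ b∈ (λ { refl → a≢b refl })) (≈-sym (≈-trans (combine
            (∑ℕ.[]·-no (a Fin.≟ b) (λ { refl → a≢b refl }))
            (≡.trans (∑ℕ.[]·-yes (toℕ a ℕ.<? toℕ b) a<b) (≡.cong₂ ℕ._*_ (localDegree-∈ {j} {a} a∈) (localDegree-∈ {j} {b} b∈))))
            (only₁ (degree H a ℕ.* degree H b)))))
        ... | tri> _ a≢b b<a = ≈-trans ([]·-no (toℕ a ℕ.≤? toℕ b) (ℕ.<⇒≱ b<a)) (≈-sym (≈-trans (combine
            (∑ℕ.[]·-no (a Fin.≟ b) (λ { refl → a≢b refl }))
            (∑ℕ.[]·-no (toℕ a ℕ.<? toℕ b) (ℕ.<⇒≯ b<a))) (≈-trans (only₀ 0) (zeroʳ κ₀))))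
        ... | tri≈ ≮ a≡b _ with refl ← Fin.toℕ-injective a≡b = ≈-trans ([]·-yes (toℕ a ℕ.≤? toℕ a) ℕ.≤-refl) (≈-trans
          (value₀ j a a∈) (≈-sym (≈-trans (combine
            (≡.trans (∑ℕ.[]·-yes (a Fin.≟ a) refl) (≡.cong₂ ℕ._*_ (localDegree-∈ {j} {a} a∈) (localDegree-∈ {j} {a} a∈)))
            (∑ℕ.[]·-no (toℕ a ℕ.<? toℕ a) ≮)) (only₀ (degree H a ℕ.* degree H a)))))
      locals : ∑ Es (λ j → ∑ RL (λ r → [ All.all? (_∈ᵉ? j) r ]· (term 0<D D<2k (content (vertices j ++ r))))) ≈
        κ₀ * fromℕ squareSum + κ₁ * fromℕ pairSum
      locals = begin
        ∑ Es (λ j → ∑ RL (λ r → [ All.all? (_∈ᵉ? j) r ]· (term 0<D D<2k (content (vertices j ++ r)))))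
          ≈⟨ ∑-cong Es (λ j → ≈-trans (∑-map pair (filter ≤? (cartesianProduct Vs Vs))) (≈-trans (∑-filter ≤? (cartesianProduct Vs Vs))
               (∑-cartesianProductWith _,_ Vs Vs))) ⟩
        ∑ Es (λ j → ∑ Vs (λ a → ∑ Vs (λ b → [ toℕ a ℕ.≤? toℕ b ]· ([ All.all? (_∈ᵉ? j) (a ∷ b ∷ []) ]· (τ j a b)))))
          ≈⟨ ∑-cong Es (λ j → ∑-cong Vs (λ a → ≈-trans (∑-cong Vs (one j a)) (linear Vs (squareTerm j a) (pairTerm j a)))) ⟩
        ∑ Es (λ j → ∑ Vs (λ a → κ₀ * fromℕ (∑ℕ.∑ Vs (squareTerm j a)) + κ₁ * fromℕ (∑ℕ.∑ Vs (pairTerm j a))))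
          ≈⟨ ∑-cong Es (λ j → linear Vs _ _) ⟩
        ∑ Es (λ j → κ₀ * fromℕ (∑ℕ.∑ Vs (λ a → ∑ℕ.∑ Vs (squareTerm j a))) + κ₁ * fromℕ (∑ℕ.∑ Vs (λ a → ∑ℕ.∑ Vs (pairTerm j a))))
          ≈⟨ linear Es _ _ ⟩
        κ₀ * fromℕ squareSum + κ₁ * fromℕ pairSum ∎
        where
        linear : ∀ {A : Set} (xs : List A) (f g : A → ℕ) →
          ∑ xs (λ x → κ₀ * fromℕ (f x) + κ₁ * fromℕ (g x)) ≈ κ₀ * fromℕ (∑ℕ.∑ xs f) + κ₁ * fromℕ (∑ℕ.∑ xs g)
        linear xs f g = ≈-trans (∑-+ xs) (+-cong (≈-sym (≈-trans (*-congˡ (fromℕ-∑ xs)) (∑-*ˡ xs κ₀)))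
          (≈-sym (≈-trans (*-congˡ (fromℕ-∑ xs)) (∑-*ˡ xs κ₁))))

-- Comparison of the traces of the hyperpath and of another hypertree

module TraceComparison where

  open ListCombinatorics
  open WalkCounting
  open TracePairing
  open HypertreeGrowth
  open HyperpathRecognition
  open LocalContributions
  open CompositionReindexing
  open HyperpathStructure
  open TraceEvaluation

  module SumsOfSquares where
    open import Data.Nat.Base using (_+_; _*_; _≤_; _<_)
    open ∑ℕ using (∑)

    -- (x - 1)(x - 2), which is 2 for x = 0.
    defect : ℕ → ℕ
    defect zero    = 2
    defect (suc x) = x * (x ∸ 1)

    square≡ : ∀ x → x * x + 2 ≡ 3 * x + defect x
    square≡ zero          = refl
    square≡ (suc zero)    = refl
    square≡ (suc (suc x)) = arith x
      where
      arith : ∀ x → (2 + x) * (2 + x) + 2 ≡ 3 * (2 + x) + (1 + x) * x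
      arith = solve-∀

    module _ {A : Set} (f : A → ℕ) where

      ∑-square≡ : ∀ xs → ∑ xs (λ x → f x * f x) + 2 * length xs ≡ 3 * ∑ xs f + ∑ xs (λ x → defect (f x))
      ∑-square≡ xs = begin
        ∑ xs (λ x → f x * f x) + 2 * length xs        ≡⟨ ≡.cong (λ z → ∑ xs (λ x → f x * f x) + 2 * z) (∑-const-1 xs) ⟨
        ∑ xs (λ x → f x * f x) + 2 * ∑ xs (λ _ → 1)   ≡⟨ ≡.cong (∑ xs (λ x → f x * f x) +_) (∑ℕ.∑-*ˡ xs 2) ⟩
        ∑ xs (λ x → f x * f x) + ∑ xs (λ _ → 2)       ≡⟨ ∑ℕ.∑-+ xs ⟨
        ∑ xs (λ x → f x * f x + 2)                    ≡⟨ ∑ℕ.∑-cong xs (λ x → square≡ (f x)) ⟩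
        ∑ xs (λ x → 3 * f x + defect (f x))           ≡⟨ ∑ℕ.∑-+ xs ⟩
        ∑ xs (λ x → 3 * f x) + ∑ xs (λ x → defect (f x)) ≡⟨ ≡.cong (_+ ∑ xs (λ x → defect (f x))) (∑ℕ.∑-*ˡ xs 3) ⟨
        3 * ∑ xs f + ∑ xs (λ x → defect (f x))        ∎
        where open ≡-Reasoning

    -- With length and sum fixed, the sum of squares is a constant plus the total defect, which is 0
    -- if all entries are 1 or 2 and positive if some entry is at least 3.
    ∑-square-< : ∀ {A B : Set} {xs : List A} {ys : List B} {f : A → ℕ} {g : B → ℕ} →
      length xs ≡ length ys → ∑ xs f ≡ ∑ ys g → (∀ x → 1 ≤ f x × f x ≤ 2) →
      ∀ {y} → y ∈ ys → 3 ≤ g y → ∑ xs (λ x → f x * f x) < ∑ ys (λ y → g y * g y)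
    ∑-square-< {xs = xs} {ys} {f} {g} len sum f≤2 {y} y∈ 3≤gy = ℕ.+-cancelʳ-< (2 * length xs) _ _ (begin-strict
      ∑ xs (λ x → f x * f x) + 2 * length xs       ≡⟨ ∑-square≡ f xs ⟩
      3 * ∑ xs f + ∑ xs (λ x → defect (f x))       ≡⟨ ≡.cong₂ _+_ (≡.cong (3 *_) sum) (∑ℕ.∑-0 xs (λ {x} _ → flat (f≤2 x))) ⟩
      3 * ∑ ys g + 0                               <⟨ ℕ.+-monoʳ-< (3 * ∑ ys g) (ℕ.<-≤-trans (curved 3≤gy) (∑ℕ.∑-≥ {f = λ y → defect (g y)} y∈)) ⟩
      3 * ∑ ys g + ∑ ys (λ y → defect (g y))       ≡⟨ ∑-square≡ g ys ⟨
      ∑ ys (λ y → g y * g y) + 2 * length ys       ≡⟨ ≡.cong (λ z → ∑ ys (λ y → g y * g y) + 2 * z) len ⟨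
      ∑ ys (λ y → g y * g y) + 2 * length xs       ∎)
      where
      open ℕ.≤-Reasoning
      flat : ∀ {x} → 1 ≤ x × x ≤ 2 → defect x ≡ 0
      flat {1} _ = refl
      flat {2} _ = refl
      flat {suc (suc (suc _))} (_ , s≤s (s≤s ()))
      curved : ∀ {x} → 3 ≤ x → 0 < defect x
      curved (s≤s (s≤s (s≤s z≤n))) = s≤s z≤n

    onesAndTwos : ∀ {xs} → All (λ x → 1 ≤ x × x ≤ 2) xs → ∃[ a ] ∃[ b ] xs ↭ replicate a 2 ++ replicate b 1
    onesAndTwos []                                   = 0 , 0 , ↭-refl
    onesAndTwos {1 ∷ _} (_ ∷ all) with a , b , p ← onesAndTwos all =
      a , suc b , trans (prep 1 p) (↭-sym (shift 1 (replicate a 2) (replicate b 1)))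
    onesAndTwos {2 ∷ _} (_ ∷ all) with a , b , p ← onesAndTwos all = suc a , b , prep 2 p
    onesAndTwos {suc (suc (suc _)) ∷ _} ((_ , s≤s (s≤s ())) ∷ _)

    -- For a twos and b ones, the length a + b and the sum 2a + b determine a and b.
    onesAndTwos-↭ : ∀ {xs ys} → All (λ x → 1 ≤ x × x ≤ 2) xs → All (λ x → 1 ≤ x × x ≤ 2) ys →
      length xs ≡ length ys → ∑ xs (λ x → x) ≡ ∑ ys (λ x → x) → xs ↭ ys
    onesAndTwos-↭ {xs} {ys} xs≤2 ys≤2 len sum
      with a , b , p ← onesAndTwos xs≤2 with a′ , b′ , p′ ← onesAndTwos ys≤2 =
      trans p (trans (↭-reflexive (≡.cong₂ (λ a b → replicate a 2 ++ replicate b 1) a≡a′ b≡b′)) (↭-sym p′))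
      where
      length-form : ∀ {zs} a b → zs ↭ replicate a 2 ++ replicate b 1 → length zs ≡ a + b
      length-form a b p = ≡.trans (↭-length p) (≡.trans (List.length-++ (replicate a 2)) (≡.cong₂ _+_ (List.length-replicate a) (List.length-replicate b)))
      ∑-replicate : ∀ a c → ∑ (replicate a c) (λ x → x) ≡ a * c
      ∑-replicate zero    c = refl
      ∑-replicate (suc a) c = ≡.cong (c +_) (∑-replicate a c)
      sum-form : ∀ {zs} a b → zs ↭ replicate a 2 ++ replicate b 1 → ∑ zs (λ x → x) ≡ a + (a + b)
      sum-form a b p = ≡.trans (∑ℕ.∑-↭ p) (≡.trans (∑ℕ.∑-++ (replicate a 2) (replicate b 1))
        (≡.trans (≡.cong₂ _+_ (∑-replicate a 2) (∑-replicate b 1)) (arith a b)))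
        where
        arith : ∀ a b → a * 2 + b * 1 ≡ a + (a + b)
        arith = solve-∀
      a+b≡ : a + b ≡ a′ + b′
      a+b≡ = ≡.trans (≡.sym (length-form a b p)) (≡.trans len (length-form a′ b′ p′))
      a≡a′ : a ≡ a′
      a≡a′ = ℕ.+-cancelʳ-≡ (a + b) a a′ (≡.trans (≡.sym (sum-form a b p)) (≡.trans sum
        (≡.trans (sum-form a′ b′ p′) (≡.cong (a′ +_) (≡.sym a+b≡)))))
      b≡b′ : b ≡ b′
      b≡b′ = ℕ.+-cancelˡ-≡ a b b′ (≡.trans a+b≡ (≡.cong (_+ b′) (≡.sym a≡a′)))

  open SumsOfSquares

  module LocalSums (H : Hypergraph) where
    open import Data.Nat.Base using (_+_; _*_; _≤_; _<_)
    open ∑ℕ using (∑; [_]·)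
    open Incidence H

    Vs = allFin (order H)
    Es = allFin (size H)

    -- Degrees extended by zero outside j, so that all sums run over the full vertex list and
    -- `square-of-sum` applies. The sums built from it are those of the trace formula.
    localDegree : E → V → ℕ
    localDegree j a = [ a ∈ᵉ? j ]· (degree H a)

    squares pairs : (V → ℕ) → ℕ
    squares x = ∑ Vs (λ a → ∑ Vs (λ b → [ a Fin.≟ b ]· (x a * x b)))
    pairs   x = ∑ Vs (λ a → ∑ Vs (λ b → [ toℕ a ℕ.<? toℕ b ]· (x a * x b)))

    squares≡ : ∀ x → squares x ≡ ∑ Vs (λ a → x a * x a)
    squares≡ x = ∑ℕ.∑-cong Vs (λ a → ≡.trans
      (∑ℕ.∑-single (Unique.allFin⁺ (order H)) (∈-allFin a) (λ {b} _ b≢a → ∑ℕ.[]·-no (a Fin.≟ b) (λ a≡b → b≢a (≡.sym a≡b))))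
      (∑ℕ.[]·-yes (a Fin.≟ a) refl))

    square-of-sum : ∀ x → ∑ Vs x * ∑ Vs x ≡ squares x + 2 * pairs x
    square-of-sum x = begin
      ∑ Vs x * ∑ Vs x
        ≡⟨ ∑ℕ.∑-*ˡ Vs (∑ Vs x) ⟩
      ∑ Vs (λ a → ∑ Vs x * x a)
        ≡⟨ ∑ℕ.∑-cong Vs (λ a → ≡.trans (ℕ.*-comm (∑ Vs x) (x a)) (∑ℕ.∑-*ˡ Vs (x a))) ⟩
      ∑ Vs (λ a → ∑ Vs (λ b → x a * x b))
        ≡⟨ ∑ℕ.∑-cong Vs (λ a → ∑ℕ.∑-cong Vs (λ b → split a b)) ⟩
      ∑ Vs (λ a → ∑ Vs (λ b → S a b + (P a b + P b a)))
        ≡⟨ ∑ℕ.∑-cong Vs (λ a → ≡.trans (∑ℕ.∑-+ Vs) (≡.cong (∑ Vs (S a) +_) (∑ℕ.∑-+ Vs))) ⟩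
      ∑ Vs (λ a → ∑ Vs (S a) + (∑ Vs (P a) + ∑ Vs (λ b → P b a)))
        ≡⟨ ≡.trans (∑ℕ.∑-+ Vs) (≡.cong (squares x +_) (∑ℕ.∑-+ Vs)) ⟩
      squares x + (pairs x + ∑ Vs (λ a → ∑ Vs (λ b → P b a)))
        ≡⟨ ≡.cong (λ z → squares x + (pairs x + z)) (≡.trans (∑ℕ.∑-swap Vs Vs) (≡.sym (ℕ.+-identityʳ (pairs x)))) ⟩
      squares x + 2 * pairs x ∎
      where
      open ≡-Reasoning
      S P : V → V → ℕ
      S a b = [ a Fin.≟ b ]· (x a * x b)
      P a b = [ toℕ a ℕ.<? toℕ b ]· (x a * x b)
      split : ∀ a b → x a * x b ≡ S a b + (P a b + P b a)
      split a b with ℕ.<-cmp (toℕ a) (toℕ b)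
      ... | tri< a<b a≢b b≮a = ≡.sym (≡.trans (≡.cong₂ _+_ (∑ℕ.[]·-no (a Fin.≟ b) (λ { refl → a≢b refl }))
        (≡.cong₂ _+_ (∑ℕ.[]·-yes (toℕ a ℕ.<? toℕ b) a<b) (∑ℕ.[]·-no (toℕ b ℕ.<? toℕ a) b≮a))) (ℕ.+-identityʳ _))
      ... | tri> a≮b a≢b b<a = ≡.sym (≡.trans (≡.cong₂ _+_ (∑ℕ.[]·-no (a Fin.≟ b) (λ { refl → a≢b refl }))
        (≡.cong₂ _+_ (∑ℕ.[]·-no (toℕ a ℕ.<? toℕ b) a≮b) (∑ℕ.[]·-yes (toℕ b ℕ.<? toℕ a) b<a))) (ℕ.*-comm (x b) (x a)))
      ... | tri≈ a≮b a≡b b≮a = ≡.sym (≡.trans (≡.cong₂ _+_ (∑ℕ.[]·-yes (a Fin.≟ b) (Fin.toℕ-injective a≡b))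
        (≡.cong₂ _+_ (∑ℕ.[]·-no (toℕ a ℕ.<? toℕ b) a≮b) (∑ℕ.[]·-no (toℕ b ℕ.<? toℕ a) b≮a))) (ℕ.+-identityʳ _))

    squareSum pairSum : ℕ
    squareSum = ∑ Es (λ j → squares (localDegree j))
    pairSum   = ∑ Es (λ j → pairs (localDegree j))

    edgeDegree : E → ℕ
    edgeDegree j = ∑ (vertices j) (degree H)

    edgeDegree≡ : ∀ j → ∑ Vs (localDegree j) ≡ edgeDegree j
    edgeDegree≡ j = ≡.sym (∑-members (edge H j) (degree H))

    -- Each square is counted once for every incident hyperedge, whence the cubes. So `squareSum`
    -- depends on the degrees only.
    squareSum≡ : squareSum ≡ ∑ Vs (λ v → degree H v * (degree H v * degree H v))
    squareSum≡ = ≡.trans (∑ℕ.∑-cong Es (λ j → ≡.trans (squares≡ (localDegree j)) (≡.trans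
      (∑ℕ.∑-cong Vs (λ a → one (a ∈ᵉ? j) (degree H a))) (≡.sym (∑-members (edge H j) (λ a → degree H a * degree H a))))))
      (∑∑-edges (λ v → degree H v * degree H v))
      where
      one : ∀ {P : Set} (d : Dec P) x → [ d ]· x * [ d ]· x ≡ [ d ]· (x * x)
      one (yes _) x = refl
      one (no _)  x = refl

    ∑-edgeDegree² : ∑ Es (λ j → edgeDegree j * edgeDegree j) ≡ squareSum + 2 * pairSum
    ∑-edgeDegree² = begin
      ∑ Es (λ j → edgeDegree j * edgeDegree j)
        ≡⟨ ∑ℕ.∑-cong Es (λ j → ≡.trans (≡.cong₂ _*_ (≡.sym (edgeDegree≡ j)) (≡.sym (edgeDegree≡ j))) (square-of-sum (localDegree j))) ⟩
      ∑ Es (λ j → squares (localDegree j) + 2 * pairs (localDegree j))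
        ≡⟨ ≡.trans (∑ℕ.∑-+ Es) (≡.cong (squareSum +_) (≡.sym (∑ℕ.∑-*ˡ Es 2))) ⟩
      squareSum + 2 * pairSum ∎
      where open ≡-Reasoning

    -- Valid when all degrees are positive: the truncated subtraction in excess
    -- is then exact.
    module _ {k : ℕ} (uniform : Uniform k H) (positive : ∀ v → 1 ≤ degree H v) where

      edgeDegree≡k+ : ∀ j → edgeDegree j ≡ k + excess H j
      edgeDegree≡k+ j = begin
        ∑ (vertices j) (degree H)                             ≡⟨ ∑ℕ.∑-cong (vertices j) (λ v → ℕ.m+[n∸m]≡n (positive v)) ⟨
        ∑ (vertices j) (λ v → 1 + (degree H v ∸ 1))           ≡⟨ ∑ℕ.∑-+ (vertices j) ⟩
        ∑ (vertices j) (λ _ → 1) + excess H j                 ≡⟨ ≡.cong (_+ excess H j) (≡.trans (∑-const-1 (vertices j)) (≡.trans (length-members (edge H j)) (uniform j))) ⟩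
        k + excess H j                                        ∎
        where open ≡-Reasoning

      -- Expand (k + excess)². For hypertrees of equal size whose degrees agree up to order and are
      -- at most 2, everything but the last sum on the right and `pairSum` on the left is fixed, so
      -- comparing `pairSum` means comparing squared excesses.
      squareSum+2pairSum : squareSum + 2 * pairSum ≡
        (k * k) * length Es + 2 * k * ∑ Es (excess H) + ∑ Es (λ j → excess H j * excess H j)
      squareSum+2pairSum = begin
        squareSum + 2 * pairSum
          ≡⟨ ∑-edgeDegree² ⟨
        ∑ Es (λ j → edgeDegree j * edgeDegree j)
          ≡⟨ ∑ℕ.∑-cong Es (λ j → ≡.trans (≡.cong₂ _*_ (edgeDegree≡k+ j) (edgeDegree≡k+ j)) (arith k (excess H j))) ⟩
        ∑ Es (λ j → k * k * 1 + 2 * k * excess H j + excess H j * excess H j)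
          ≡⟨ ≡.trans (∑ℕ.∑-+ Es) (≡.cong (_+ ∑ Es (λ j → excess H j * excess H j)) (∑ℕ.∑-+ Es)) ⟩
        ∑ Es (λ _ → k * k * 1) + ∑ Es (λ j → 2 * k * excess H j) + ∑ Es (λ j → excess H j * excess H j)
          ≡⟨ ≡.cong (_+ ∑ Es (λ j → excess H j * excess H j)) (≡.cong₂ _+_
               (≡.trans (≡.sym (∑ℕ.∑-*ˡ Es (k * k))) (≡.cong (k * k *_) (∑-const-1 Es))) (≡.sym (∑ℕ.∑-*ˡ Es (2 * k)))) ⟩
        (k * k) * length Es + 2 * k * ∑ Es (excess H) + ∑ Es (λ j → excess H j * excess H j) ∎
        where
        open ≡-Reasoning
        arith : ∀ k s → (k + s) * (k + s) ≡ k * k * 1 + 2 * k * s + s * s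
        arith = solve-∀

  -- The order compares only traces with index below the number of eigenvalues. For n ≥ k ≥ 3 the
  -- power of k - 1 is at least 2, so there are at least 2k ≥ k + 3 eigenvalues.
  eigenvalueCount-bound : ∀ {k n} → 3 ℕ.≤ k → k ℕ.≤ n → k ℕ.+ 2 ℕ.≤ n ℕ.* (k ∸ 1) ℕ.^ (n ∸ 1) ∸ 1
  eigenvalueCount-bound {k@(suc k-1)} {suc n-1} 3≤k k≤n = ℕ.≤-pred (begin
    suc (k ℕ.+ 2)                    ≡⟨ ℕ.+-suc k 2 ⟨
    k ℕ.+ 3                          ≤⟨ ℕ.+-monoʳ-≤ k 3≤k ⟩
    k ℕ.+ k                          ≡⟨ double k ⟩
    k ℕ.* 2                          ≤⟨ ℕ.*-mono-≤ k≤n 2≤power ⟩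
    suc n-1 ℕ.* k-1 ℕ.^ n-1          ≤⟨ ℕ.≤-reflexive (≡.sym (ℕ.m+[n∸m]≡n 1≤)) ⟩
    suc (suc n-1 ℕ.* k-1 ℕ.^ n-1 ∸ 1)  ∎)
    where
    open ℕ.≤-Reasoning
    double : ∀ k → k ℕ.+ k ≡ k ℕ.* 2
    double = solve-∀
    2≤k-1 : 2 ℕ.≤ k-1
    2≤k-1 = ℕ.≤-pred 3≤k
    instance
      k-1≢0 : ℕ.NonZero k-1
      k-1≢0 = ℕ.>-nonZero (ℕ.<⇒≤ 2≤k-1)
    2≤power : 2 ℕ.≤ k-1 ℕ.^ n-1
    2≤power = ℕ.≤-trans 2≤k-1 (ℕ.≤-trans (ℕ.≤-reflexive (≡.sym (ℕ.^-identityʳ k-1)))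
      (ℕ.^-monoʳ-≤ k-1 {1} {n-1} (ℕ.≤-pred (ℕ.≤-trans (ℕ.≤-trans (s≤s (s≤s z≤n)) 3≤k) k≤n))))
    1≤ : 1 ℕ.≤ suc n-1 ℕ.* k-1 ℕ.^ n-1
    1≤ = ℕ.*-mono-≤ {1} {suc n-1} {1} (s≤s z≤n) (ℕ.<⇒≤ 2≤power)

  -- The hyperpath enters through the bound 2 on its degrees and excesses, so X stands for any
  -- uniform hypertree with these bounds.
  module MinimalDegreesFirst {c ℓ₁ ℓ₂ : Level} (F : OrderedField c ℓ₁ ℓ₂) (q : ℕ) (α : OrderedField.Carrier F)
    (0<α : OrderedField._<_ F (OrderedField.0# F) α) (α<1 : OrderedField._<_ F α (OrderedField.1# F))
    (X H : Hypergraph) (size≡ : size X ≡ size H) (1≤mˣ : 1 ℕ.≤ size X) (1≤m : 1 ℕ.≤ size H)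
    (uniformˣ : Uniform (3 ℕ.+ q) X) (connectedˣ : Connected X) (acyclicˣ : ¬ Cycle X)
    (degree≤2ˣ : ∀ v → degree X v ℕ.≤ 2) (excess≤2ˣ : ∀ j → excess X j ℕ.≤ 2)
    (uniform : Uniform (3 ℕ.+ q) H) (connected : Connected H) (acyclic : ¬ Cycle H) where
    open OrderedFieldProperties F
    open Spectral F
    open ListSum semiring
    open ListProduct semiring
    open import Relation.Binary.Reasoning.Setoid (CommutativeRing.setoid commutativeRing)
    open import Algebra.Properties.CommutativeSemigroup (CommutativeSemiring.*-commutativeSemigroup semiring) using (interchange)

    k : ℕ
    k = 3 ℕ.+ q

    2≤k : 2 ℕ.≤ k
    2≤k = s≤s (s≤s z≤n)

    open Constants F k α
    module TX = TraceFormulas F q α X uniformˣ connectedˣ acyclicˣ 1≤mˣ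
    module TH = TraceFormulas F q α H uniform connected acyclic 1≤m
    module UX = UniformHypertrees X (ℕ.<⇒≤ 2≤k) uniformˣ connectedˣ acyclicˣ
    module UH = UniformHypertrees H (ℕ.<⇒≤ 2≤k) uniform connected acyclic
    module SX = LocalSums X
    module SH = LocalSums H

    order≡ : order X ≡ order H
    order≡ = ℕ.+-cancelʳ-≡ (size H) _ _ (≡.trans (≡.cong (order X ℕ.+_) (≡.sym size≡)) (≡.trans (UX.order≡ 1≤mˣ)
      (≡.trans (≡.cong (λ m → 1 ℕ.+ m ℕ.* k) size≡) (≡.sym (UH.order≡ 1≤m)))))

    ∑-degree≡ : ∑ℕ.∑ SX.Vs (degree X) ≡ ∑ℕ.∑ SH.Vs (degree H)
    ∑-degree≡ = ≡.trans UX.∑-degree (≡.trans (≡.cong (ℕ._* k) size≡) (≡.sym UH.∑-degree))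

    length-Vs : length SX.Vs ≡ length SH.Vs
    length-Vs = ≡.trans (List.length-tabulate {n = order X} (λ i → i)) (≡.trans order≡ (≡.sym (List.length-tabulate {n = order H} (λ i → i))))

    length-Es : length SX.Es ≡ length SH.Es
    length-Es = ≡.trans (List.length-tabulate {n = size X} (λ i → i)) (≡.trans size≡ (≡.sym (List.length-tabulate {n = size H} (λ i → i))))

    scaling≈ : TX.scaling ≈ TH.scaling
    scaling≈ = fromℕ-≡ (≡.cong (λ n → (k ∸ 1) ℕ.^ (n ∸ 1)) order≡)

    scaling-pos : 0# < TH.scaling
    scaling-pos = fromℕ-pos ((k ∸ 1) ℕ.^ (order H ∸ 1)) {{ℕ.m^n≢0 (k ∸ 1) (order H ∸ 1)}}

    trace-0 : TX.trace 0 ≈ TH.trace 0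
    trace-0 = fromℕ-≡ (≡.cong (λ n → n ℕ.* (k ∸ 1) ℕ.^ (n ∸ 1)) order≡)

    k≤order : k ℕ.≤ order H
    k≤order = ℕ.≤-trans (ℕ.≤-reflexive (≡.sym (UH.length-vertices j))) (ℕ.≤-trans
      (unique-⊆⇒length≤ {xs = SH.Vs} (members-unique (edge H j)) (λ _ → ∈-allFin _))
      (ℕ.≤-reflexive (List.length-tabulate {n = order H} (λ i → i))))
      where
      j = fromℕ< 1≤m

    index-bound : k ℕ.+ 2 ℕ.≤ order X ℕ.* (k ∸ 1) ℕ.^ (order X ∸ 1) ∸ 1
    index-bound = ≡.subst (λ n → k ℕ.+ 2 ℕ.≤ n ℕ.* (k ∸ 1) ℕ.^ (n ∸ 1) ∸ 1) (≡.sym order≡)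
      (eigenvalueCount-bound {k} {order H} (s≤s (s≤s (s≤s z≤n))) k≤order)

    ∑-power-1 : ∀ (G : Hypergraph) → ∑ (allFin (order G)) (λ v → diagonalPower 1 (degree G v)) ≈ α * fromℕ (∑ℕ.∑ (allFin (order G)) (degree G))
    ∑-power-1 G = ≈-trans (∑-cong (allFin (order G)) (λ v → *-identityʳ _))
      (≈-trans (≈-sym (∑-*ˡ (allFin (order G)) α)) (*-congˡ (≈-sym (fromℕ-∑ (allFin (order G))))))

    ∑-power-2 : ∀ (G : Hypergraph) → ∑ (allFin (order G)) (λ v → diagonalPower 2 (degree G v)) ≈
      (α * α) * fromℕ (∑ℕ.∑ (allFin (order G)) (λ v → degree G v ℕ.* degree G v))
    ∑-power-2 G = ≈-trans (∑-cong (allFin (order G)) (λ v → ≈-trans (*-congˡ (*-identityʳ _)) (≈-trans (interchange _ _ _ _)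
      (*-congˡ (≈-sym (fromℕ-* (degree G v) (degree G v)))))))
      (≈-trans (≈-sym (∑-*ˡ (allFin (order G)) (α * α))) (*-congˡ (≈-sym (fromℕ-∑ (allFin (order G))))))

    module LargeDegree {w : Fin (order H)} (3≤w : 3 ℕ.≤ degree H w) where

      trace-1 : TX.trace 1 ≈ TH.trace 1
      trace-1 = ≈-trans (TX.trace-below {1} (s≤s z≤n) (s≤s (s≤s z≤n))) (≈-trans
        (*-cong scaling≈ (*-congˡ (≈-trans (∑-power-1 X) (≈-trans (*-congˡ (fromℕ-≡ ∑-degree≡)) (≈-sym (∑-power-1 H))))))
        (≈-sym (TH.trace-below {1} (s≤s z≤n) (s≤s (s≤s z≤n)))))

      trace-2 : TX.trace 2 < TH.trace 2
      trace-2 = <-respˡ-≈ (≈-sym (≈-trans (TX.trace-below {2} (s≤s z≤n) (s≤s (s≤s (s≤s z≤n)))) (*-cong scaling≈ (*-congˡ (∑-power-2 X)))))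
        (<-respʳ-≈ (≈-sym (≈-trans (TH.trace-below {2} (s≤s z≤n) (s≤s (s≤s (s≤s z≤n)))) (*-congˡ (*-congˡ (∑-power-2 H)))))
          (*-monoˡ-< scaling-pos (*-monoˡ-< (ConstantsPositive.diagonalConstant-pos F (suc q) α α<1 2) (*-monoˡ-< (*-pos 0<α 0<α)
            (fromℕ-mono-< (∑-square-< {xs = SX.Vs} {ys = SH.Vs} {f = degree X} {g = degree H} length-Vs ∑-degree≡ (λ v → UX.degree≥1 1≤mˣ v , degree≤2ˣ v) (∈-allFin w) 3≤w))))))

      precedes : X ≺[ k , α ] H
      precedes = order≡ , 2 , s≤s z≤n , ℕ.≤-trans (ℕ.m≤n+m 2 k) index-bound , below , trace-2
        where
        below : ∀ t → t ℕ.< 2 → TX.trace t ≈ TH.trace t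
        below 0 _ = trace-0
        below 1 _ = trace-1
        below (suc (suc _)) (s≤s (s≤s ()))

    module LargeExcess (degree≤2 : ∀ v → degree H v ℕ.≤ 2) {j : Fin (size H)} (3≤j : 3 ℕ.≤ excess H j) where

      module RX = Recognition X 2≤k uniformˣ connectedˣ acyclicˣ 1≤mˣ degree≤2ˣ
      module RH = Recognition H 2≤k uniform connected acyclic 1≤m degree≤2

      degrees-↭ : map (degree X) SX.Vs ↭ map (degree H) SH.Vs
      degrees-↭ = onesAndTwos-↭
        (All.map⁺ (All.universal (λ v → UX.degree≥1 1≤mˣ v , degree≤2ˣ v) SX.Vs))
        (All.map⁺ (All.universal (λ v → UH.degree≥1 1≤m v , degree≤2 v) SH.Vs))
        (≡.trans (List.length-map (degree X) SX.Vs) (≡.trans length-Vs (≡.sym (List.length-map (degree H) SH.Vs))))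
        (≡.trans (∑ℕ.∑-map (degree X) SX.Vs) (≡.trans ∑-degree≡ (≡.sym (∑ℕ.∑-map (degree H) SH.Vs))))

      ∑-degrees : ∀ (f : ℕ → Carrier) → ∑ SX.Vs (λ v → f (degree X v)) ≈ ∑ SH.Vs (λ v → f (degree H v))
      ∑-degrees f = ≈-trans (≈-sym (∑-map (degree X) SX.Vs {f = f})) (≈-trans (∑-↭ degrees-↭) (∑-map (degree H) SH.Vs))

      ∑ℕ-degrees : ∀ (f : ℕ → ℕ) → ∑ℕ.∑ SX.Vs (λ v → f (degree X v)) ≡ ∑ℕ.∑ SH.Vs (λ v → f (degree H v))
      ∑ℕ-degrees f = ≡.trans (≡.sym (∑ℕ.∑-map (degree X) SX.Vs {f = f})) (≡.trans (∑ℕ.∑-↭ degrees-↭) (∑ℕ.∑-map (degree H) SH.Vs))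

      diagonalPart≈ : ∀ D → TX.diagonalPart D ≈ TH.diagonalPart D
      diagonalPart≈ D = *-congˡ (∑-degrees (diagonalPower D))

      degreeSum≡ : TX.degreeSum ≡ TH.degreeSum
      degreeSum≡ = ≡.trans (Incidence.∑∑-edges X (degree X)) (≡.trans (∑ℕ-degrees (λ d → d ℕ.* d)) (≡.sym (Incidence.∑∑-edges H (degree H))))

      squareSum≡ : SX.squareSum ≡ SH.squareSum
      squareSum≡ = ≡.trans SX.squareSum≡ (≡.trans (∑ℕ-degrees (λ d → d ℕ.* (d ℕ.* d))) (≡.sym SH.squareSum≡))

      ∑-excess≡ : ∑ℕ.∑ SX.Es (excess X) ≡ ∑ℕ.∑ SH.Es (excess H)
      ∑-excess≡ = ℕ.+-cancelʳ-≡ 2 _ _ (≡.trans RX.∑-excess (≡.trans (≡.cong (2 ℕ.*_) size≡) (≡.sym RH.∑-excess)))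

      -- An excess of 3 forces 2m ≥ 5. With at least two hyperedges the excesses of X are positive;
      -- an excess 0 would have defect 2 and spoil the comparison of squares.
      2≤m : 2 ℕ.≤ size H
      2≤m = ℕ.*-cancelˡ-≤ 2 (ℕ.≤-trans (ℕ.≤-trans (ℕ.n≤1+n 4) (ℕ.+-monoˡ-≤ 2 (ℕ.≤-trans 3≤j (∑ℕ.∑-≥ {f = excess H} (∈-allFin j)))))
        (ℕ.≤-reflexive RH.∑-excess))

      pairSum< : SX.pairSum ℕ.< SH.pairSum
      pairSum< = ℕ.*-cancelˡ-< 2 _ _ (ℕ.+-cancelˡ-< SX.squareSum _ _ (ℕ.≤-<-trans
        (ℕ.≤-reflexive (SX.squareSum+2pairSum uniformˣ (UX.degree≥1 1≤mˣ)))
        (ℕ.<-≤-trans (ℕ.+-monoʳ-< (k ℕ.* k ℕ.* length SX.Es ℕ.+ 2 ℕ.* k ℕ.* ∑ℕ.∑ SX.Es (excess X)) squares<)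
          (ℕ.≤-reflexive (≡.trans (≡.cong₂ (λ l z → k ℕ.* k ℕ.* l ℕ.+ 2 ℕ.* k ℕ.* z ℕ.+ ∑ℕ.∑ SH.Es (λ j → excess H j ℕ.* excess H j)) length-Es ∑-excess≡)
            (≡.trans (≡.sym (SH.squareSum+2pairSum uniform (UH.degree≥1 1≤m))) (≡.cong (ℕ._+ 2 ℕ.* SH.pairSum) (≡.sym squareSum≡))))))))
        where
        squares< : ∑ℕ.∑ SX.Es (λ j → excess X j ℕ.* excess X j) ℕ.< ∑ℕ.∑ SH.Es (λ j → excess H j ℕ.* excess H j)
        squares< = ∑-square-< {xs = SX.Es} {ys = SH.Es} length-Es ∑-excess≡ (λ j → RX.excess≥1 (ℕ.≤-trans 2≤m (ℕ.≤-reflexive (≡.sym size≡))) j , excess≤2ˣ j) (∈-allFin j) 3≤j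

      trace-k : TX.trace (k ℕ.+ 0) ≈ TH.trace (k ℕ.+ 0)
      trace-k = ≈-trans TX.trace-k (≈-trans (*-cong scaling≈ (+-cong (diagonalPart≈ (k ℕ.+ 0))
        (CommutativeRing.reflexive commutativeRing (≡.cong (λ m → ∑ (allFin m) (λ _ → localConstant (k ℕ.+ 0) [])) size≡)))) (≈-sym TH.trace-k))

      trace-k+1 : TX.trace (k ℕ.+ 1) ≈ TH.trace (k ℕ.+ 1)
      trace-k+1 = ≈-trans TX.trace-k+1 (≈-trans
        (*-cong scaling≈ (+-cong (diagonalPart≈ (k ℕ.+ 1)) (*-congˡ (*-congˡ (fromℕ-≡ degreeSum≡))))) (≈-sym TH.trace-k+1))

      trace-k+2 : TX.trace (k ℕ.+ 2) < TH.trace (k ℕ.+ 2)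
      trace-k+2 = <-respˡ-≈ (≈-sym (≈-trans TX.trace-k+2 (*-cong scaling≈ (+-cong (diagonalPart≈ (k ℕ.+ 2))
          (+-congʳ (*-congˡ (fromℕ-≡ squareSum≡)))))))
        (<-respʳ-≈ (≈-sym TH.trace-k+2) (*-monoˡ-< scaling-pos (+-monoʳ-< _ (+-monoʳ-< _ (*-monoˡ-<
          (*-pos (ConstantsPositive.localConstant-pos F (suc q) α α<1) (*-pos 0<α 0<α)) (fromℕ-mono-< pairSum<))))))

      precedes : X ≺[ k , α ] H
      precedes = order≡ , k ℕ.+ 2 , s≤s z≤n , index-bound , below , trace-k+2
        where
        below : ∀ t → t ℕ.< k ℕ.+ 2 → TX.trace t ≈ TH.trace t
        below zero      _  = trace-0
        below t@(suc _) lt with ℕ.<-cmp t k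
        ... | tri< t<k _ _ = ≈-trans (TX.trace-below {t} (s≤s z≤n) t<k) (≈-trans (*-cong scaling≈ (diagonalPart≈ t)) (≈-sym (TH.trace-below {t} (s≤s z≤n) t<k)))
        ... | tri≈ _ refl _ = ≡.subst (λ t → TX.trace t ≈ TH.trace t) (ℕ.+-identityʳ k) trace-k
        ... | tri> _ _ k<t = ≡.subst (λ t → TX.trace t ≈ TH.trace t)
          (ℕ.≤-antisym (ℕ.≤-trans (ℕ.≤-reflexive (ℕ.+-comm k 1)) k<t) (ℕ.≤-pred (ℕ.≤-trans lt (ℕ.≤-reflexive (ℕ.+-suc k 1))))) trace-k+1

    first : (∀ v → degree H v ℕ.≤ 2) × (∀ j → excess H j ℕ.≤ 2) ⊎ X ≺[ k , α ] H
    first with Fin.any? (λ v → 3 ℕ.≤? degree H v)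
    ... | yes (v , 3≤v) = inj₂ (LargeDegree.precedes {v} 3≤v)
    ... | no no-v with Fin.any? (λ j → 3 ℕ.≤? excess H j)
    ...   | yes (j , 3≤j) = inj₂ (LargeExcess.precedes (λ v → ℕ.≤-pred (ℕ.≰⇒> (λ 3≤v → no-v (v , 3≤v)))) {j} 3≤j)
    ...   | no no-j = inj₁ ((λ v → ℕ.≤-pred (ℕ.≰⇒> (λ 3≤v → no-v (v , 3≤v)))) , (λ j → ℕ.≤-pred (ℕ.≰⇒> (λ 3≤j → no-j (j , 3≤j)))))

open HyperpathRecognition
open HyperpathStructure
open TraceComparison

theorem6p2 : ∀ {c ℓ₁ ℓ₂} (ℝ : RealNumbers c ℓ₁ ℓ₂) →
    let open RealNumbers ℝ
        open Spectral orderedField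
    in
    ∀ (k m : ℕ) → 3 ℕ.≤ k → 1 ℕ.≤ m →
    ∀ (α : Carrier) → 0# < α → α < 1# →
    IsFirst k α (UniformHypertree k m) (hyperpath k m)
theorem6p2 ℝ k@(suc (suc (suc q))) m 3≤k@(s≤s (s≤s (s≤s _))) 1≤m α 0<α α<1 = isHypertree , least
  where
  open RealNumbers ℝ using (orderedField)
  open Spectral orderedField
  2≤k : 2 ℕ.≤ k
  2≤k = ℕ.<⇒≤ 3≤k
  module P = Hyperpath {k} 2≤k m
  isHypertree : UniformHypertree k m (hyperpath k m)
  isHypertree = record { uniform = P.uniform ; hypertree = P.connected , P.acyclic ; size≡m = refl }
  least : ∀ H → UniformHypertree k m H → ¬ (hyperpath k m ≅ H) → hyperpath k m ≺[ k , α ] H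
  least H record { uniform = uniform ; hypertree = connected , acyclic ; size≡m = refl } X≇H = [ isomorphic , id ]′
    (MinimalDegreesFirst.first orderedField q α 0<α α<1 (hyperpath k (size H)) H refl 1≤m 1≤m
      P.uniform P.connected P.acyclic P.degree≤2 P.excess≤2 uniform connected acyclic)
    where
    isomorphic : (∀ v → degree H v ℕ.≤ 2) × (∀ j → excess H j ℕ.≤ 2) → hyperpath k (size H) ≺[ k , α ] H
    isomorphic (degree≤2 , excess≤2) =
      -- If no trace separates them, H obeys the same bounds on degrees and excesses and is
      -- therefore itself a hyperpath.
      ⊥-elim (X≇H (Recognition.hyperpath≅ H 2≤k uniform connected acyclic 1≤m degree≤2 excess≤2))
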